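{- Let $\mathcal S$ be a hereditary class of binary relational structures, $\psi$ a CMSO sentence over the vocabulary of $\mathcal S$, and $I$ a simple hereditary CMSO interpretation of $\mathcal S$ into a class $\mathcal T$ of rooted labelled binary trees. Suppose there exists a simple hereditary CMSO interpretation $J$ of $\mathcal S$ into the class $\mathcal U$ of rooted labelled trees of fixed height $h$. Then there is a finite deterministic tree automaton $\mathcal A_{\psi,I}$ accepting exactly those $T\in\mathcal T$ with $T\models\psi^I$, and the number of states of $\mathcal A_{\psi,I}$ is at most $\mathrm{tow}_{h+1}\big(\mathcal O(M+|\psi^J|+\iota)^2\big)$, where $\psi^J$ is the translation of $\psi$ under $J$, $M$ is the least common multiple of the values $b$ of all predicates $\mathrm{mod}_{a,b}$ occurring in $\psi^J$, and $\iota$ is a constant depending on $I$ and $\mathcal T$ but not on $\psi$.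
   Context: CMSO is monadic second-order logic extended with predicates $\mathrm{mod}_{a,b}(X)$ (the set $X$ has $a$ modulo $b$ elements). A class of structures is hereditary if closed under induced substructures. Rooted trees are structures with a parent–child relation; labels are unary predicates; the height of a rooted tree is its largest root-to-node distance. A simple interpretation of a vocabulary $\tau$ into a vocabulary $\sigma$ is a tuple $I=(\nu(x),\{\eta_R(\bar x)\}_{R\in\tau})$ of CMSO$[\sigma]$ formulas, $\nu$ with one free variable and $\eta_R$ with as many free variables as the arity of $R$. To a $\sigma$-structure $A$ it assigns the $\tau$-structure $A^I$ with domain $\{a: A\models\nu(a)\}$ and relations $R^I=\{\bar a: A\models\eta_R(\bar a)\}$. A class $\mathcal C$ has an interpretation $I$ into a class $\mathcal D$ if every $C\in\mathcal C$ is isomorphic to $D^I$ for some $D\in\mathcal D$ and every $D^I$ ($D\in\mathcal D$) is isomorphic to a member of $\mathcal C$. The translation $\psi^I$ of a $\tau$-formula $\psi$ replaces $\exists x.\phi$ by $\exists x(\nu(x)\wedge\phi^I)$, $\exists X.\phi$ by $\exists X(\forall y(y\in X\to\nu(y))\wedge\phi^I)$, and each atom $R(\bar x)$ by $\eta_R(\bar x)$; then $A\models\psi^I$ iff $A^I\models\psi$. An interpretation $I$ of $\mathcal S$ into a class of rooted trees is hereditary if, whenever $S\in\mathcal S$ is interpreted in a tree $T$ with domain $D\subseteq V(T)$, every rooted subtree $T'\subseteq T$ interprets under $I$ the restriction of $S$ to $D\cap V(T')$. $\mathrm{tow}_0(x)=x$, $\mathrm{tow}_{i+1}(x)=2^{\mathrm{tow}_i(x)}$;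 $|\psi^J|$ denotes the length of the formula $\psi^J$. -}

module Defs where

open import Data.Nat using (ℕ; zero; suc; _+_; _*_; _^_; _≤_; _⊔_; NonZero; _≡ᵇ_)
open import Data.Nat.DivMod using (_%_)
open import Data.Nat.LCM using (lcm)
open import Data.Fin using (Fin; zero; suc; toℕ)
open import Data.Bool using (Bool; true; false)
open import Data.Vec using (Vec; []; _∷_; lookup; map)
open import Data.List using (List; []; _∷_; _++_; length; foldr)
import Data.List as List
open import Data.Maybe using (Maybe; just; nothing)
open import Data.Product using (Σ; _×_; _,_)
open import Data.Empty using (⊥)
open import Relation.Nullary using (¬_)
open import Relation.Binary.PropositionalEquality using (_≡_)
open import Function.Bundles using (_⇔_)
open import Function.Definitions using (Injective)
open import Data.List.Relation.Binary.Permutation.Propositional using (_↭_)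

tow : ℕ → ℕ → ℕ
tow zero    x = x
tow (suc i) x = 2 ^ tow i x

record Voc : Set where
  field
    nrel : ℕ
    ar   : Fin nrel → ℕ
open Voc public

BinVoc : ℕ → Voc
BinVoc r = record { nrel = r ; ar = λ _ → 2 }

-- vocabulary of rooted trees with L labels:
-- symbol 0 = parent–child relation E(x,y) "x is the parent of y",
-- symbols 1..L = unary label predicates
treeAr : (L : ℕ) → Fin (suc L) → ℕ
treeAr L zero    = 2
treeAr L (suc _) = 1

TreeVoc : ℕ → Voc
TreeVoc L = record { nrel = suc L ; ar = treeAr L }

record Structure (V : Voc) : Set where
  field
    size : ℕ
    rel  : (R : Fin (nrel V)) → Vec (Fin size) (ar V R) → Bool
open Structure public

InducedSub : {V : Voc} → Structure V → Structure V → Set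
InducedSub {V} B A =
  Σ (Fin (size B) → Fin (size A)) λ g → Injective _≡_ _≡_ g ×
    (∀ (R : Fin (nrel V)) (t : Vec (Fin (size B)) (ar V R)) →
       rel B R t ≡ rel A R (map g t))

Hereditary : {V : Voc} → (Structure V → Set) → Set
Hereditary {V} 𝒮 = ∀ (A B : Structure V) → 𝒮 A → InducedSub B A → 𝒮 B

-- CMSO formulas, de Bruijn indexed: m first-order, k second-order
-- variables in scope (index zero = most recently bound).

data Form (V : Voc) (m k : ℕ) : Set where
  atom : (R : Fin (nrel V)) → Vec (Fin m) (ar V R) → Form V m k
  eq   : Fin m → Fin m → Form V m k
  mem  : Fin m → Fin k → Form V m k
  modp : (a b : ℕ) → .{{_ : NonZero b}} → Fin k → Form V m k
  neg  : Form V m k → Form V m k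
  and  : Form V m k → Form V m k → Form V m k
  ex1  : Form V (suc m) k → Form V m k
  ex2  : Form V m (suc k) → Form V m k

len : {V : Voc} {m k : ℕ} → Form V m k → ℕ
len {V} (atom R _) = suc (ar V R)
len (eq _ _)      = 3
len (mem _ _)     = 3
len (modp _ _ _)  = 2
len (neg φ)       = suc (len φ)
len (and φ ψ)     = suc (len φ + len ψ)
len (ex1 φ)       = 2 + len φ
len (ex2 φ)       = 2 + len φ

moduli : {V : Voc} {m k : ℕ} → Form V m k → List ℕ
moduli (atom _ _)    = []
moduli (eq _ _)     = []
moduli (mem _ _)    = []
moduli (modp _ b _) = b ∷ []
moduli (neg φ)      = moduli φ
moduli (and φ ψ)    = moduli φ ++ moduli ψ
moduli (ex1 φ)      = moduli φ
moduli (ex2 φ)      = moduli φ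

lcmMod : {V : Voc} {m k : ℕ} → Form V m k → ℕ
lcmMod φ = foldr lcm 1 (moduli φ)

-- Semantics, relativised to a subset U of the domain (this is exactly the
-- semantics in the induced substructure on U).

ext : {A : Set} {m : ℕ} → A → (Fin m → A) → Fin (suc m) → A
ext a ρ zero    = a
ext a ρ (suc i) = ρ i

fin0 : {A : Set} → Fin 0 → A
fin0 ()

card : {n : ℕ} → (Fin n → Bool) → ℕ
card {zero}  X = 0
card {suc n} X with X zero
... | true  = suc (card (λ i → X (suc i)))
... | false = card (λ i → X (suc i))

full : {n : ℕ} → Fin n → Bool
full _ = true

SatIn : {V : Voc} (A : Structure V) (U : Fin (size A) → Bool) {m k : ℕ} →
        (Fin m → Fin (size A)) → (Fin k → (Fin (size A) → Bool)) →
        Form V m k → Set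
SatIn A U ρ σ (atom R xs)   = rel A R (map ρ xs) ≡ true
SatIn A U ρ σ (eq x y)     = ρ x ≡ ρ y
SatIn A U ρ σ (mem x X)    = σ X (ρ x) ≡ true
SatIn A U ρ σ (modp a b X) = card (σ X) % b ≡ a % b
SatIn A U ρ σ (neg φ)      = ¬ SatIn A U ρ σ φ
SatIn A U ρ σ (and φ ψ)    = SatIn A U ρ σ φ × SatIn A U ρ σ ψ
SatIn A U ρ σ (ex1 φ)      =
  Σ (Fin (size A)) λ a → U a ≡ true × SatIn A U (ext a ρ) σ φ
SatIn A U ρ σ (ex2 φ)      =
  Σ (Fin (size A) → Bool) λ X → (∀ a → X a ≡ true → U a ≡ true) ×
    SatIn A U ρ (ext X σ) φ

_⊨_ : {V : Voc} → Structure V → Form V 0 0 → Set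
A ⊨ φ = SatIn A full fin0 fin0 φ

liftR : {m m' : ℕ} → (Fin m → Fin m') → Fin (suc m) → Fin (suc m')
liftR f zero    = zero
liftR f (suc i) = suc (f i)

ren : {V : Voc} {m m' k k' : ℕ} → (Fin m → Fin m') → (Fin k → Fin k') →
      Form V m k → Form V m' k'
ren f g (atom R xs)   = atom R (map f xs)
ren f g (eq x y)     = eq (f x) (f y)
ren f g (mem x X)    = mem (f x) (g X)
ren f g (modp a b X) = modp a b (g X)
ren f g (neg φ)      = neg (ren f g φ)
ren f g (and φ ψ)    = and (ren f g φ) (ren f g ψ)
ren f g (ex1 φ)      = ex1 (ren (liftR f) g φ)
ren f g (ex2 φ)      = ex2 (ren f (liftR g) φ)

record Interp (τ σ : Voc) : Set where
  field
    ν : Form σ 1 0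
    η : (R : Fin (nrel τ)) → Form σ (ar τ R) 0
open Interp public

translate : {τ σ : Voc} {m k : ℕ} → Interp τ σ → Form τ m k → Form σ m k
translate I (atom R xs)   = ren (lookup xs) fin0 (η I R)
translate I (eq x y)     = eq x y
translate I (mem x X)    = mem x X
translate I (modp a b X) = modp a b X
translate I (neg φ)      = neg (translate I φ)
translate I (and φ ψ)    = and (translate I φ) (translate I ψ)
translate I (ex1 φ)      = ex1 (and (ren (λ _ → zero) fin0 (ν I)) (translate I φ))
translate I (ex2 φ)      =
  ex2 (and (neg (ex1 (and (mem zero zero) (neg (ren (λ _ → zero) fin0 (ν I))))))
           (translate I φ))

IsInterpretedBy : {τ σ : Voc} → Interp τ σ → Structure σ → Structure τ → Set
IsInterpretedBy {τ} I A C =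
  Σ (Fin (size C) → Fin (size A)) λ f →
    Injective _≡_ _≡_ f ×
    (∀ c → SatIn A full (λ _ → f c) fin0 (ν I)) ×
    (∀ a → SatIn A full (λ _ → a) fin0 (ν I) → Σ (Fin (size C)) λ c → f c ≡ a) ×
    (∀ (R : Fin (nrel τ)) (t : Vec (Fin (size C)) (ar τ R)) →
       (rel C R t ≡ true) ⇔ SatIn A full (lookup (map f t)) fin0 (η I R))

-- Rooted labelled trees (node labels = set of unary predicates holding)

Lab : ℕ → Set
Lab L = Fin L → Bool

data Tree (L : ℕ) : Set where
  node : Lab L → List (Tree L) → Tree L

mutual
  height : {L : ℕ} → Tree L → ℕ
  height (node _ ts) = heightL ts

  heightL : {L : ℕ} → List (Tree L) → ℕ
  heightL []       = 0
  heightL (t ∷ ts) = suc (height t) ⊔ heightL ts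

mutual
  IsBinary : {L : ℕ} → Tree L → Set
  IsBinary (node _ ts) = length ts ≤ 2 × AllBinary ts

  AllBinary : {L : ℕ} → List (Tree L) → Set
  AllBinary []       = Data.Unit.⊤ where import Data.Unit
  AllBinary (t ∷ ts) = IsBinary t × AllBinary ts

-- preorder flattening: entries (label, index of parent)
mutual
  flat : {L : ℕ} → Tree L → Maybe ℕ → ℕ → List (Lab L × Maybe ℕ)
  flat (node l ts) p i = (l , p) ∷ flatL ts i (suc i)

  flatL : {L : ℕ} → List (Tree L) → ℕ → ℕ → List (Lab L × Maybe ℕ)
  flatL []       p j = []
  flatL (t ∷ ts) p j = flat t (just p) j ++ flatL ts p (j + length (flat t (just p) j))

nodes : {L : ℕ} → Tree L → List (Lab L × Maybe ℕ)
nodes t = flat t nothing 0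

isParent : ℕ → Maybe ℕ → Bool
isParent x (just p) = x ≡ᵇ p
isParent x nothing  = false

treeRel : {L : ℕ} (t : Tree L) (R : Fin (suc L)) →
          Vec (Fin (length (nodes t))) (treeAr L R) → Bool
treeRel t zero    (x ∷ y ∷ []) = isParent (toℕ x) (Data.Product.proj₂ (List.lookup (nodes t) y))
treeRel t (suc i) (x ∷ [])     = Data.Product.proj₁ (List.lookup (nodes t) x) i

treeStr : {L : ℕ} → Tree L → Structure (TreeVoc L)
treeStr {L} t = record { size = length (nodes t) ; rel = treeRel t }

RootedSub : {L : ℕ} (t : Tree L) → (Fin (size (treeStr t)) → Bool) → Set
RootedSub t X =
  (Σ (Fin (size (treeStr t))) λ y → X y ≡ true) ×
  (∀ x y → rel (treeStr t) zero (x ∷ y ∷ []) ≡ true → X y ≡ true → X x ≡ true)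

InterpClass : {τ : Voc} {L : ℕ} → Interp τ (TreeVoc L) →
              (Structure τ → Set) → (Tree L → Set) → Set
InterpClass I 𝒮 𝒟 =
  (∀ C → 𝒮 C → Σ _ λ D → 𝒟 D × IsInterpretedBy I (treeStr D) C) ×
  (∀ D → 𝒟 D → Σ _ λ C → 𝒮 C × IsInterpretedBy I (treeStr D) C)

-- hereditary: for T in the class and every rooted subtree T' (node set X),
-- T'^I is exactly the restriction of T^I to (domain of T^I) ∩ X.
HereditaryInterp : {τ : Voc} {L : ℕ} → Interp τ (TreeVoc L) → (Tree L → Set) → Set
HereditaryInterp {τ} I 𝒟 =
  ∀ T → 𝒟 T → ∀ X → RootedSub T X →
    (∀ a → X a ≡ true →
       SatIn (treeStr T) full (λ _ → a) fin0 (ν I) ⇔ SatIn (treeStr T) X (λ _ → a) fin0 (ν I)) ×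
    (∀ (R : Fin (nrel τ)) (t : Vec (Fin (size (treeStr T))) (ar τ R)) →
       (∀ i → X (lookup t i) ≡ true) →
       (∀ i → SatIn (treeStr T) full (λ _ → lookup t i) fin0 (ν I)) →
       SatIn (treeStr T) full (lookup t) fin0 (η I R) ⇔ SatIn (treeStr T) X (lookup t) fin0 (η I R))

record DTA (L : ℕ) : Set where
  field
    states : ℕ
    δ      : Lab L → List (Fin states) → Fin states
    acc    : Fin states → Bool
    -- children are unordered: transitions do not depend on child order
    δ-perm : ∀ l xs ys → xs ↭ ys → δ l xs ≡ δ l ys
open DTA public

mutual
  run : {L : ℕ} (𝒜 : DTA L) → Tree L → Fin (states 𝒜)
  run 𝒜 (node l ts) = δ 𝒜 l (runL 𝒜 ts)

  runL : {L : ℕ} (𝒜 : DTA L) → List (Tree L) → List (Fin (states 𝒜))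
  runL 𝒜 []       = []
  runL 𝒜 (t ∷ ts) = run 𝒜 t ∷ runL 𝒜 ts

Accepts : {L : ℕ} → DTA L → Tree L → Set
Accepts 𝒜 t = acc 𝒜 (run 𝒜 t) ≡ true

module Submission where

-- The type of a coloured structure records what n rounds of the Ehrenfeucht–Fraïssé game, played
-- with sets, can tell about it.  Types are finite data, and the type of a structure glued from
-- two parts by rules depending only on colours is computed from the types of the parts.
--
-- Let T be a tree on which I is evaluated and T′ a subtree.  Colour a node x of T′ by the
-- types of T′ with x marked.  The part of T^I inside T′ then depends on the rest of T only
-- through a context (which types of T′ with two marked nodes lead to acceptance of the formulas
-- of I), and the parts inside the two subtrees of a node are glued by a rule depending on
-- colours.  Hence the type of T^I for ψ can be computed bottom-up by a state which holds the
-- type of T′ and, for every context, the type of the induced part.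
--
-- The induced part lies in 𝒮, so it is interpreted through J in a coloured tree of height at
-- most h, whose type determines the type of the part.  In such a tree the number of isomorphic
-- siblings matters only up to a threshold and modulo M, because a set move splits a long list of
-- equal siblings into few classes one of which is again long.  This leaves a tower of height
-- h + 1 of types, and the states only have to name representatives of these types; the finitely
-- many contexts and types for I are absorbed in ι.

open import Defs
open import Data.Bool using (Bool; true; false; _∧_; _∨_; not; if_then_else_)
open import Data.Bool.Properties using (∨-zeroʳ; ∨-assoc; ∨-comm; ∨-idem)
open import Data.Empty using (⊥; ⊥-elim; ⊥-elim-irr)
open import Data.Fin using (Fin; zero; suc; toℕ; fromℕ<; combine; remQuot; splitAt; funToFin; finToFun; _↑ˡ_; _↑ʳ_)
open import Data.Fin.Properties using (_≟_; any?; suc-injective; toℕ<n; toℕ-injective; toℕ-fromℕ<; toℕ-↑ˡ; toℕ-↑ʳ;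
  ↑ˡ-injective; ↑ʳ-injective; splitAt-↑ˡ; splitAt-↑ʳ; join-splitAt; remQuot-combine; combine-remQuot;
  finToFun-funToFin; funToFin-finToFin)
open import Data.List as List using (List; []; _∷_; _++_; length; map; foldr; replicate; allFin; cartesianProductWith)
open import Data.List.Membership.Propositional using (_∈_)
open import Data.List.Membership.Propositional.Properties using (∈-++⁺ˡ; ∈-++⁺ʳ; ∈-++⁻; ∈-allFin; ∈-cartesianProductWith⁺)
open import Data.List.Properties using (length-++; length-map; length-replicate)
open import Data.List.Relation.Binary.Permutation.Propositional as ↭ using (_↭_)
open import Data.List.Relation.Binary.Permutation.Propositional.Properties
  using (↭-length; ↭-empty-inv; ↭-singleton-inv; drop-∷; ∈-resp-↭)
open import Data.List.Relation.Unary.All as All using (All; []; _∷_)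
open import Data.List.Relation.Unary.All.Properties as All using ()
open import Data.List.Relation.Unary.Any as Any using (here; there)
open import Data.Maybe as Maybe using (Maybe; just; nothing; fromMaybe)
open import Data.Nat using (ℕ; zero; suc; _+_; _*_; _^_; _⊔_; _≤_; _<_; _<?_; _≡ᵇ_; z≤n; s≤s; s≤s⁻¹; NonZero; ≢-nonZero; >-nonZero)
open import Data.Nat.DivMod using (_%_; _/_; _mod_; m%n<n; m%n%n≡m%n; %-distribˡ-+; m∣n⇒o%n%m≡o%m; [m+kn]%n≡m%n; m<n⇒m%n≡m; m≡m%n+[m/n]*n)
open import Data.Nat.Divisibility using (_∣_; ∣-trans; 0∣⇒≡0; m∣m*n; n∣m*n)
open import Data.Nat.LCM using (lcm; m∣lcm[m,n]; n∣lcm[m,n]; lcm-least)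
open import Data.Nat.Properties as ℕ using (+-comm; +-assoc; +-identityʳ; +-suc; ≡ᵇ⇒≡; ≡⇒≡ᵇ)
open import Algebra.Properties.CommutativeSemigroup ℕ.+-commutativeSemigroup using (interchange; x∙yz≈y∙xz)
open import Data.Nat.Solver using (module +-*-Solver)
open import Data.Product using (Σ; ∃; _×_; _,_; proj₁; proj₂)
open import Data.Sum using (_⊎_; inj₁; inj₂; [_,_]′)
open import Data.Unit using (⊤; tt)
open import Data.Vec as Vec using (Vec; []; _∷_; lookup)
open import Data.Vec.Properties using (lookup-map; map-∘; map-cong)
open import Function using (_∘_; id)
open import Function.Bundles using (_⇔_; Equivalence; mk⇔)
open import Function.Definitions using (Injective)
open import Relation.Binary.PropositionalEquality
open import Relation.Nullary using (yes; no; ¬_)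
open import Relation.Nullary.Decidable using (⌊_⌋)

-- Written out in full, types for ψ would cost a tower that grows with the quantifier depth of ψ.
-- States therefore hold indices of representatives, and the height of the tower comes from `h`
-- alone. For this the multiplicity of a subtree must be bounded without regard to its size: what
-- matters is the number of outcomes of a set move, which gluing multiplies (`HW`), and whose
-- logarithm grows by one exponential per level. The automaton meets parts of interpreted
-- structures, while `J` describes only members of 𝒮. A state is therefore correct only for contexts
-- whose part is in 𝒮 and may hold anything for the others. Representatives need not be trees of 𝒰,
-- nor their interpretations members of 𝒮: only types are compared. Only what occurs in the
-- translation under `J` can be charged to its length. So relations that ψ does not mention are
-- masked, and labels that the translation does not mention are dropped from the colours. The square
-- in the bound is the product of the number of rounds and the logarithm of the number of colours,
-- both linear in the base; the estimate 5 * 6 + 19 = 7 ^ 2 yields the constant 7.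

⇔→≡ : ∀ {a b : Bool} → (a ≡ true → b ≡ true) → (b ≡ true → a ≡ true) → a ≡ b
⇔→≡ {true}  f g = sym (f refl)
⇔→≡ {false} {true}  f g = g refl
⇔→≡ {false} {false} f g = refl

∧-intro : ∀ {a b} → a ≡ true → b ≡ true → a ∧ b ≡ true
∧-intro refl refl = refl

∧-elim : ∀ {a b} → a ∧ b ≡ true → a ≡ true × b ≡ true
∧-elim {true} {true} refl = refl , refl

∨-introˡ : ∀ {a b} → a ≡ true → a ∨ b ≡ true
∨-introˡ refl = refl

∨-introʳ : ∀ {a b} → b ≡ true → a ∨ b ≡ true
∨-introʳ {a} refl = ∨-zeroʳ a

∨-elim : ∀ {a b} → a ∨ b ≡ true → a ≡ true ⊎ b ≡ true
∨-elim {true}  p = inj₁ refl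
∨-elim {false} p = inj₂ p

-- Opaque copies of ∧ and ∨: being neutral, they can be unified argument by argument.
infixr 6 _and′_
infixr 5 _or′_
abstract
  _and′_ _or′_ : Bool → Bool → Bool
  _and′_ = _∧_
  _or′_  = _∨_

  and-intro : ∀ {a b} → a ≡ true → b ≡ true → (a and′ b) ≡ true
  and-intro = ∧-intro

  and-elim : ∀ {a b} → (a and′ b) ≡ true → a ≡ true × b ≡ true
  and-elim = ∧-elim

  or-introˡ : ∀ {a b} → a ≡ true → (a or′ b) ≡ true
  or-introˡ = ∨-introˡ

  or-introʳ : ∀ {a b} → b ≡ true → (a or′ b) ≡ true
  or-introʳ {a} = ∨-introʳ {a}

  or-elim : ∀ {a b} → (a or′ b) ≡ true → a ≡ true ⊎ b ≡ true
  or-elim = ∨-elim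

  or-comm : ∀ a b → (a or′ b) ≡ (b or′ a)
  or-comm = ∨-comm

_≡ᶠ_ : ∀ {n} → Fin n → Fin n → Bool
i ≡ᶠ j = ⌊ i ≟ j ⌋

≡ᶠ-sound : ∀ {n} {i j : Fin n} → (i ≡ᶠ j) ≡ true → i ≡ j
≡ᶠ-sound {i = i} {j} e with i ≟ j
... | yes p = p

≡ᶠ-refl : ∀ {n} (i : Fin n) → (i ≡ᶠ i) ≡ true
≡ᶠ-refl i with i ≟ i
... | yes _ = refl
... | no ¬p = ⊥-elim (¬p refl)

-- Search, sums and cardinalities over finite sets

anyᶠ : ∀ {n} → (Fin n → Bool) → Bool
anyᶠ {zero}  P = false
anyᶠ {suc n} P = P zero ∨ anyᶠ (P ∘ suc)

anyᶠ-intro : ∀ {n} (P : Fin n → Bool) i → P i ≡ true → anyᶠ P ≡ true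
anyᶠ-intro P zero    p = ∨-introˡ p
anyᶠ-intro P (suc i) p = ∨-introʳ {P zero} (anyᶠ-intro (P ∘ suc) i p)

anyᶠ-elim : ∀ {n} (P : Fin n → Bool) → anyᶠ P ≡ true → ∃ λ i → P i ≡ true
anyᶠ-elim {suc n} P p with ∨-elim {P zero} p
... | inj₁ q = zero , q
... | inj₂ q = let i , r = anyᶠ-elim (P ∘ suc) q in suc i , r

anyˢ : ∀ {n} → ((Fin n → Bool) → Bool) → Bool
anyˢ {zero}  P = P fin0
anyˢ {suc n} P = anyˢ (P ∘ ext true) ∨ anyˢ (P ∘ ext false)

-- `anyˢ` visits only sets built by `ext`. An arbitrary set is merely pointwise equal to one of
-- them, so `P` has to respect pointwise equality.
anyˢ-intro : ∀ {n} (P : (Fin n → Bool) → Bool) → (∀ {X Y} → X ≗ Y → P X ≡ P Y) →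
             ∀ X → P X ≡ true → anyˢ P ≡ true
anyˢ-intro {zero}  P P-ext X p = trans (P-ext λ ()) p
anyˢ-intro {suc n} P P-ext X p = go (X zero) refl
  where
  P-ext′ : ∀ b {Y Z} → Y ≗ Z → P (ext b Y) ≡ P (ext b Z)
  P-ext′ b e = P-ext λ { zero → refl ; (suc i) → e i }
  step : ∀ b → X zero ≡ b → anyˢ (P ∘ ext b) ≡ true
  step b e = anyˢ-intro (P ∘ ext b) (P-ext′ b) (X ∘ suc)
    (trans (P-ext λ { zero → sym e ; (suc i) → refl }) p)
  go : ∀ b → X zero ≡ b → anyˢ P ≡ true
  go true  e = ∨-introˡ (step true e)
  go false e = ∨-introʳ {anyˢ (P ∘ ext true)} (step false e)

anyˢ-elim : ∀ {n} (P : (Fin n → Bool) → Bool) → anyˢ P ≡ true → ∃ λ X → P X ≡ true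
anyˢ-elim {zero}  P p = fin0 , p
anyˢ-elim {suc n} P p with ∨-elim {anyˢ (P ∘ ext true)} p
... | inj₁ q = let X , r = anyˢ-elim (P ∘ ext true) q in ext true X , r
... | inj₂ q = let X , r = anyˢ-elim (P ∘ ext false) q in ext false X , r

b2n : Bool → ℕ
b2n true  = 1
b2n false = 0

sumᶠ : ∀ {n} → (Fin n → ℕ) → ℕ
sumᶠ {zero}  f = 0
sumᶠ {suc n} f = f zero + sumᶠ (f ∘ suc)

sumᶠ-cong : ∀ {n} {f g : Fin n → ℕ} → f ≗ g → sumᶠ f ≡ sumᶠ g
sumᶠ-cong {zero}  e = refl
sumᶠ-cong {suc n} e = cong₂ _+_ (e zero) (sumᶠ-cong (e ∘ suc))

sumᶠ-0 : ∀ n → sumᶠ {n} (λ _ → 0) ≡ 0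
sumᶠ-0 zero    = refl
sumᶠ-0 (suc n) = sumᶠ-0 n

sumᶠ-+ : ∀ {n} (f g : Fin n → ℕ) → sumᶠ (λ i → f i + g i) ≡ sumᶠ f + sumᶠ g
sumᶠ-+ {zero}  f g = refl
sumᶠ-+ {suc n} f g =
  trans (cong (f zero + g zero +_) (sumᶠ-+ (f ∘ suc) (g ∘ suc)))
        (interchange (f zero) (g zero) (sumᶠ (f ∘ suc)) (sumᶠ (g ∘ suc)))

suc-≡ᶠ : ∀ {n} (i j : Fin n) → (suc i ≡ᶠ suc j) ≡ (i ≡ᶠ j)
suc-≡ᶠ i j = ⇔→≡ (λ e → subst (λ z → (i ≡ᶠ z) ≡ true) (suc-injective (≡ᶠ-sound {i = suc i} e)) (≡ᶠ-refl i))
                 (λ e → subst (λ z → (suc i ≡ᶠ suc z) ≡ true) (≡ᶠ-sound {i = i} e) (≡ᶠ-refl (suc i)))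

sumᶠ-δ : ∀ {n} (P : Fin n → Bool) i → sumᶠ (λ j → if P j then b2n (i ≡ᶠ j) else 0) ≡ b2n (P i)
sumᶠ-δ {suc n} P zero = trans (cong₂ _+_ (lem (P zero)) (trans (sumᶠ-cong {f = λ j → if P (suc j) then 0 else 0} lem′) (sumᶠ-0 n))) (+-identityʳ _)
  where
  lem : ∀ b → (if b then 1 else 0) ≡ b2n b
  lem true = refl
  lem false = refl
  lem′ : ∀ j → (if P (suc j) then 0 else 0) ≡ 0
  lem′ j with P (suc j)
  ... | true = refl
  ... | false = refl
sumᶠ-δ {suc n} P (suc i) = cong₂ _+_ lem (trans (sumᶠ-cong λ j → cong (λ b → if P (suc j) then b2n b else 0) (suc-≡ᶠ i j)) (sumᶠ-δ (P ∘ suc) i))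
  where
  lem : (if P zero then 0 else 0) ≡ 0
  lem with P zero
  ... | true = refl
  ... | false = refl

sumᶠ-single : ∀ {n} (f : Fin n → ℕ) i → sumᶠ (λ j → if j ≡ᶠ i then f j else 0) ≡ f i
sumᶠ-single {suc n} f zero    = trans (cong (f zero +_) (sumᶠ-0 n)) (+-identityʳ _)
sumᶠ-single {suc n} f (suc i) =
  trans (sumᶠ-cong λ j → cong (λ b → if b then f (suc j) else 0) (suc-≡ᶠ j i)) (sumᶠ-single (f ∘ suc) i)

card-suc : ∀ {n} (X : Fin (suc n) → Bool) → card X ≡ b2n (X zero) + card (X ∘ suc)
card-suc X with X zero
... | true  = refl
... | false = refl

card-cong : ∀ {n} {X Y : Fin n → Bool} → X ≗ Y → card X ≡ card Y
card-cong {zero}  e = refl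
card-cong {suc n} {X} {Y} e = trans (card-suc X)
  (trans (cong₂ _+_ (cong b2n (e zero)) (card-cong (e ∘ suc))) (sym (card-suc Y)))

card-∅ : ∀ n → card {n} (λ _ → false) ≡ 0
card-∅ zero    = refl
card-∅ (suc n) = card-∅ n

card-↑ : ∀ m {n} (X : Fin (m + n) → Bool) → card X ≡ card (X ∘ (_↑ˡ n)) + card (X ∘ (m ↑ʳ_))
card-↑ zero    X = refl
card-↑ (suc m) {n} X = begin
  card X                                   ≡⟨ card-suc X ⟩
  b2n (X zero) + card (X ∘ suc)            ≡⟨ cong (b2n (X zero) +_) (card-↑ m (X ∘ suc)) ⟩
  b2n (X zero) + (card (X ∘ suc ∘ (_↑ˡ n)) + card (X ∘ suc ∘ (m ↑ʳ_)))
    ≡⟨ +-assoc (b2n (X zero)) _ _ ⟨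
  b2n (X zero) + card (X ∘ suc ∘ (_↑ˡ n)) + card (X ∘ (suc m ↑ʳ_))
    ≡⟨ cong (_+ card (X ∘ (suc m ↑ʳ_))) (card-suc (X ∘ (_↑ˡ n))) ⟨
  card (X ∘ (_↑ˡ n)) + card (X ∘ (suc m ↑ʳ_)) ∎
  where open ≡-Reasoning

remove : ∀ {n} → Fin n → (Fin n → Bool) → Fin n → Bool
remove i X j = if i ≡ᶠ j then false else X j

card-remove : ∀ {n} (i : Fin n) (X : Fin n → Bool) → card X ≡ b2n (X i) + card (remove i X)
card-remove {suc n} zero X = trans (card-suc X) (cong (b2n (X zero) +_) (sym (trans (card-suc (remove zero X)) refl)))
card-remove {suc n} (suc i) X = begin
  card X                                    ≡⟨ card-suc X ⟩
  x₀ + card (X ∘ suc)                       ≡⟨ cong (x₀ +_) (card-remove i (X ∘ suc)) ⟩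
  x₀ + (xᵢ + card (remove i (X ∘ suc)))     ≡⟨ x∙yz≈y∙xz x₀ xᵢ _ ⟩
  xᵢ + (x₀ + card (remove i (X ∘ suc)))
    ≡⟨ cong (λ z → xᵢ + (x₀ + z)) (card-cong λ j → cong (λ b → if b then false else X (suc j)) (suc-≡ᶠ i j)) ⟨
  xᵢ + (x₀ + card (remove (suc i) X ∘ suc)) ≡⟨ cong (xᵢ +_) (card-suc (remove (suc i) X)) ⟨
  xᵢ + card (remove (suc i) X)              ∎
  where
  open ≡-Reasoning
  x₀ = b2n (X zero)
  xᵢ = b2n (X (suc i))

-- Induction on the domain of `f`: the point `f zero` is counted and removed from `X`; by
-- injectivity no other value of `f` is affected.
card-image : ∀ {m n} (f : Fin m → Fin n) → Injective _≡_ _≡_ f → (X : Fin n → Bool) →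
             (∀ y → X y ≡ true → ∃ λ x → f x ≡ y) → card X ≡ card (X ∘ f)
card-image {zero} {n} f inj X cov = trans (card-cong empty) (card-∅ n)
  where
  empty : ∀ y → X y ≡ false
  empty y with X y in e
  ... | false = refl
  ... | true with () ← proj₁ (cov y e)
card-image {suc m} f inj X cov = trans (card-remove (f zero) X)
  (trans (cong (b2n (X (f zero)) +_) (trans
     (card-image (f ∘ suc) (λ e → suc-injective (inj e)) (remove (f zero) X) cov′)
     (card-cong same)))
   (sym (card-suc (X ∘ f))))
  where
  cov′ : ∀ y → remove (f zero) X y ≡ true → ∃ λ x → f (suc x) ≡ y
  cov′ y e with f zero ≟ y
  ... | no ¬p with cov y e
  ...   | zero  , q = ⊥-elim (¬p q)
  ...   | suc x , q = x , q
  same : ∀ x → remove (f zero) X (f (suc x)) ≡ X (f (suc x))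
  same x with f zero ≟ f (suc x)
  ... | yes p with () ← inj p
  ... | no _ = refl

-- Colours

-- A universe of finite sets, so that colours can be compared and searched and come with a size for
-- counting states. A set move adds a `bit`. Types are themselves elements of a palette and can
-- serve as colours.
data Pal : Set where
  base : ℕ → Pal
  bit  : Pal → Pal
  _⊗_  : Pal → Pal → Pal

El : Pal → Set
El (base n) = Fin n
El (bit p)  = Bool × El p
El (p ⊗ q)  = El p × El q

⟦_⟧ : Pal → ℕ
⟦ base n ⟧ = n
⟦ bit p ⟧  = 2 * ⟦ p ⟧
⟦ p ⊗ q ⟧  = ⟦ p ⟧ * ⟦ q ⟧

b2f : Bool → Fin 2
b2f true  = zero
b2f false = suc zero

f2b : Fin 2 → Bool
f2b zero    = true
f2b (suc _) = false

f2b-b2f : ∀ b → f2b (b2f b) ≡ b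
f2b-b2f true = refl
f2b-b2f false = refl

b2f-f2b : ∀ i → b2f (f2b i) ≡ i
b2f-f2b zero = refl
b2f-f2b (suc zero) = refl

enc : ∀ p → El p → Fin ⟦ p ⟧
enc (base n) i      = i
enc (bit p) (b , κ) = combine (b2f b) (enc p κ)
enc (p ⊗ q) (κ , μ) = combine (enc p κ) (enc q μ)

dec : ∀ p → Fin ⟦ p ⟧ → El p
dec (base n) i = i
dec (bit p)  i = f2b (proj₁ (remQuot {2} ⟦ p ⟧ i)) , dec p (proj₂ (remQuot {2} ⟦ p ⟧ i))
dec (p ⊗ q)  i = dec p (proj₁ (remQuot {⟦ p ⟧} ⟦ q ⟧ i)) , dec q (proj₂ (remQuot {⟦ p ⟧} ⟦ q ⟧ i))

dec-enc : ∀ p κ → dec p (enc p κ) ≡ κ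
dec-enc (base n) i = refl
dec-enc (bit p) (b , κ) =
  trans (cong (λ z → f2b (proj₁ z) , dec p (proj₂ z)) (remQuot-combine (b2f b) (enc p κ)))
        (cong₂ _,_ (f2b-b2f b) (dec-enc p κ))
dec-enc (p ⊗ q) (κ , μ) =
  trans (cong (λ z → dec p (proj₁ z) , dec q (proj₂ z)) (remQuot-combine (enc p κ) (enc q μ)))
        (cong₂ _,_ (dec-enc p κ) (dec-enc q μ))

enc-dec : ∀ p i → enc p (dec p i) ≡ i
enc-dec (base n) i = refl
enc-dec (bit p) i = trans (cong₂ combine (b2f-f2b (proj₁ (remQuot {2} ⟦ p ⟧ i))) (enc-dec p _)) (combine-remQuot {2} ⟦ p ⟧ i)
enc-dec (p ⊗ q) i = trans (cong₂ combine (enc-dec p _) (enc-dec q _)) (combine-remQuot {⟦ p ⟧} ⟦ q ⟧ i)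

module _ {p : Pal} where

  _==_ : El p → El p → Bool
  κ == μ = enc p κ ≡ᶠ enc p μ

  ==-sound : ∀ {κ μ} → (κ == μ) ≡ true → κ ≡ μ
  ==-sound {κ} {μ} e = trans (sym (dec-enc p κ)) (trans (cong (dec p) (≡ᶠ-sound e)) (dec-enc p μ))

  ==-refl : ∀ κ → (κ == κ) ≡ true
  ==-refl κ = ≡ᶠ-refl (enc p κ)

  ==-complete : ∀ {κ μ} → κ ≡ μ → (κ == μ) ≡ true
  ==-complete {κ} refl = ==-refl κ

  anyᴱ : (El p → Bool) → Bool
  anyᴱ P = anyᶠ (P ∘ dec p)

  anyᴱ-intro : ∀ P κ → P κ ≡ true → anyᴱ P ≡ true
  anyᴱ-intro P κ e = anyᶠ-intro (P ∘ dec p) (enc p κ) (trans (cong P (dec-enc p κ)) e)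

  anyᴱ-elim : ∀ P → anyᴱ P ≡ true → ∃ λ κ → P κ ≡ true
  anyᴱ-elim P e = let i , q = anyᶠ-elim (P ∘ dec p) e in dec p i , q

  sumᴱ : (El p → ℕ) → ℕ
  sumᴱ f = sumᶠ (f ∘ dec p)

  sumᴱ-cong : ∀ {f g : El p → ℕ} → f ≗ g → sumᴱ f ≡ sumᴱ g
  sumᴱ-cong e = sumᶠ-cong (e ∘ dec p)

  sumOver : (El p → Bool) → (El p → ℕ) → ℕ
  sumOver P f = sumᴱ λ κ → if P κ then f κ else 0

  sumOver-cong : ∀ P {f g : El p → ℕ} → f ≗ g → sumOver P f ≡ sumOver P g
  sumOver-cong P e = sumᴱ-cong λ κ → cong (λ z → if P κ then z else 0) (e κ)

  sumOver-+ : ∀ P (f g : El p → ℕ) → sumOver P (λ κ → f κ + g κ) ≡ sumOver P f + sumOver P g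
  sumOver-+ P f g = trans (sumᶠ-cong λ i → lem (P (dec p i)) (f (dec p i)) (g (dec p i)))
      (sumᶠ-+ (λ i → if P (dec p i) then f (dec p i) else 0) (λ i → if P (dec p i) then g (dec p i) else 0))
    where
    lem : ∀ b x y → (if b then x + y else 0) ≡ (if b then x else 0) + (if b then y else 0)
    lem true  x y = refl
    lem false x y = refl

  sumOver-δ : ∀ P κ₀ → sumOver P (λ κ → b2n (κ₀ == κ)) ≡ b2n (P κ₀)
  sumOver-δ P κ₀ = trans (sumᶠ-cong λ i → cong (λ z → if P (dec p i) then b2n (enc p κ₀ ≡ᶠ z) else 0) (enc-dec p i))
    (trans (sumᶠ-δ (P ∘ dec p) (enc p κ₀)) (cong (b2n ∘ P) (dec-enc p κ₀)))

  sumOver-single : ∀ κ₀ (f : El p → ℕ) → sumOver (_== κ₀) f ≡ f κ₀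
  sumOver-single κ₀ f = trans (sumᶠ-cong λ i → cong (λ z → if z ≡ᶠ enc p κ₀ then f (dec p i) else 0) (enc-dec p i))
    (trans (sumᶠ-single (f ∘ dec p) (enc p κ₀)) (cong f (dec-enc p κ₀)))

  sumOver-0 : ∀ P → sumOver P (λ _ → 0) ≡ 0
  sumOver-0 P = trans (sumᴱ-cong λ κ → lem (P κ)) (sumᶠ-0 ⟦ p ⟧)
    where
    lem : ∀ b → (if b then 0 else 0) ≡ 0
    lem true  = refl
    lem false = refl

  -- Counts of single colours determine the count of every colour predicate. Hence an observation,
  -- which records only the former, suffices for recolouring and for evaluating formulas.
  card-fibres : ∀ {n} (d : Fin n → Bool) (col : Fin n → El p) (P : El p → Bool) →
                card (λ x → d x ∧ P (col x)) ≡ sumOver P (λ κ → card (λ x → d x ∧ (col x == κ)))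
  card-fibres {zero}  d col P = sym (sumOver-0 P)
  card-fibres {suc n} d col P = begin
    card (λ x → d x ∧ P (col x)) ≡⟨ card-suc (λ x → d x ∧ P (col x)) ⟩
    b2n (d zero ∧ P (col zero)) + card (λ x → d (suc x) ∧ P (col (suc x)))
      ≡⟨ cong₂ _+_ (lem (d zero)) (card-fibres (d ∘ suc) (col ∘ suc) P) ⟩
    sumOver P head + sumOver P tail ≡⟨ sumOver-+ P head tail ⟨
    sumOver P (λ κ → head κ + tail κ)
      ≡⟨ sumOver-cong P (λ κ → card-suc (λ x → d x ∧ (col x == κ))) ⟨
    sumOver P (λ κ → card (λ x → d x ∧ (col x == κ))) ∎
    where
    open ≡-Reasoning
    head tail : El p → ℕ
    head κ = b2n (d zero ∧ (col zero == κ))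
    tail κ = card (λ x → d (suc x) ∧ (col (suc x) == κ))
    lem : ∀ b → b2n (b ∧ P (col zero)) ≡ sumOver P (λ κ → b2n (b ∧ (col zero == κ)))
    lem true  = sym (sumOver-δ P (col zero))
    lem false = sym (sumOver-0 P)

funToFin-cong : ∀ {m n} {f g : Fin m → Fin n} → f ≗ g → funToFin f ≡ funToFin g
funToFin-cong {zero}  e = refl
funToFin-cong {suc m} e = cong₂ combine (e zero) (funToFin-cong (e ∘ suc))

finToFun-injective : ∀ {m n} (i j : Fin (n ^ m)) → finToFun {n} {m} i ≗ finToFun {n} {m} j → i ≡ j
finToFun-injective {m} {n} i j e =
  trans (sym (funToFin-finToFin {m} {n} i)) (trans (funToFin-cong e) (funToFin-finToFin {m} {n} j))

-- Counts are kept exactly below 2, so that singletons are recognised, and modulo M from 2 on.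
module Capped (M : ℕ) .{{_ : NonZero M}} where

  cap : ℕ → Fin (2 + M)
  cap 0             = zero
  cap 1             = suc zero
  cap (suc (suc x)) = suc (suc (x mod M))

  capᵗ : ℕ → ℕ
  capᵗ x = toℕ (cap x)

  toℕ-mod : ∀ x → toℕ (x mod M) ≡ x % M
  toℕ-mod x = toℕ-fromℕ< (m%n<n x M)

  mod-cong : ∀ x y → x % M ≡ y % M → x mod M ≡ y mod M
  mod-cong x y e = toℕ-injective (trans (toℕ-mod x) (trans e (sym (toℕ-mod y))))

  cap-capᵗ : ∀ x → cap (capᵗ x) ≡ cap x
  cap-capᵗ 0 = refl
  cap-capᵗ 1 = refl
  cap-capᵗ (suc (suc x)) = cong (λ z → suc (suc z))
    (mod-cong (toℕ (x mod M)) x (trans (cong (_% M) (toℕ-mod x)) (m%n%n≡m%n x M)))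

  suc-% : ∀ x → suc x % M ≡ suc (toℕ (x mod M)) % M
  suc-% x = begin
    suc x % M                         ≡⟨ %-distribˡ-+ 1 x M ⟩
    (1 % M + x % M) % M               ≡⟨ cong (λ z → (1 % M + z) % M) (m%n%n≡m%n x M) ⟨
    (1 % M + x % M % M) % M           ≡⟨ %-distribˡ-+ 1 (x % M) M ⟨
    suc (x % M) % M                   ≡⟨ cong (λ z → suc z % M) (toℕ-mod x) ⟨
    suc (toℕ (x mod M)) % M           ∎
    where open ≡-Reasoning

  -- Capped counts carry a successor; by induction addition respects `cap`, so counts of glued parts
  -- can be added after capping.
  capsuc : Fin (2 + M) → Fin (2 + M)
  capsuc zero          = suc zero
  capsuc (suc zero)    = cap 2
  capsuc (suc (suc i)) = suc (suc (suc (toℕ i) mod M))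

  cap-suc : ∀ x → cap (suc x) ≡ capsuc (cap x)
  cap-suc 0 = refl
  cap-suc 1 = refl
  cap-suc (suc (suc x)) = cong (λ z → suc (suc z)) (mod-cong (suc x) (suc (toℕ (x mod M))) (suc-% x))

  cap-+ʳ : ∀ x {y y′} → cap y ≡ cap y′ → cap (x + y) ≡ cap (x + y′)
  cap-+ʳ zero    e = e
  cap-+ʳ (suc x) {y} {y′} e =
    trans (cap-suc (x + y)) (trans (cong capsuc (cap-+ʳ x e)) (sym (cap-suc (x + y′))))

  cap-+ : ∀ {x x′ y y′} → cap x ≡ cap x′ → cap y ≡ cap y′ → cap (x + y) ≡ cap (x′ + y′)
  cap-+ {x} {x′} {y} {y′} e f = trans (cap-+ʳ x f)
    (trans (cong cap (+-comm x y′)) (trans (cap-+ʳ y′ e) (cong cap (+-comm y′ x′))))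

  cap-sumᶠ : ∀ {n} {f g : Fin n → ℕ} → (∀ i → cap (f i) ≡ cap (g i)) → cap (sumᶠ f) ≡ cap (sumᶠ g)
  cap-sumᶠ {zero}  e = refl
  cap-sumᶠ {suc n} e = cap-+ (e zero) (cap-sumᶠ (e ∘ suc))

  cap-sumOver : ∀ {p} (P : El p → Bool) {f g : El p → ℕ} → (∀ κ → cap (f κ) ≡ cap (g κ)) →
                cap (sumOver P f) ≡ cap (sumOver P g)
  cap-sumOver {p} P {f} {g} e = cap-sumᶠ λ i → lem (P (dec p i)) (e (dec p i))
    where
    lem : ∀ b {x y} → cap x ≡ cap y → cap (if b then x else 0) ≡ cap (if b then y else 0)
    lem true  e = e
    lem false e = refl

  cap-toℕ : ∀ i → cap (toℕ i) ≡ i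
  cap-toℕ zero          = refl
  cap-toℕ (suc zero)    = refl
  cap-toℕ (suc (suc i)) = cong (λ z → suc (suc z)) (toℕ-injective (trans (toℕ-mod (toℕ i)) (m<n⇒m%n≡m (toℕ<n i))))

  cap-period : ∀ x → 2 ≤ x → ∀ k → cap (k * M + x) ≡ cap x
  cap-period (suc (suc x)) (s≤s (s≤s z≤n)) k =
    trans (cong cap (trans (+-suc (k * M) (suc x)) (cong suc (+-suc (k * M) x))))
          (cong (λ z → suc (suc z)) (mod-cong (k * M + x) x (trans (cong (_% M) (+-comm (k * M) x)) ([m+kn]%n≡m%n x k M))))

  capᵗ-1 : ∀ x → (capᵗ x ≡ᵇ 1) ≡ (x ≡ᵇ 1)
  capᵗ-1 0 = refl
  capᵗ-1 1 = refl
  capᵗ-1 (suc (suc x)) = refl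

  capᵗ-0 : ∀ x → (capᵗ x ≡ᵇ 0) ≡ (x ≡ᵇ 0)
  capᵗ-0 0 = refl
  capᵗ-0 1 = refl
  capᵗ-0 (suc (suc x)) = refl

  capᵗ-% : ∀ b .{{_ : NonZero b}} → b ∣ M → ∀ x → capᵗ x % b ≡ x % b
  capᵗ-% b d 0 = refl
  capᵗ-% b d 1 = refl
  capᵗ-% b d (suc (suc x)) = begin
    (2 + toℕ (x mod M)) % b          ≡⟨ cong (λ z → (2 + z) % b) (toℕ-mod x) ⟩
    (2 + x % M) % b                  ≡⟨ %-distribˡ-+ 2 (x % M) b ⟩
    (2 % b + x % M % b) % b          ≡⟨ cong (λ z → (2 % b + z) % b) (m∣n⇒o%n%m≡o%m b M x d) ⟩
    (2 % b + x % b) % b              ≡⟨ %-distribˡ-+ 2 x b ⟨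
    (2 + x) % b                      ∎
    where open ≡-Reasoning

module _ (p : Pal) {m : ℕ} where

  -- Functions are stored as numbers: equality of tables is decidable, and tables can again be
  -- colours.
  table : (El p → Fin m) → Fin (m ^ ⟦ p ⟧)
  table f = funToFin (f ∘ dec p)

  look : Fin (m ^ ⟦ p ⟧) → El p → Fin m
  look t κ = finToFun {m} {⟦ p ⟧} t (enc p κ)

  look-table : ∀ f κ → look (table f) κ ≡ f κ
  look-table f κ = trans (finToFun-funToFin (f ∘ dec p) (enc p κ)) (cong f (dec-enc p κ))

  table-cong : ∀ {f g} → f ≗ g → table f ≡ table g
  table-cong e = funToFin-cong (e ∘ dec p)

  look-injective : ∀ {s t} → look s ≗ look t → s ≡ t
  look-injective {s} {t} e = finToFun-injective s t λ i →
    subst (λ j → finToFun {m} {⟦ p ⟧} s j ≡ finToFun {m} {⟦ p ⟧} t j) (enc-dec p i) (e (dec p i))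

f2b-injective : ∀ {i j} → f2b i ≡ f2b j → i ≡ j
f2b-injective {i} {j} e = trans (sym (b2f-f2b i)) (trans (cong b2f e) (b2f-f2b j))

-- Types of finite coloured structures

-- Elements outside `dom` have no influence on types. An interpreted structure can thus live on all
-- nodes of its tree, with no renumbering.
record Str (r : ℕ) (p : Pal) : Set where
  constructor str
  field
    car : ℕ
    dom : Fin car → Bool
    col : Fin car → El p
    lnk : Fin r → Fin car → Fin car → Bool
open Str public

infixl 5 _▹_ _◂_
_▹_ : ∀ {r p} (A : Str r p) → (Fin (car A) → Bool) → Str r (bit p)
A ▹ X = record { car = car A ; dom = dom A ; col = λ x → X x , col A x ; lnk = lnk A }

_◂_ : ∀ {r p} (A : Str r p) → Fin (car A) → Str r (bit p)
A ◂ x = A ▹ (x ≡ᶠ_)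

-- An isomorphism of the parts inside the domains. Injectivity on the whole carrier lets every set
-- of `A` be transported, whether or not it stays inside `dom`.
record Emb {r p} (A B : Str r p) : Set where
  field
    fun    : Fin (car A) → Fin (car B)
    inj    : Injective _≡_ _≡_ fun
    dom-f  : ∀ x → dom B (fun x) ≡ dom A x
    cover  : ∀ y → dom B y ≡ true → ∃ λ x → fun x ≡ y
    col-f  : ∀ x → dom A x ≡ true → col B (fun x) ≡ col A x
    lnk-f  : ∀ R x y → dom A x ≡ true → dom A y ≡ true → lnk B R (fun x) (fun y) ≡ lnk A R x y
open Emb public

module Types (r M : ℕ) .{{_ : NonZero M}} where
  open Capped M public

  -- What zero rounds see: the capped number of elements of each colour and, for each relation and
  -- pair of colours, whether some elements of these colours are linked.
  ObPal : Pal → Pal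
  ObPal p = base ((2 + M) ^ ⟦ p ⟧) ⊗ base (2 ^ ⟦ base r ⊗ (p ⊗ p) ⟧)

  -- The record makes `p` inferable, which it is not from `El (ObPal p)`; likewise for `Type`.
  record Obs (p : Pal) : Set where
    constructor obs
    field elt : El (ObPal p)

  TyPal : ℕ → Pal → Pal
  TyPal zero    p = ObPal p
  TyPal (suc n) p = ObPal p ⊗ base (2 ^ ⟦ TyPal n (bit p) ⟧)

  record Type (n : ℕ) (p : Pal) : Set where
    constructor type
    field elt : El (TyPal n p)

  abstract
    mkOb : ∀ {p} → (El p → ℕ) → (Fin r → El p → El p → Bool) → Obs p
    mkOb {p} f g = obs (table p (cap ∘ f) , table (base r ⊗ (p ⊗ p)) λ (R , κ , μ) → b2f (g R κ μ))

    cntOf : ∀ {p} → Obs p → El p → ℕ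
    cntOf {p} (obs (t , _)) κ = toℕ (look p t κ)

    lnkOf : ∀ {p} → Obs p → Fin r → El p → El p → Bool
    lnkOf {p} (obs (_ , t)) R κ μ = f2b (look (base r ⊗ (p ⊗ p)) t (R , κ , μ))

    cntOf-mkOb : ∀ {p} f g (κ : El p) → cntOf (mkOb f g) κ ≡ capᵗ (f κ)
    cntOf-mkOb {p} f g κ = cong toℕ (look-table p (cap ∘ f) κ)

    lnkOf-mkOb : ∀ {p} f g R (κ μ : El p) → lnkOf (mkOb f g) R κ μ ≡ g R κ μ
    lnkOf-mkOb {p} f g R κ μ = trans (cong f2b (look-table (base r ⊗ (p ⊗ p)) _ (R , κ , μ))) (f2b-b2f (g R κ μ))

    cap-cntOf : ∀ {p} (o : Obs p) κ → capᵗ (cntOf o κ) ≡ cntOf o κ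
    cap-cntOf {p} (obs (t , _)) κ = cong toℕ (cap-toℕ (look p t κ))

    mkOb-cong : ∀ {p} {f f′ : El p → ℕ} {g g′} → (∀ κ → cap (f κ) ≡ cap (f′ κ)) →
                (∀ R κ μ → g R κ μ ≡ g′ R κ μ) → mkOb f g ≡ mkOb f′ g′
    mkOb-cong {p} e e′ = cong obs (cong₂ _,_ (table-cong p e)
      (table-cong (base r ⊗ (p ⊗ p)) λ (R , κ , μ) → cong b2f (e′ R κ μ)))

    Obs-ext : ∀ {p} {o o′ : Obs p} → (∀ κ → cntOf o κ ≡ cntOf o′ κ) →
              (∀ R κ μ → lnkOf o R κ μ ≡ lnkOf o′ R κ μ) → o ≡ o′
    Obs-ext {p} {obs (s , t)} {obs (s′ , t′)} e e′ = cong obs (cong₂ _,_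
      (look-injective p λ κ → toℕ-injective (e κ))
      (look-injective (base r ⊗ (p ⊗ p)) λ (R , κ , μ) → f2b-injective (e′ R κ μ)))

    mkT₀ : ∀ {p} → Obs p → Type 0 p
    mkT₀ (obs o) = type o

    mkT : ∀ {n p} → Obs p → (Type n (bit p) → Bool) → Type (suc n) p
    mkT {n} {p} (obs o) S = type (o , table (TyPal n (bit p)) (b2f ∘ S ∘ type))

    obOf : ∀ {n p} → Type n p → Obs p
    obOf {zero}  (type o)       = obs o
    obOf {suc n} (type (o , _)) = obs o

    infix 4 _∈ᵀ_
    _∈ᵀ_ : ∀ {n p} → Type n (bit p) → Type (suc n) p → Bool
    _∈ᵀ_ {n} {p} (type σ) (type (_ , t)) = f2b (look (TyPal n (bit p)) t σ)

  infix 4 _∈ᵗ_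
  _∈ᵗ_ : ∀ {n p} → Type n (bit p) → Type (suc n) p → Set
  σ ∈ᵗ τ = (σ ∈ᵀ τ) ≡ true

  abstract
    ∈ᵀ-mkT : ∀ {n p} (o : Obs p) (S : Type n (bit p) → Bool) σ → (σ ∈ᵀ mkT o S) ≡ S σ
    ∈ᵀ-mkT {n} {p} o S (type σ) = trans (cong f2b (look-table (TyPal n (bit p)) (b2f ∘ S ∘ type) σ)) (f2b-b2f (S (type σ)))

    obOf-mkT₀ : ∀ {p} (o : Obs p) → obOf (mkT₀ o) ≡ o
    obOf-mkT₀ o = refl

    obOf-mkT : ∀ {n p} (o : Obs p) (S : Type n (bit p) → Bool) → obOf (mkT o S) ≡ o
    obOf-mkT o S = refl

    Type-ext₀ : ∀ {p} {σ τ : Type 0 p} → obOf σ ≡ obOf τ → σ ≡ τ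
    Type-ext₀ refl = refl

    Type-ext : ∀ {n p} {σ τ : Type (suc n) p} → obOf σ ≡ obOf τ →
               (∀ ρ → ρ ∈ᵗ σ → ρ ∈ᵗ τ) → (∀ ρ → ρ ∈ᵗ τ → ρ ∈ᵗ σ) → σ ≡ τ
    Type-ext {n} {p} {type (o , s)} {type (.o , t)} refl f g = cong (λ z → type (o , z))
      (look-injective (TyPal n (bit p)) λ κ → f2b-injective (⇔→≡ (f (type κ)) (g (type κ))))

    infix 4 _≡ᵀ_
    _≡ᵀ_ : ∀ {n p} → Type n p → Type n p → Bool
    _≡ᵀ_ {n} {p} (type σ) (type τ) = _==_ {TyPal n p} σ τ

    ≡ᵀ-sound : ∀ {n p} {σ τ : Type n p} → (σ ≡ᵀ τ) ≡ true → σ ≡ τ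
    ≡ᵀ-sound {n} {p} e = cong type (==-sound {TyPal n p} e)

    ≡ᵀ-refl : ∀ {n p} (σ : Type n p) → (σ ≡ᵀ σ) ≡ true
    ≡ᵀ-refl {n} {p} (type σ) = ==-refl {TyPal n p} σ

    ≡ᵀ-complete : ∀ {n p} {σ τ : Type n p} → σ ≡ τ → (σ ≡ᵀ τ) ≡ true
    ≡ᵀ-complete {σ = σ} refl = ≡ᵀ-refl σ

    anyᵀ : ∀ {n p} → (Type n p → Bool) → Bool
    anyᵀ {n} {p} P = anyᴱ {TyPal n p} (P ∘ type)

    anyᵀ-intro : ∀ {n p} (P : Type n p → Bool) τ → P τ ≡ true → anyᵀ P ≡ true
    anyᵀ-intro {n} {p} P (type τ) e = anyᴱ-intro {TyPal n p} (P ∘ type) τ e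

    anyᵀ-elim : ∀ {n p} (P : Type n p → Bool) → anyᵀ P ≡ true → ∃ λ τ → P τ ≡ true
    anyᵀ-elim {n} {p} P e = let τ , q = anyᴱ-elim {TyPal n p} (P ∘ type) e in type τ , q

  at : ∀ {p} (A : Str r p) → El p → Fin (car A) → Bool
  at A κ x = dom A x ∧ (col A x == κ)

  linked : ∀ {p} (A : Str r p) → Fin r → El p → El p → Bool
  linked A R κ μ = anyᶠ λ x → anyᶠ λ y → (at A κ x ∧ at A μ y) ∧ lnk A R x y

  ob : ∀ {p} → Str r p → Obs p
  ob A = mkOb (λ κ → card (at A κ)) (linked A)

  -- The type of A for the n-round Ehrenfeucht–Fraïssé game in which every move is a set:
  -- first-order quantifiers are played with singletons.
  abstract
    mutual
      tp : ∀ n {p} → Str r p → Type n p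
      tp zero    A = mkT₀ (ob A)
      tp (suc n) A = mkT (ob A) (tpSet n A)

      tpSet : ∀ n {p} → Str r p → Type n (bit p) → Bool
      tpSet n A σ = anyˢ λ X → tp n (A ▹ X) ≡ᵀ σ

    obOf-tp : ∀ n {p} (A : Str r p) → obOf (tp n A) ≡ ob A
    obOf-tp zero    A = obOf-mkT₀ (ob A)
    obOf-tp (suc n) A = obOf-mkT (ob A) (tpSet n A)

    ∈-tp : ∀ n {p} (A : Str r p) σ → (σ ∈ᵀ tp (suc n) A) ≡ anyˢ (λ X → tp n (A ▹ X) ≡ᵀ σ)
    ∈-tp n A σ = ∈ᵀ-mkT (ob A) (tpSet n A) σ

  linked-intro : ∀ {p} (A : Str r p) R {κ μ} x y → dom A x ≡ true → dom A y ≡ true →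
                 col A x ≡ κ → col A y ≡ μ → lnk A R x y ≡ true → linked A R κ μ ≡ true
  linked-intro A R x y dx dy refl refl l =
    anyᶠ-intro _ x (anyᶠ-intro _ y (∧-intro (∧-intro (∧-intro dx (==-refl (col A x))) (∧-intro dy (==-refl (col A y)))) l))

  linked-elim : ∀ {p} (A : Str r p) R {κ μ} → linked A R κ μ ≡ true →
                ∃ λ x → ∃ λ y → dom A x ≡ true × dom A y ≡ true × col A x ≡ κ × col A y ≡ μ × lnk A R x y ≡ true
  linked-elim A R e with anyᶠ-elim _ e
  ... | x , e₁ with anyᶠ-elim _ e₁
  ... | y , e₂ with ∧-elim e₂
  ... | ab , l with ∧-elim ab
  ... | a , b with ∧-elim a | ∧-elim b
  ... | dx , cx | dy , cy = x , y , dx , dy , ==-sound cx , ==-sound cy , l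

  ▹-cong : ∀ {p} (A : Str r p) {X Y} → X ≗ Y → Emb (A ▹ X) (A ▹ Y)
  ▹-cong A e = record { fun = id ; inj = id ; dom-f = λ _ → refl ; cover = λ y _ → y , refl
                      ; col-f = λ x _ → cong (_, col A x) (sym (e x)) ; lnk-f = λ _ _ _ _ _ → refl }

  ▹-emb : ∀ {p} {A B : Str r p} (f : Emb A B) {X Y} → (∀ x → Y (fun f x) ≡ X x) → Emb (A ▹ X) (B ▹ Y)
  ▹-emb f e = record { fun = fun f ; inj = inj f ; dom-f = dom-f f ; cover = cover f
                     ; col-f = λ x d → cong₂ _,_ (e x) (col-f f x d) ; lnk-f = lnk-f f }

  ob-emb : ∀ {p} {A B : Str r p} → Emb A B → ob A ≡ ob B
  ob-emb {p} {A} {B} f = mkOb-cong (λ κ → cong cap (sym (cnt κ))) (λ R κ μ → ⇔→≡ (to R {κ} {μ}) (from R))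
    where
    same : ∀ κ x → at B κ (fun f x) ≡ at A κ x
    same κ x with dom A x in e
    ... | true rewrite dom-f f x | e | col-f f x e = refl
    ... | false rewrite dom-f f x | e = refl
    cnt : ∀ κ → card (at B κ) ≡ card (at A κ)
    cnt κ = trans (card-image (fun f) (inj f) (at B κ) (λ y e → cover f y (proj₁ (∧-elim e)))) (card-cong (same κ))
    to : ∀ R {κ μ} → linked A R κ μ ≡ true → linked B R κ μ ≡ true
    to R e with linked-elim A R e
    ... | x , y , dx , dy , cx , cy , l = linked-intro B R (fun f x) (fun f y)
      (trans (dom-f f x) dx) (trans (dom-f f y) dy) (trans (col-f f x dx) cx) (trans (col-f f y dy) cy)
      (trans (lnk-f f R x y dx dy) l)
    from : ∀ R {κ μ} → linked B R κ μ ≡ true → linked A R κ μ ≡ true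
    from R e with linked-elim B R e
    ... | x′ , y′ , dx , dy , cx , cy , l with cover f x′ dx | cover f y′ dy
    ... | x , refl | y , refl =
      let dx′ = trans (sym (dom-f f x)) dx ; dy′ = trans (sym (dom-f f y)) dy in
      linked-intro A R x y dx′ dy′ (trans (sym (col-f f x dx′)) cx) (trans (sym (col-f f y dy′)) cy)
        (trans (sym (lnk-f f R x y dx′ dy′)) l)

  ∈-tp-elim : ∀ n {p} (A : Str r p) σ → σ ∈ᵗ tp (suc n) A → ∃ λ X → tp n (A ▹ X) ≡ σ
  ∈-tp-elim n A σ e = let X , q = anyˢ-elim (λ X → tp n (A ▹ X) ≡ᵀ σ) (trans (sym (∈-tp n A σ)) e) in X , ≡ᵀ-sound q

  -- The search for a move needs a predicate that respects pointwise equality of sets. For `tp n`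
  -- this is invariance for `n` rounds, whence the joint recursion with `∈-tp-intro`.
  tp-emb : ∀ n {p} {A B : Str r p} → Emb A B → tp n A ≡ tp n B
  ∈-tp-intro : ∀ n {p} (A : Str r p) X → tp n (A ▹ X) ∈ᵗ tp (suc n) A

  tp-emb zero {A = A} {B} f = Type-ext₀ (trans (obOf-tp 0 A) (trans (ob-emb f) (sym (obOf-tp 0 B))))
  tp-emb (suc n) {p} {A} {B} f = Type-ext (trans (obOf-tp (suc n) A) (trans (ob-emb f) (sym (obOf-tp (suc n) B)))) to from
    where
    push : (Fin (car A) → Bool) → Fin (car B) → Bool
    push X y = anyᶠ λ x → (fun f x ≡ᶠ y) ∧ X x
    push-f : ∀ X x → push X (fun f x) ≡ X x
    push-f X x = ⇔→≡
      (λ e → let x′ , q = anyᶠ-elim (λ z → (fun f z ≡ᶠ fun f x) ∧ X z) e ; a , b = ∧-elim q in subst (λ z → X z ≡ true) (inj f (≡ᶠ-sound a)) b)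
      (λ e → anyᶠ-intro (λ z → (fun f z ≡ᶠ fun f x) ∧ X z) x (∧-intro (≡ᶠ-refl (fun f x)) e))
    to : ∀ σ → σ ∈ᵗ tp (suc n) A → σ ∈ᵗ tp (suc n) B
    to σ e with ∈-tp-elim n A σ e
    ... | X , refl = subst (_∈ᵗ tp (suc n) B) (sym (tp-emb n (▹-emb f {X} {push X} (push-f X)))) (∈-tp-intro n B (push X))
    from : ∀ σ → σ ∈ᵗ tp (suc n) B → σ ∈ᵗ tp (suc n) A
    from σ e with ∈-tp-elim n B σ e
    ... | Y , refl = subst (_∈ᵗ tp (suc n) A) (tp-emb n (▹-emb f {Y ∘ fun f} (λ _ → refl))) (∈-tp-intro n A (Y ∘ fun f))

  ∈-tp-intro n A X = trans (∈-tp n A (tp n (A ▹ X)))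
    (anyˢ-intro (λ Y → tp n (A ▹ Y) ≡ᵀ tp n (A ▹ X)) (λ {Y} {Z} e → cong (_≡ᵀ tp n (A ▹ X)) (tp-emb n (▹-cong A e))) X (≡ᵀ-refl (tp n (A ▹ X))))

  tp-move : ∀ {n p} {A B : Str r p} → tp (suc n) A ≡ tp (suc n) B → ∀ X → ∃ λ Y → tp n (A ▹ X) ≡ tp n (B ▹ Y)
  tp-move {n} {A = A} {B} e X =
    let Y , q = ∈-tp-elim n B _ (subst (λ τ → tp n (A ▹ X) ∈ᵗ τ) e (∈-tp-intro n A X)) in Y , sym q

-- Gluing structures and composing their types

↑-elim : ∀ m {n} (P : Fin (m + n) → Set) → (∀ x → P (x ↑ˡ n)) → (∀ y → P (m ↑ʳ y)) → ∀ z → P z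
↑-elim m {n} P f g z with splitAt m z | join-splitAt m n z
... | inj₁ x | refl = f x
... | inj₂ y | refl = g y

card-pos : ∀ {n} (X : Fin n → Bool) → not (card X ≡ᵇ 0) ≡ anyᶠ X
card-pos {zero}  X = refl
card-pos {suc n} X with X zero
... | true  = refl
... | false = card-pos (X ∘ suc)

module _ {p q : Pal} where

  any² : (El p → El q → Bool) → Bool
  any² P = anyᴱ {p} λ κ → anyᴱ {q} λ μ → P κ μ

  any²-intro : ∀ P κ μ → P κ μ ≡ true → any² P ≡ true
  any²-intro P κ μ e = anyᴱ-intro {p} _ κ (anyᴱ-intro {q} (P κ) μ e)

  any²-elim : ∀ P → any² P ≡ true → ∃ λ κ → ∃ λ μ → P κ μ ≡ true
  any²-elim P e = let κ , e₁ = anyᴱ-elim {p} (λ κ → anyᴱ {q} (P κ)) e in κ , anyᴱ-elim {q} (P κ) e₁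

  any²-cong : ∀ {P Q} → (∀ κ μ → P κ μ ≡ Q κ μ) → any² P ≡ any² Q
  any²-cong {P} {Q} e = ⇔→≡
    (λ t → let κ , μ , q = any²-elim P t in any²-intro Q κ μ (trans (sym (e κ μ)) q))
    (λ t → let κ , μ , q = any²-elim Q t in any²-intro P κ μ (trans (e κ μ) q))

sumOver-congᴾ : ∀ {p} {P Q : El p → Bool} → P ≗ Q → ∀ f → sumOver P f ≡ sumOver Q f
sumOver-congᴾ {p} e f = sumᴱ-cong {p} λ κ → cong (λ b → if b then f κ else 0) (e κ)

-- The rules consult colours only, so that whatever happens between the parts can be computed from
-- their types.
record Glue (r : ℕ) (p q s : Pal) : Set where
  field
    m₁  : El p → El s
    m₂  : El q → El s
    x₁₂ : Fin r → El p → El q → Bool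
    x₂₁ : Fin r → El q → El p → Bool
open Glue public

disj : ∀ {r p} → Glue r p p p
disj = record { m₁ = id ; m₂ = id ; x₁₂ = λ _ _ _ → false ; x₂₁ = λ _ _ _ → false }

∅ : ∀ {r p} → Str r p
∅ = record { car = 0 ; dom = λ () ; col = λ () ; lnk = λ _ () }

lift : ∀ {r p q s} → Glue r p q s → Glue r (bit p) (bit q) (bit s)
lift G = record
  { m₁ = λ (b , κ) → b , m₁ G κ ; m₂ = λ (b , κ) → b , m₂ G κ
  ; x₁₂ = λ R (_ , κ) (_ , μ) → x₁₂ G R κ μ ; x₂₁ = λ R (_ , κ) (_ , μ) → x₂₁ G R κ μ }

swap : ∀ {r p q s} → Glue r p q s → Glue r q p s
swap G = record { m₁ = m₂ G ; m₂ = m₁ G ; x₁₂ = x₂₁ G ; x₂₁ = x₁₂ G }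

record _≈ᴳ_ {r p q s} (G H : Glue r p q s) : Set where
  field
    m₁≈  : ∀ κ → m₁ G κ ≡ m₁ H κ
    m₂≈  : ∀ κ → m₂ G κ ≡ m₂ H κ
    x₁₂≈ : ∀ R κ μ → x₁₂ G R κ μ ≡ x₁₂ H R κ μ
    x₂₁≈ : ∀ R κ μ → x₂₁ G R κ μ ≡ x₂₁ H R κ μ
open _≈ᴳ_ public

lift-≈ : ∀ {r p q s} {G H : Glue r p q s} → G ≈ᴳ H → lift G ≈ᴳ lift H
lift-≈ e = record
  { m₁≈ = λ (b , κ) → cong (b ,_) (m₁≈ e κ) ; m₂≈ = λ (b , κ) → cong (b ,_) (m₂≈ e κ)
  ; x₁₂≈ = λ R (_ , κ) (_ , μ) → x₁₂≈ e R κ μ ; x₂₁≈ = λ R (_ , κ) (_ , μ) → x₂₁≈ e R κ μ }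

module _ {r p q s} (G : Glue r p q s) (A : Str r p) (B : Str r q) where

  crossing : Fin r → Fin (car A) ⊎ Fin (car B) → Fin (car A) ⊎ Fin (car B) → Bool
  crossing R (inj₁ x) (inj₁ y) = lnk A R x y
  crossing R (inj₁ x) (inj₂ y) = x₁₂ G R (col A x) (col B y)
  crossing R (inj₂ x) (inj₁ y) = x₂₁ G R (col B x) (col A y)
  crossing R (inj₂ x) (inj₂ y) = lnk B R x y

  glue : Str r s
  glue = record
    { car = car A + car B
    ; dom = λ z → [ dom A , dom B ]′ (splitAt (car A) z)
    ; col = λ z → [ m₁ G ∘ col A , m₂ G ∘ col B ]′ (splitAt (car A) z)
    ; lnk = λ R z w → crossing R (splitAt (car A) z) (splitAt (car A) w) }

module _ {r p q s} (G : Glue r p q s) (A : Str r p) (B : Str r q) where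

  private
    l : Fin (car A) → Fin (car A + car B)
    l = _↑ˡ car B
    u : Fin (car B) → Fin (car A + car B)
    u = car A ↑ʳ_

  dom-l : ∀ x → dom (glue G A B) (l x) ≡ dom A x
  dom-l x = cong [ dom A , dom B ]′ (splitAt-↑ˡ (car A) x (car B))

  dom-u : ∀ y → dom (glue G A B) (u y) ≡ dom B y
  dom-u y = cong [ dom A , dom B ]′ (splitAt-↑ʳ (car A) (car B) y)

  col-l : ∀ x → col (glue G A B) (l x) ≡ m₁ G (col A x)
  col-l x = cong [ m₁ G ∘ col A , m₂ G ∘ col B ]′ (splitAt-↑ˡ (car A) x (car B))

  col-u : ∀ y → col (glue G A B) (u y) ≡ m₂ G (col B y)
  col-u y = cong [ m₁ G ∘ col A , m₂ G ∘ col B ]′ (splitAt-↑ʳ (car A) (car B) y)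

  lnk-ll : ∀ R x y → lnk (glue G A B) R (l x) (l y) ≡ lnk A R x y
  lnk-ll R x y = cong₂ (crossing G A B R) (splitAt-↑ˡ (car A) x (car B)) (splitAt-↑ˡ (car A) y (car B))

  lnk-lu : ∀ R x y → lnk (glue G A B) R (l x) (u y) ≡ x₁₂ G R (col A x) (col B y)
  lnk-lu R x y = cong₂ (crossing G A B R) (splitAt-↑ˡ (car A) x (car B)) (splitAt-↑ʳ (car A) (car B) y)

  lnk-ul : ∀ R x y → lnk (glue G A B) R (u x) (l y) ≡ x₂₁ G R (col B x) (col A y)
  lnk-ul R x y = cong₂ (crossing G A B R) (splitAt-↑ʳ (car A) (car B) x) (splitAt-↑ˡ (car A) y (car B))

  lnk-uu : ∀ R x y → lnk (glue G A B) R (u x) (u y) ≡ lnk B R x y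
  lnk-uu R x y = cong₂ (crossing G A B R) (splitAt-↑ʳ (car A) (car B) x) (splitAt-↑ʳ (car A) (car B) y)

  glue-emb : (C : Str r s) (c : car C ≡ car A + car B) →
    let l′ = subst Fin (sym c) ∘ l ; u′ = subst Fin (sym c) ∘ u in
    (∀ x → dom C (l′ x) ≡ dom A x) → (∀ y → dom C (u′ y) ≡ dom B y) →
    (∀ x → dom A x ≡ true → col C (l′ x) ≡ m₁ G (col A x)) →
    (∀ y → dom B y ≡ true → col C (u′ y) ≡ m₂ G (col B y)) →
    (∀ R x y → dom A x ≡ true → dom A y ≡ true → lnk C R (l′ x) (l′ y) ≡ lnk A R x y) →
    (∀ R x y → dom A x ≡ true → dom B y ≡ true → lnk C R (l′ x) (u′ y) ≡ x₁₂ G R (col A x) (col B y)) →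
    (∀ R x y → dom B x ≡ true → dom A y ≡ true → lnk C R (u′ x) (l′ y) ≡ x₂₁ G R (col B x) (col A y)) →
    (∀ R x y → dom B x ≡ true → dom B y ≡ true → lnk C R (u′ x) (u′ y) ≡ lnk B R x y) →
    Emb (glue G A B) C
  glue-emb C refl d₁ d₂ c₁ c₂ l₁₁ l₁₂ l₂₁ l₂₂ = record
    { fun = id ; inj = id ; cover = λ y _ → y , refl
    ; dom-f = ↑-elim (car A) _ (λ x → trans (d₁ x) (sym (dom-l x))) (λ y → trans (d₂ y) (sym (dom-u y)))
    ; col-f = ↑-elim (car A) _ (λ x e → trans (c₁ x (trans (sym (dom-l x)) e)) (sym (col-l x)))
                               (λ y e → trans (c₂ y (trans (sym (dom-u y)) e)) (sym (col-u y)))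
    ; lnk-f = λ R → ↑-elim (car A) _
        (λ x → ↑-elim (car A) _ (λ y e f → trans (l₁₁ R x y (trans (sym (dom-l x)) e) (trans (sym (dom-l y)) f)) (sym (lnk-ll R x y)))
                                (λ y e f → trans (l₁₂ R x y (trans (sym (dom-l x)) e) (trans (sym (dom-u y)) f)) (sym (lnk-lu R x y))))
        (λ x → ↑-elim (car A) _ (λ y e f → trans (l₂₁ R x y (trans (sym (dom-u x)) e) (trans (sym (dom-l y)) f)) (sym (lnk-ul R x y)))
                                (λ y e f → trans (l₂₂ R x y (trans (sym (dom-u x)) e) (trans (sym (dom-u y)) f)) (sym (lnk-uu R x y)))) }

  ▹-glue : ∀ X → Emb (glue (lift G) (A ▹ X ∘ l) (B ▹ X ∘ u)) (glue G A B ▹ X)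
  ▹-glue X = record
    { fun = id ; inj = id ; cover = λ y _ → y , refl ; dom-f = λ _ → refl
    ; col-f = ↑-elim (car A) _
        (λ x _ → trans (cong (X (l x) ,_) (col-l x)) (sym (cong [ _ , _ ]′ (splitAt-↑ˡ (car A) x (car B)))))
        (λ y _ → trans (cong (X (u y) ,_) (col-u y)) (sym (cong [ _ , _ ]′ (splitAt-↑ʳ (car A) (car B) y))))
    ; lnk-f = λ R z w _ _ → same R (splitAt (car A) z) (splitAt (car A) w) }
    where
    same : ∀ R z w → crossing G A B R z w ≡ crossing (lift G) (A ▹ X ∘ l) (B ▹ X ∘ u) R z w
    same R (inj₁ _) (inj₁ _) = refl
    same R (inj₁ _) (inj₂ _) = refl
    same R (inj₂ _) (inj₁ _) = refl
    same R (inj₂ _) (inj₂ _) = refl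

module Composition (r M : ℕ) .{{_ : NonZero M}} where
  open Types r M

  abstract
    -- A rule for links across the parts produces a link only if both colours are present. Capping
    -- keeps zero apart from positive counts, so presence can be read off.
    occurs : ∀ {p} → Obs p → El p → Bool
    occurs o κ = not (cntOf o κ ≡ᵇ 0)

    occurs-ob : ∀ {p} (A : Str r p) κ → occurs (ob A) κ ≡ anyᶠ (at A κ)
    occurs-ob A κ = trans (cong (λ z → not (z ≡ᵇ 0)) (cntOf-mkOb (λ κ → card (at A κ)) (linked A) κ))
      (trans (cong not (capᵗ-0 (card (at A κ)))) (card-pos (at A κ)))

  module _ {p q s} (G : Glue r p q s) (o : Obs p) (o′ : Obs q) where

    compCnt : El s → ℕ
    compCnt κ = sumOver {p} (λ μ → m₁ G μ == κ) (cntOf o) + sumOver {q} (λ μ → m₂ G μ == κ) (cntOf o′)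

    within₁ : Fin r → El s → El s → El p → El p → Bool
    within₁ R κ κ′ μ μ′ = ((m₁ G μ == κ) and′ (m₁ G μ′ == κ′)) and′ lnkOf o R μ μ′

    within₂ : Fin r → El s → El s → El q → El q → Bool
    within₂ R κ κ′ μ μ′ = ((m₂ G μ == κ) and′ (m₂ G μ′ == κ′)) and′ lnkOf o′ R μ μ′

    across₁₂ : Fin r → El s → El s → El p → El q → Bool
    across₁₂ R κ κ′ μ μ′ = ((m₁ G μ == κ) and′ (m₂ G μ′ == κ′)) and′ ((occurs o μ and′ occurs o′ μ′) and′ x₁₂ G R μ μ′)

    across₂₁ : Fin r → El s → El s → El q → El p → Bool
    across₂₁ R κ κ′ μ μ′ = ((m₂ G μ == κ) and′ (m₁ G μ′ == κ′)) and′ ((occurs o′ μ and′ occurs o μ′) and′ x₂₁ G R μ μ′)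

    compLnk : Fin r → El s → El s → Bool
    compLnk R κ κ′ = (any² {p} {p} (within₁ R κ κ′) or′ any² {q} {q} (within₂ R κ κ′)) or′
                     (any² {p} {q} (across₁₂ R κ κ′) or′ any² {q} {p} (across₂₁ R κ κ′))

    compOb : Obs s
    compOb = mkOb compCnt compLnk

  module _ {p q s} (G : Glue r p q s) (A : Str r p) (B : Str r q) where

    private
      C = glue G A B
      o = ob A
      o′ = ob B

    card-glue : ∀ κ → card (at C κ) ≡ sumOver {p} (λ μ → m₁ G μ == κ) (λ μ → card (at A μ))
                                     + sumOver {q} (λ μ → m₂ G μ == κ) (λ μ → card (at B μ))
    card-glue κ = trans (card-↑ (car A) (at C κ)) (cong₂ _+_
      (trans (card-cong λ x → cong₂ (λ d c → d ∧ (c == κ)) (dom-l G A B x) (col-l G A B x))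
             (card-fibres (dom A) (col A) (λ μ → m₁ G μ == κ)))
      (trans (card-cong λ x → cong₂ (λ d c → d ∧ (c == κ)) (dom-u G A B x) (col-u G A B x))
             (card-fibres (dom B) (col B) (λ μ → m₂ G μ == κ))))

    cap-count : ∀ {p} (A : Str r p) κ → cap (card (at A κ)) ≡ cap (cntOf (ob A) κ)
    cap-count A κ = sym (trans (cong cap (cntOf-mkOb (λ κ → card (at A κ)) (linked A) κ)) (cap-capᵗ (card (at A κ))))

    occurs-intro : ∀ {p} (A : Str r p) x → dom A x ≡ true → occurs (ob A) (col A x) ≡ true
    occurs-intro A x d = trans (occurs-ob A (col A x)) (anyᶠ-intro (at A (col A x)) x (∧-intro d (==-refl (col A x))))

    occurs-elim : ∀ {p} (A : Str r p) κ → occurs (ob A) κ ≡ true → ∃ λ x → dom A x ≡ true × col A x ≡ κ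
    occurs-elim A κ e = let x , q = anyᶠ-elim (at A κ) (trans (sym (occurs-ob A κ)) e) ; d , c = ∧-elim q in x , d , ==-sound c

    lnk-ob : ∀ {p} (A : Str r p) R κ μ → lnkOf (ob A) R κ μ ≡ linked A R κ μ
    lnk-ob A R κ μ = lnkOf-mkOb (λ κ → card (at A κ)) (linked A) R κ μ

    linked⇒comp : ∀ R κ κ′ → linked C R κ κ′ ≡ true → compLnk G o o′ R κ κ′ ≡ true
    linked⇒comp R κ κ′ e with linked-elim C R e
    ... | z , w , dz , dw , refl , refl , lz = go z w dz dw lz
      where
      Goal : Fin (car C) → Fin (car C) → Set
      Goal z w = dom C z ≡ true → dom C w ≡ true → lnk C R z w ≡ true → compLnk G o o′ R (col C z) (col C w) ≡ true
      eqs : ∀ {a a′ b b′ : El s} → a ≡ b → a′ ≡ b′ → ((b == a) and′ (b′ == a′)) ≡ true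
      eqs e f = and-intro (==-complete (sym e)) (==-complete (sym f))
      go : ∀ z w → Goal z w
      go = ↑-elim (car A) _
        (λ x → ↑-elim (car A) (Goal (x ↑ˡ car B))
          (λ y dx dy l → or-introˡ (or-introˡ (any²-intro {p} {p} (within₁ G o o′ R _ _) (col A x) (col A y) (and-intro (eqs (col-l G A B x) (col-l G A B y))
            (trans (lnk-ob A R _ _) (linked-intro A R x y (trans (sym (dom-l G A B x)) dx) (trans (sym (dom-l G A B y)) dy) refl refl
              (trans (sym (lnk-ll G A B R x y)) l)))))))
          (λ y dx dy l → or-introʳ (or-introˡ (any²-intro {p} {q} (across₁₂ G o o′ R _ _) (col A x) (col B y) (and-intro (eqs (col-l G A B x) (col-u G A B y))
            (and-intro (and-intro (occurs-intro A x (trans (sym (dom-l G A B x)) dx)) (occurs-intro B y (trans (sym (dom-u G A B y)) dy)))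
              (trans (sym (lnk-lu G A B R x y)) l)))))))
        (λ x → ↑-elim (car A) (Goal (car A ↑ʳ x))
          (λ y dx dy l → or-introʳ (or-introʳ (any²-intro {q} {p} (across₂₁ G o o′ R _ _) (col B x) (col A y) (and-intro (eqs (col-u G A B x) (col-l G A B y))
            (and-intro (and-intro (occurs-intro B x (trans (sym (dom-u G A B x)) dx)) (occurs-intro A y (trans (sym (dom-l G A B y)) dy)))
              (trans (sym (lnk-ul G A B R x y)) l))))))
          (λ y dx dy l → or-introˡ (or-introʳ (any²-intro {q} {q} (within₂ G o o′ R _ _) (col B x) (col B y) (and-intro (eqs (col-u G A B x) (col-u G A B y))
            (trans (lnk-ob B R _ _) (linked-intro B R x y (trans (sym (dom-u G A B x)) dx) (trans (sym (dom-u G A B y)) dy) refl refl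
              (trans (sym (lnk-uu G A B R x y)) l))))))))

    comp⇒linked : ∀ R κ κ′ → compLnk G o o′ R κ κ′ ≡ true → linked C R κ κ′ ≡ true
    comp⇒linked R κ κ′ e with or-elim e
    comp⇒linked R κ κ′ e | inj₁ e′ with or-elim e′
    ... | inj₁ t with any²-elim {p} {p} (within₁ G o o′ R κ κ′) t
    ...   | μ , μ′ , t₁ with and-elim t₁
    ...   | t₂ , t₃ with and-elim t₂ | linked-elim A R (trans (sym (lnk-ob A R μ μ′)) t₃)
    ...   | a , b | x , y , dx , dy , refl , refl , l =
      linked-intro C R (x ↑ˡ car B) (y ↑ˡ car B) (trans (dom-l G A B x) dx) (trans (dom-l G A B y) dy)
        (trans (col-l G A B x) (==-sound a)) (trans (col-l G A B y) (==-sound b)) (trans (lnk-ll G A B R x y) l)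
    comp⇒linked R κ κ′ e | inj₁ e′ | inj₂ t with any²-elim {q} {q} (within₂ G o o′ R κ κ′) t
    ...   | μ , μ′ , t₁ with and-elim t₁
    ...   | t₂ , t₃ with and-elim t₂ | linked-elim B R (trans (sym (lnk-ob B R μ μ′)) t₃)
    ...   | a , b | x , y , dx , dy , refl , refl , l =
      linked-intro C R (car A ↑ʳ x) (car A ↑ʳ y) (trans (dom-u G A B x) dx) (trans (dom-u G A B y) dy)
        (trans (col-u G A B x) (==-sound a)) (trans (col-u G A B y) (==-sound b)) (trans (lnk-uu G A B R x y) l)
    comp⇒linked R κ κ′ e | inj₂ e′ with or-elim e′
    ... | inj₁ t with any²-elim {p} {q} (across₁₂ G o o′ R κ κ′) t
    ...   | μ , μ′ , t₁ with and-elim t₁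
    ...   | t₂ , t₃ with and-elim t₂ | and-elim t₃
    ...   | a , b | t₄ , l with and-elim t₄
    ...   | t₅ , t₆ with occurs-elim A μ t₅ | occurs-elim B μ′ t₆
    ...   | x , dx , refl | y , dy , refl =
      linked-intro C R (x ↑ˡ car B) (car A ↑ʳ y) (trans (dom-l G A B x) dx) (trans (dom-u G A B y) dy)
        (trans (col-l G A B x) (==-sound a)) (trans (col-u G A B y) (==-sound b)) (trans (lnk-lu G A B R x y) l)
    comp⇒linked R κ κ′ e | inj₂ e′ | inj₂ t with any²-elim {q} {p} (across₂₁ G o o′ R κ κ′) t
    ...   | μ , μ′ , t₁ with and-elim t₁
    ...   | t₂ , t₃ with and-elim t₂ | and-elim t₃
    ...   | a , b | t₄ , l with and-elim t₄
    ...   | t₅ , t₆ with occurs-elim B μ t₅ | occurs-elim A μ′ t₆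
    ...   | x , dx , refl | y , dy , refl =
      linked-intro C R (car A ↑ʳ x) (y ↑ˡ car B) (trans (dom-u G A B x) dx) (trans (dom-l G A B y) dy)
        (trans (col-u G A B x) (==-sound a)) (trans (col-l G A B y) (==-sound b)) (trans (lnk-ul G A B R x y) l)

    ob-glue : ob C ≡ compOb G o o′
    ob-glue = mkOb-cong
      (λ κ → trans (cong cap (card-glue κ)) (cap-+
        (cap-sumOver {p} (λ μ → m₁ G μ == κ) (cap-count A)) (cap-sumOver {q} (λ μ → m₂ G μ == κ) (cap-count B))))
      (λ R κ κ′ → ⇔→≡ (linked⇒comp R κ κ′) (comp⇒linked R κ κ′))

  abstract
    mutual
      comp : ∀ n {p q s} → Glue r p q s → Type n p → Type n q → Type n s
      comp zero    G σ τ = mkT₀ (compOb G (obOf σ) (obOf τ))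
      comp (suc n) G σ τ = mkT (compOb G (obOf σ) (obOf τ)) (compSet n G σ τ)

      compSet : ∀ n {p q s} → Glue r p q s → Type (suc n) p → Type (suc n) q → Type n (bit s) → Bool
      compSet n G σ τ ρ = anyᵀ λ α → anyᵀ λ β → ((α ∈ᵀ σ) and′ (β ∈ᵀ τ)) and′ (comp n (lift G) α β ≡ᵀ ρ)

    obOf-comp : ∀ n {p q s} (G : Glue r p q s) σ τ → obOf (comp n G σ τ) ≡ compOb G (obOf σ) (obOf τ)
    obOf-comp zero    G σ τ = obOf-mkT₀ _
    obOf-comp (suc n) G σ τ = obOf-mkT _ (compSet n G σ τ)

    ∈-comp : ∀ n {p q s} (G : Glue r p q s) σ τ ρ → (ρ ∈ᵀ comp (suc n) G σ τ) ≡
             anyᵀ (λ α → anyᵀ λ β → ((α ∈ᵀ σ) and′ (β ∈ᵀ τ)) and′ (comp n (lift G) α β ≡ᵀ ρ))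
    ∈-comp n G σ τ ρ = ∈ᵀ-mkT _ (compSet n G σ τ) ρ

  ∈-comp-intro : ∀ n {p q s} (G : Glue r p q s) {σ τ} α β → α ∈ᵗ σ → β ∈ᵗ τ →
                 comp n (lift G) α β ∈ᵗ comp (suc n) G σ τ
  ∈-comp-intro n G {σ} {τ} α β a b = trans (∈-comp n G σ τ (comp n (lift G) α β))
    (anyᵀ-intro _ α (anyᵀ-intro _ β (and-intro (and-intro a b) (≡ᵀ-refl _))))

  ∈-comp-elim : ∀ n {p q s} (G : Glue r p q s) {σ τ} ρ → ρ ∈ᵗ comp (suc n) G σ τ →
                ∃ λ α → ∃ λ β → α ∈ᵗ σ × β ∈ᵗ τ × comp n (lift G) α β ≡ ρ
  ∈-comp-elim n G {σ} {τ} ρ e with anyᵀ-elim _ (trans (sym (∈-comp n G σ τ ρ)) e)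
  ... | α , e₁ with anyᵀ-elim _ e₁
  ... | β , e₂ with and-elim e₂
  ... | e₃ , e₄ with and-elim e₃
  ... | a , b = α , β , a , b , ≡ᵀ-sound e₄

  -- Composition in the manner of Feferman and Vaught: a set move in the glued structure is a pair
  -- of moves in the parts, which are then glued by `lift G`.
  tp-glue : ∀ n {p q s} (G : Glue r p q s) A B → tp n (glue G A B) ≡ comp n G (tp n A) (tp n B)
  tp-glue zero G A B = Type-ext₀
    (trans (obOf-tp 0 (glue G A B)) (trans (ob-glue G A B)
      (sym (trans (obOf-comp 0 G _ _) (cong₂ (compOb G) (obOf-tp 0 A) (obOf-tp 0 B))))))
  tp-glue (suc n) G A B = Type-ext
    (trans (obOf-tp (suc n) (glue G A B)) (trans (ob-glue G A B)
      (sym (trans (obOf-comp (suc n) G _ _) (cong₂ (compOb G) (obOf-tp (suc n) A) (obOf-tp (suc n) B))))))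
    to from
    where
    split : ∀ X → tp n (glue G A B ▹ X) ≡ comp n (lift G) (tp n (A ▹ X ∘ (_↑ˡ car B))) (tp n (B ▹ X ∘ (car A ↑ʳ_)))
    split X = trans (sym (tp-emb n (▹-glue G A B X))) (tp-glue n (lift G) (A ▹ X ∘ (_↑ˡ car B)) (B ▹ X ∘ (car A ↑ʳ_)))
    to : ∀ ρ → ρ ∈ᵗ tp (suc n) (glue G A B) → ρ ∈ᵗ comp (suc n) G (tp (suc n) A) (tp (suc n) B)
    to ρ e with ∈-tp-elim n (glue G A B) ρ e
    ... | X , refl = subst (_∈ᵗ comp (suc n) G (tp (suc n) A) (tp (suc n) B)) (sym (split X))
      (∈-comp-intro n G _ _ (∈-tp-intro n A _) (∈-tp-intro n B _))
    from : ∀ ρ → ρ ∈ᵗ comp (suc n) G (tp (suc n) A) (tp (suc n) B) → ρ ∈ᵗ tp (suc n) (glue G A B)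
    from ρ e with ∈-comp-elim n G ρ e
    ... | α , β , a , b , refl with ∈-tp-elim n A α a | ∈-tp-elim n B β b
    ... | X , refl | Y , refl = subst (_∈ᵗ tp (suc n) (glue G A B)) (trans (split Z) (cong₂ (comp n (lift G))
          (tp-emb n (▹-cong A λ x → cong [ X , Y ]′ (splitAt-↑ˡ (car A) x (car B))))
          (tp-emb n (▹-cong B λ y → cong [ X , Y ]′ (splitAt-↑ʳ (car A) (car B) y)))))
        (∈-tp-intro n (glue G A B) Z)
      where
      Z : Fin (car A + car B) → Bool
      Z z = [ X , Y ]′ (splitAt (car A) z)

  compOb-cong : ∀ {p q s} {G H : Glue r p q s} → G ≈ᴳ H → ∀ o o′ → compOb G o o′ ≡ compOb H o o′
  compOb-cong {p} {q} {s} {G} {H} e o o′ = mkOb-cong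
    (λ κ → cong cap (cong₂ _+_ (sumOver-congᴾ {p} (λ μ → e₁ κ μ) (cntOf o)) (sumOver-congᴾ {q} (λ μ → e₂ κ μ) (cntOf o′))))
    (λ R κ κ′ → cong₂ _or′_
      (cong₂ _or′_ (any²-cong {p} {p} λ μ μ′ → cong (_and′ lnkOf o R μ μ′) (cong₂ _and′_ (e₁ κ μ) (e₁ κ′ μ′)))
                 (any²-cong {q} {q} λ μ μ′ → cong (_and′ lnkOf o′ R μ μ′) (cong₂ _and′_ (e₂ κ μ) (e₂ κ′ μ′))))
      (cong₂ _or′_ (any²-cong {p} {q} λ μ μ′ → cong₂ _and′_ (cong₂ _and′_ (e₁ κ μ) (e₂ κ′ μ′)) (cong ((occurs o μ and′ occurs o′ μ′) and′_) (x₁₂≈ e R μ μ′)))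
                 (any²-cong {q} {p} λ μ μ′ → cong₂ _and′_ (cong₂ _and′_ (e₂ κ μ) (e₁ κ′ μ′)) (cong ((occurs o′ μ and′ occurs o μ′) and′_) (x₂₁≈ e R μ μ′)))))
    where
    e₁ : ∀ κ μ → (m₁ G μ == κ) ≡ (m₁ H μ == κ)
    e₁ κ μ = cong (_== κ) (m₁≈ e μ)
    e₂ : ∀ κ μ → (m₂ G μ == κ) ≡ (m₂ H μ == κ)
    e₂ κ μ = cong (_== κ) (m₂≈ e μ)

  comp-cong : ∀ n {p q s} {G H : Glue r p q s} → G ≈ᴳ H → ∀ σ τ → comp n G σ τ ≡ comp n H σ τ
  comp-cong zero {G = G} {H} e σ τ = Type-ext₀
    (trans (obOf-comp 0 G σ τ) (trans (compOb-cong e (obOf σ) (obOf τ)) (sym (obOf-comp 0 H σ τ))))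
  comp-cong (suc n) {G = G} {H} e σ τ = Type-ext
    (trans (obOf-comp (suc n) G σ τ) (trans (compOb-cong e (obOf σ) (obOf τ)) (sym (obOf-comp (suc n) H σ τ))))
    (half G H (λ α β → comp-cong n (lift-≈ e) α β)) (half H G (λ α β → sym (comp-cong n (lift-≈ e) α β)))
    where
    half : ∀ G H → (∀ α β → comp n (lift G) α β ≡ comp n (lift H) α β) → ∀ ρ →
           ρ ∈ᵗ comp (suc n) G σ τ → ρ ∈ᵗ comp (suc n) H σ τ
    half G H ih ρ e with ∈-comp-elim n G ρ e
    ... | α , β , a , b , refl = subst (_∈ᵗ comp (suc n) H σ τ) (sym (ih α β)) (∈-comp-intro n H α β a b)

  compOb-swap : ∀ {p q s} (G : Glue r p q s) o o′ → compOb G o o′ ≡ compOb (swap G) o′ o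
  compOb-swap {p} {q} G o o′ = mkOb-cong
    (λ κ → cong cap (+-comm (sumOver {p} (λ μ → m₁ G μ == κ) (cntOf o)) (sumOver {q} (λ μ → m₂ G μ == κ) (cntOf o′))))
    (λ R κ κ′ → cong₂ _or′_
      (or-comm (any² {p} {p} (within₁ G o o′ R κ κ′)) (any² {q} {q} (within₂ G o o′ R κ κ′)))
      (or-comm (any² {p} {q} (across₁₂ G o o′ R κ κ′)) (any² {q} {p} (across₂₁ G o o′ R κ κ′))))

  -- Children come without order: commutativity of `⊕` and the invariance of transitions under
  -- permutation both rest on this.
  comp-swap : ∀ n {p q s} (G : Glue r p q s) σ τ → comp n G σ τ ≡ comp n (swap G) τ σ
  comp-swap zero G σ τ = Type-ext₀
    (trans (obOf-comp 0 G σ τ) (trans (compOb-swap G (obOf σ) (obOf τ)) (sym (obOf-comp 0 (swap G) τ σ))))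
  comp-swap (suc n) G σ τ = Type-ext
    (trans (obOf-comp (suc n) G σ τ) (trans (compOb-swap G (obOf σ) (obOf τ)) (sym (obOf-comp (suc n) (swap G) τ σ))))
    (half G σ τ) (half (swap G) τ σ)
    where
    half : ∀ {p q s} (G : Glue r p q s) σ τ ρ → ρ ∈ᵗ comp (suc n) G σ τ → ρ ∈ᵗ comp (suc n) (swap G) τ σ
    half G σ τ ρ e with ∈-comp-elim n G ρ e
    ... | α , β , a , b , refl = subst (_∈ᵗ comp (suc n) (swap G) τ σ) (sym (comp-swap n (lift G) α β))
                                   (∈-comp-intro n (swap G) β α b a)

-- Multiples of a type

length-cartesianProductWith : ∀ {A B C : Set} (f : A → B → C) xs ys →
                              length (cartesianProductWith f xs ys) ≡ length xs * length ys
length-cartesianProductWith f []       ys = refl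
length-cartesianProductWith f (x ∷ xs) ys = trans (length-++ (map (f x) ys))
  (cong₂ _+_ (length-map (f x) ys) (length-cartesianProductWith f xs ys))

module Monoid (r M : ℕ) .{{_ : NonZero M}} where
  open Types r M
  open Composition r M

  lift-disj : ∀ {p} → lift (disj {r} {p}) ≈ᴳ disj
  lift-disj = record { m₁≈ = λ _ → refl ; m₂≈ = λ _ → refl ; x₁₂≈ = λ _ _ _ → refl ; x₂₁≈ = λ _ _ _ → refl }

  infixr 6 _⊕_
  _⊕_ : ∀ {n p} → Type n p → Type n p → Type n p
  _⊕_ {n} = comp n disj

  ε : ∀ {n p} → Type n p
  ε {n} = tp n ∅

  cnt-⊕ : ∀ {p} (o o′ : Obs p) κ → cntOf (compOb disj o o′) κ ≡ capᵗ (cntOf o κ + cntOf o′ κ)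
  cnt-⊕ {p} o o′ κ = trans (cntOf-mkOb (compCnt disj o o′) (compLnk disj o o′) κ)
    (cong capᵗ (cong₂ _+_ (sumOver-single {p} κ (cntOf o)) (sumOver-single {p} κ (cntOf o′))))

  lnk-⊕ : ∀ {p} (o o′ : Obs p) R κ μ → lnkOf (compOb disj o o′) R κ μ ≡ lnkOf o R κ μ ∨ lnkOf o′ R κ μ
  lnk-⊕ {p} o o′ R κ μ = trans (lnkOf-mkOb (compCnt disj o o′) (compLnk disj o o′) R κ μ) (⇔→≡ to from)
    where
    to : compLnk disj o o′ R κ μ ≡ true → lnkOf o R κ μ ∨ lnkOf o′ R κ μ ≡ true
    to e with or-elim e
    to e | inj₁ e′ with or-elim e′
    ... | inj₁ t with any²-elim {p} {p} (within₁ disj o o′ R κ μ) t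
    ...   | _ , _ , t₁ with and-elim t₁
    ...   | t₂ , t₃ with and-elim t₂
    ...   | a , b with ==-sound {p} a | ==-sound {p} b
    ...   | refl | refl = ∨-introˡ t₃
    to e | inj₁ e′ | inj₂ t with any²-elim {p} {p} (within₂ disj o o′ R κ μ) t
    ...   | _ , _ , t₁ with and-elim t₁
    ...   | t₂ , t₃ with and-elim t₂
    ...   | a , b with ==-sound {p} a | ==-sound {p} b
    ...   | refl | refl = ∨-introʳ {lnkOf o R κ μ} t₃
    to e | inj₂ e′ with or-elim e′
    ... | inj₁ t with any²-elim {p} {p} (across₁₂ disj o o′ R κ μ) t
    ...   | _ , _ , t₁ with and-elim t₁
    ...   | _ , t₃ with and-elim t₃
    ...   | _ , ()
    to e | inj₂ e′ | inj₂ t with any²-elim {p} {p} (across₂₁ disj o o′ R κ μ) t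
    ...   | _ , _ , t₁ with and-elim t₁
    ...   | _ , t₃ with and-elim t₃
    ...   | _ , ()
    from : lnkOf o R κ μ ∨ lnkOf o′ R κ μ ≡ true → compLnk disj o o′ R κ μ ≡ true
    from e with ∨-elim {lnkOf o R κ μ} e
    ... | inj₁ t = or-introˡ (or-introˡ (any²-intro {p} {p} (within₁ disj o o′ R κ μ) κ μ
                     (and-intro (and-intro (==-refl {p} κ) (==-refl {p} μ)) t)))
    ... | inj₂ t = or-introˡ (or-introʳ (any²-intro {p} {p} (within₂ disj o o′ R κ μ) κ μ
                     (and-intro (and-intro (==-refl {p} κ) (==-refl {p} μ)) t)))

  ∈-⊕-intro : ∀ {n p} {σ τ : Type (suc n) p} α β → α ∈ᵗ σ → β ∈ᵗ τ → (α ⊕ β) ∈ᵗ (σ ⊕ τ)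
  ∈-⊕-intro {n} {σ = σ} {τ} α β a b =
    subst (_∈ᵗ (σ ⊕ τ)) (comp-cong n lift-disj α β) (∈-comp-intro n disj α β a b)

  ∈-⊕-elim : ∀ {n p} {σ τ : Type (suc n) p} ρ → ρ ∈ᵗ (σ ⊕ τ) →
             ∃ λ α → ∃ λ β → α ∈ᵗ σ × β ∈ᵗ τ × ρ ≡ α ⊕ β
  ∈-⊕-elim {n} ρ e with ∈-comp-elim n disj ρ e
  ... | α , β , a , b , q = α , β , a , b , trans (sym q) (comp-cong n lift-disj α β)

  ⊕-comm : ∀ {n p} (σ τ : Type n p) → σ ⊕ τ ≡ τ ⊕ σ
  ⊕-comm {n} σ τ = trans (comp-swap n disj σ τ)
    (comp-cong n (record { m₁≈ = λ _ → refl ; m₂≈ = λ _ → refl ; x₁₂≈ = λ _ _ _ → refl ; x₂₁≈ = λ _ _ _ → refl }) τ σ)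

  cap-cap+ : ∀ x y → capᵗ (capᵗ x + y) ≡ capᵗ (x + y)
  cap-cap+ x y = cong toℕ (cap-+ {capᵗ x} {x} {y} {y} (cap-capᵗ x) refl)

  cap-+cap : ∀ x y → capᵗ (x + capᵗ y) ≡ capᵗ (x + y)
  cap-+cap x y = cong toℕ (cap-+ {x} {x} {capᵗ y} {y} refl (cap-capᵗ y))

  private
    ⊕ᵒ : ∀ {p} → Obs p → Obs p → Obs p
    ⊕ᵒ = compOb (disj {r})

  ⊕ᵒ-assoc : ∀ {p} (a b c : Obs p) → compOb disj (compOb disj a b) c ≡ compOb disj a (compOb disj b c)
  ⊕ᵒ-assoc a b c = Obs-ext
    (λ κ → begin
      cntOf (⊕ᵒ (⊕ᵒ a b) c) κ                    ≡⟨ cnt-⊕ (⊕ᵒ a b) c κ ⟩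
      capᵗ (cntOf (⊕ᵒ a b) κ + cntOf c κ)         ≡⟨ cong (λ z → capᵗ (z + cntOf c κ)) (cnt-⊕ a b κ) ⟩
      capᵗ (capᵗ (cntOf a κ + cntOf b κ) + cntOf c κ) ≡⟨ cap-cap+ (cntOf a κ + cntOf b κ) (cntOf c κ) ⟩
      capᵗ (cntOf a κ + cntOf b κ + cntOf c κ)    ≡⟨ cong capᵗ (+-assoc (cntOf a κ) (cntOf b κ) (cntOf c κ)) ⟩
      capᵗ (cntOf a κ + (cntOf b κ + cntOf c κ))  ≡⟨ cap-+cap (cntOf a κ) (cntOf b κ + cntOf c κ) ⟨
      capᵗ (cntOf a κ + capᵗ (cntOf b κ + cntOf c κ)) ≡⟨ cong (λ z → capᵗ (cntOf a κ + z)) (cnt-⊕ b c κ) ⟨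
      capᵗ (cntOf a κ + cntOf (⊕ᵒ b c) κ)         ≡⟨ cnt-⊕ a (⊕ᵒ b c) κ ⟨
      cntOf (⊕ᵒ a (⊕ᵒ b c)) κ                    ∎)
    (λ R κ μ → begin
      lnkOf (⊕ᵒ (⊕ᵒ a b) c) R κ μ                ≡⟨ lnk-⊕ (⊕ᵒ a b) c R κ μ ⟩
      lnkOf (⊕ᵒ a b) R κ μ ∨ lnkOf c R κ μ        ≡⟨ cong (_∨ lnkOf c R κ μ) (lnk-⊕ a b R κ μ) ⟩
      (lnkOf a R κ μ ∨ lnkOf b R κ μ) ∨ lnkOf c R κ μ ≡⟨ ∨-assoc (lnkOf a R κ μ) _ _ ⟩
      lnkOf a R κ μ ∨ (lnkOf b R κ μ ∨ lnkOf c R κ μ) ≡⟨ cong (lnkOf a R κ μ ∨_) (lnk-⊕ b c R κ μ) ⟨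
      lnkOf a R κ μ ∨ lnkOf (⊕ᵒ b c) R κ μ        ≡⟨ lnk-⊕ a (⊕ᵒ b c) R κ μ ⟨
      lnkOf (⊕ᵒ a (⊕ᵒ b c)) R κ μ                ∎)
    where open ≡-Reasoning

  obOf-⊕ : ∀ {n p} (σ τ : Type n p) → obOf (σ ⊕ τ) ≡ compOb disj (obOf σ) (obOf τ)
  obOf-⊕ {n} = obOf-comp n disj

  ⊕-assoc-ob : ∀ {n p} (ρ σ τ : Type n p) → obOf ((ρ ⊕ σ) ⊕ τ) ≡ obOf (ρ ⊕ (σ ⊕ τ))
  ⊕-assoc-ob ρ σ τ = begin
    obOf ((ρ ⊕ σ) ⊕ τ)                   ≡⟨ obOf-⊕ (ρ ⊕ σ) τ ⟩
    ⊕ᵒ (obOf (ρ ⊕ σ)) (obOf τ)           ≡⟨ cong (λ z → ⊕ᵒ z (obOf τ)) (obOf-⊕ ρ σ) ⟩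
    ⊕ᵒ (⊕ᵒ (obOf ρ) (obOf σ)) (obOf τ)  ≡⟨ ⊕ᵒ-assoc (obOf ρ) (obOf σ) (obOf τ) ⟩
    ⊕ᵒ (obOf ρ) (⊕ᵒ (obOf σ) (obOf τ))  ≡⟨ cong (⊕ᵒ (obOf ρ)) (obOf-⊕ σ τ) ⟨
    ⊕ᵒ (obOf ρ) (obOf (σ ⊕ τ))           ≡⟨ obOf-⊕ ρ (σ ⊕ τ) ⟨
    obOf (ρ ⊕ (σ ⊕ τ))                   ∎
    where open ≡-Reasoning

  -- The law holds for all codes of types, also those that no structure has; hence an induction on
  -- rounds in place of regrouping disjoint unions.
  ⊕-assoc : ∀ {n p} (ρ σ τ : Type n p) → (ρ ⊕ σ) ⊕ τ ≡ ρ ⊕ (σ ⊕ τ)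
  ⊕-assoc {zero}  ρ σ τ = Type-ext₀ (⊕-assoc-ob ρ σ τ)
  ⊕-assoc {suc n} ρ σ τ = Type-ext (⊕-assoc-ob ρ σ τ) to from
    where
    to : ∀ α → α ∈ᵗ ((ρ ⊕ σ) ⊕ τ) → α ∈ᵗ (ρ ⊕ (σ ⊕ τ))
    to α e with ∈-⊕-elim α e
    ... | βγ , δ , m , d , refl with ∈-⊕-elim βγ m
    ... | β , γ , b , c , refl = subst (_∈ᵗ (ρ ⊕ (σ ⊕ τ))) (sym (⊕-assoc β γ δ))
      (∈-⊕-intro β (γ ⊕ δ) b (∈-⊕-intro γ δ c d))
    from : ∀ α → α ∈ᵗ (ρ ⊕ (σ ⊕ τ)) → α ∈ᵗ ((ρ ⊕ σ) ⊕ τ)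
    from α e with ∈-⊕-elim α e
    ... | β , γδ , b , m , refl with ∈-⊕-elim γδ m
    ... | γ , δ , c , d , refl = subst (_∈ᵗ ((ρ ⊕ σ) ⊕ τ)) (⊕-assoc β γ δ)
      (∈-⊕-intro (β ⊕ γ) δ (∈-⊕-intro β γ b c) d)

  cnt-∅ : ∀ {p} (κ : El p) → cntOf (ob ∅) κ ≡ 0
  cnt-∅ κ = cntOf-mkOb _ (linked ∅) κ

  lnk-∅ : ∀ {p} R (κ μ : El p) → lnkOf (ob ∅) R κ μ ≡ false
  lnk-∅ R κ μ = lnkOf-mkOb (λ κ → card (at ∅ κ)) (linked ∅) R κ μ

  ⊕-identityˡ-ob : ∀ {n p} (τ : Type n p) → obOf (ε ⊕ τ) ≡ obOf τ
  ⊕-identityˡ-ob {n} τ = trans (obOf-⊕ ε τ) (trans (cong (λ z → ⊕ᵒ z (obOf τ)) (obOf-tp n ∅)) (Obs-ext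
    (λ κ → trans (cnt-⊕ (ob ∅) (obOf τ) κ) (trans (cong (λ z → capᵗ (z + cntOf (obOf τ) κ)) (cnt-∅ κ)) (cap-cntOf (obOf τ) κ)))
    (λ R κ μ → trans (lnk-⊕ (ob ∅) (obOf τ) R κ μ) (cong (_∨ lnkOf (obOf τ) R κ μ) (lnk-∅ R κ μ)))))

  ε-▹ : ∀ n {p} X → tp n (∅ {p = p} ▹ X) ≡ ε
  ε-▹ n X = tp-emb n (record { fun = id ; inj = id ; dom-f = λ () ; cover = λ () ; col-f = λ () ; lnk-f = λ _ () })

  ⊕-identityˡ : ∀ {n p} (τ : Type n p) → ε ⊕ τ ≡ τ
  ⊕-identityˡ {zero}  τ = Type-ext₀ (⊕-identityˡ-ob τ)
  ⊕-identityˡ {suc n} τ = Type-ext (⊕-identityˡ-ob τ) to from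
    where
    to : ∀ α → α ∈ᵗ (ε ⊕ τ) → α ∈ᵗ τ
    to α e with ∈-⊕-elim α e
    ... | β , γ , b , c , refl with ∈-tp-elim n ∅ β b
    ... | X , refl = subst (_∈ᵗ τ) (sym (trans (cong (_⊕ γ) (ε-▹ n X)) (⊕-identityˡ γ))) c
    from : ∀ α → α ∈ᵗ τ → α ∈ᵗ (ε ⊕ τ)
    from α e = subst (_∈ᵗ (ε ⊕ τ)) (⊕-identityˡ α)
      (∈-⊕-intro ε α (subst (_∈ᵗ ε) (ε-▹ n (λ ())) (∈-tp-intro n ∅ (λ ()))) e)

  ⊕-identityʳ : ∀ {n p} (τ : Type n p) → τ ⊕ ε ≡ τ
  ⊕-identityʳ τ = trans (⊕-comm τ ε) (⊕-identityˡ τ)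

  ⊕-exchange : ∀ {n p} (ρ σ τ : Type n p) → ρ ⊕ (σ ⊕ τ) ≡ σ ⊕ (ρ ⊕ τ)
  ⊕-exchange ρ σ τ = trans (sym (⊕-assoc ρ σ τ)) (trans (cong (_⊕ τ) (⊕-comm ρ σ)) (⊕-assoc σ ρ τ))

  ⨁ : ∀ {n p} → List (Type n p) → Type n p
  ⨁ []       = ε
  ⨁ (τ ∷ τs) = τ ⊕ ⨁ τs

  ⨁-++ : ∀ {n p} (σs τs : List (Type n p)) → ⨁ (σs ++ τs) ≡ ⨁ σs ⊕ ⨁ τs
  ⨁-++ []       τs = sym (⊕-identityˡ (⨁ τs))
  ⨁-++ (σ ∷ σs) τs = trans (cong (σ ⊕_) (⨁-++ σs τs)) (sym (⊕-assoc σ (⨁ σs) (⨁ τs)))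

  infixr 7 _·_
  _·_ : ∀ {n p} → ℕ → Type n p → Type n p
  a · τ = ⨁ (replicate a τ)

  ∈-·-elim : ∀ {n p} a {τ : Type (suc n) p} σ → σ ∈ᵗ (a · τ) →
             ∃ λ σs → length σs ≡ a × All (λ ρ → ρ ∈ᵗ τ) σs × σ ≡ ⨁ σs
  ∈-·-elim {n} zero σ e with ∈-tp-elim n ∅ σ e
  ... | X , refl = [] , refl , [] , ε-▹ n X
  ∈-·-elim (suc a) σ e with ∈-⊕-elim σ e
  ... | α , β , x , y , refl with ∈-·-elim a β y
  ... | σs , refl , all , refl = α ∷ σs , refl , x ∷ all , refl

  ∈-·-intro : ∀ {n p} {τ : Type (suc n) p} σs → All (λ ρ → ρ ∈ᵗ τ) σs → ⨁ σs ∈ᵗ (length σs · τ)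
  ∈-·-intro {n} [] [] = subst (_∈ᵗ ε) (ε-▹ n (λ ())) (∈-tp-intro n ∅ (λ ()))
  ∈-·-intro (σ ∷ σs) (x ∷ all) = ∈-⊕-intro σ (⨁ σs) x (∈-·-intro σs all)

  cnt-· : ∀ {n p} a (τ : Type n p) κ → cntOf (obOf (a · τ)) κ ≡ capᵗ (a * cntOf (obOf τ) κ)
  cnt-· {n} zero τ κ = trans (cong (λ z → cntOf z κ) (obOf-tp n ∅)) (cnt-∅ κ)
  cnt-· (suc a) τ κ = trans (cong (λ z → cntOf z κ) (obOf-⊕ τ (a · τ))) (trans (cnt-⊕ (obOf τ) (obOf (a · τ)) κ)
    (trans (cong (λ z → capᵗ (cntOf (obOf τ) κ + z)) (cnt-· a τ κ)) (cap-+cap (cntOf (obOf τ) κ) (a * cntOf (obOf τ) κ))))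

  lnk-· : ∀ {n p} a (τ : Type n p) R κ μ → lnkOf (obOf (suc a · τ)) R κ μ ≡ lnkOf (obOf τ) R κ μ
  lnk-· zero τ R κ μ = cong (λ z → lnkOf (obOf z) R κ μ) (⊕-identityʳ τ)
  lnk-· (suc a) τ R κ μ = trans (cong (λ z → lnkOf z R κ μ) (obOf-⊕ τ (suc a · τ))) (trans (lnk-⊕ (obOf τ) (obOf (suc a · τ)) R κ μ)
    (trans (cong (lnkOf (obOf τ) R κ μ ∨_) (lnk-· a τ R κ μ)) (∨-idem _)))

  -- Hereditary width: a list of at most `w` types contains all outcomes of a set move, and so again
  -- after every move. The threshold `θ` depends on the structure through this number alone.
  HW : ℕ → ∀ n {p} → Type n p → Set
  HW w zero    τ = ⊤
  HW w (suc n) τ = Σ (List (Type n _)) λ σs → length σs ≤ w × (∀ σ → σ ∈ᵗ τ → σ ∈ σs × HW w n σ)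

  HW-mono : ∀ {w v} → w ≤ v → ∀ n {p} {τ : Type n p} → HW w n τ → HW v n τ
  HW-mono le zero    h = tt
  HW-mono le (suc n) (σs , l , h) = σs , ℕ.≤-trans l le , λ σ e → proj₁ (h σ e) , HW-mono le n (proj₂ (h σ e))

  -- Each outcome of a move is composed from one outcome per part, hence the product.
  HW-comp : ∀ {w v} n {p q s} (G : Glue r p q s) {σ τ} → HW w n σ → HW v n τ → HW (w * v) n (comp n G σ τ)
  HW-comp zero G h k = tt
  HW-comp {w} {v} (suc n) G {σ} {τ} (σs , l , h) (τs , m , k) =
    cartesianProductWith (comp n (lift G)) σs τs ,
    ℕ.≤-trans (ℕ.≤-reflexive (length-cartesianProductWith (comp n (lift G)) σs τs)) (ℕ.*-mono-≤ l m) ,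
    members
    where
    members : ∀ ρ → ρ ∈ᵗ comp (suc n) G σ τ →
              ρ ∈ cartesianProductWith (comp n (lift G)) σs τs × HW (w * v) n ρ
    members ρ e with ∈-comp-elim n G ρ e
    ... | α , β , a , b , refl = ∈-cartesianProductWith⁺ (comp n (lift G)) (proj₁ (h α a)) (proj₁ (k β b))
                               , HW-comp n (lift G) (proj₂ (h α a)) (proj₂ (k β b))

  -- On at most one element every set is constant, so a move has at most two outcomes.
  HW-tp : ∀ n {p} (A : Str r p) → car A ≤ 1 → HW 2 n (tp n A)
  HW-tp zero    A le = tt
  HW-tp (suc n) A le = tp n (A ▹ λ _ → true) ∷ tp n (A ▹ λ _ → false) ∷ [] , ℕ.≤-refl , members
    where
    constant : ∀ {m} (X : Fin m → Bool) → m ≤ 1 → (X ≗ λ _ → true) ⊎ (X ≗ λ _ → false)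
    constant {zero} X _ = inj₁ λ ()
    constant {suc zero} X _ with X zero in e
    ... | true  = inj₁ λ { zero → e }
    ... | false = inj₂ λ { zero → e }
    constant {suc (suc m)} X (s≤s ())
    members : ∀ σ → σ ∈ᵗ tp (suc n) A →
              σ ∈ (tp n (A ▹ λ _ → true) ∷ tp n (A ▹ λ _ → false) ∷ []) × HW 2 n σ
    members σ e with ∈-tp-elim n A σ e
    ... | X , refl with constant X le
    ... | inj₁ q = here (tp-emb n (▹-cong A q)) , HW-tp n (A ▹ X) le
    ... | inj₂ q = there (here (tp-emb n (▹-cong A q))) , HW-tp n (A ▹ X) le

  module _ {n : ℕ} {p : Pal} {P : Type n p → Set} where

    -- Gathers all copies of `σ`. The property `P σ` is known only if there is a copy, hence the
    -- guard `0 < k`.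
    extract : ∀ σ τs → All P τs → ∃ λ k → ∃ λ ρs → length τs ≡ k + length ρs × ⨁ τs ≡ k · σ ⊕ ⨁ ρs ×
              (0 < k → P σ) × All P ρs × (∀ ρ → ρ ∈ ρs → ρ ∈ τs × ¬ ρ ≡ σ)
    extract σ [] [] = 0 , [] , refl , sym (⊕-identityˡ ε) , (λ ()) , [] , (λ _ ())
    extract σ (τ ∷ τs) (x ∷ all) with extract σ τs all | τ ≡ᵀ σ in eq
    ... | k , ρs , l , e , p₀ , all′ , f | true = suc k , ρs , cong suc l
        , trans (cong₂ _⊕_ (≡ᵀ-sound eq) e) (sym (⊕-assoc σ (k · σ) (⨁ ρs)))
        , (λ _ → subst P (≡ᵀ-sound eq) x) , all′ , λ ρ m → there (proj₁ (f ρ m)) , proj₂ (f ρ m)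
    ... | k , ρs , l , e , p₀ , all′ , f | false = k , τ ∷ ρs , trans (cong suc l) (sym (ℕ.+-suc k (length ρs)))
        , trans (cong (τ ⊕_) e) (⊕-exchange τ (k · σ) (⨁ ρs))
        , p₀ , x ∷ all′
        , λ { ρ (here refl) → here refl , (λ q → contra (trans (sym (≡ᵀ-complete q)) eq)) ; ρ (there m) → there (proj₁ (f ρ m)) , proj₂ (f ρ m) }
      where
      contra : ¬ true ≡ false
      contra ()

    -- If the first candidate occurs at most `m` times, its copies are set aside, and what remains
    -- is still longer than `m` times the number of remaining candidates.
    pigeonhole : ∀ m σs τs → (∀ ρ → ρ ∈ τs → ρ ∈ σs) → All P τs → length σs * m < length τs →
                 ∃ λ k → ∃ λ σ → ∃ λ ρs → m < k × length τs ≡ k + length ρs × ⨁ τs ≡ k · σ ⊕ ⨁ ρs × P σ × All P ρs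
    pigeonhole m [] (τ ∷ τs) f all lt with () ← f τ (here refl)
    pigeonhole m (σ ∷ σs) τs f all lt with extract σ τs all
    ... | k , ρs , l , e , p₀ , all′ , g with m <? k
    ... | yes m<k = k , σ , ρs , m<k , l , e , p₀ (ℕ.≤-<-trans z≤n m<k) , all′
    ... | no ¬m<k with pigeonhole m σs ρs inσs all′ lt′
      where
      inσs : ∀ ρ → ρ ∈ ρs → ρ ∈ σs
      inσs ρ i with f ρ (proj₁ (g ρ i))
      ... | here q  = ⊥-elim (proj₂ (g ρ i) q)
      ... | there j = j
      lt′ : length σs * m < length ρs
      lt′ = ℕ.+-cancelˡ-< m _ _ (ℕ.<-≤-trans (ℕ.<-≤-trans lt (ℕ.≤-reflexive l)) (ℕ.+-monoˡ-≤ (length ρs) (ℕ.≮⇒≥ ¬m<k)))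
    ... | k′ , σ′ , ρs′ , m<k′ , l′ , e′ , x , all″ = k′ , σ′ , replicate k σ ++ ρs′ , m<k′
        , (begin
            length τs                                  ≡⟨ l ⟩
            k + length ρs                              ≡⟨ cong (k +_) l′ ⟩
            k + (k′ + length ρs′)                      ≡⟨ x∙yz≈y∙xz k k′ (length ρs′) ⟩
            k′ + (k + length ρs′)                      ≡⟨ cong (λ z → k′ + (z + length ρs′)) (length-replicate k) ⟨
            k′ + (length (replicate k σ) + length ρs′) ≡⟨ cong (k′ +_) (length-++ (replicate k σ)) ⟨
            k′ + length (replicate k σ ++ ρs′)         ∎)
        , (begin
            ⨁ τs                                ≡⟨ e ⟩
            k · σ ⊕ ⨁ ρs                        ≡⟨ cong (k · σ ⊕_) e′ ⟩
            k · σ ⊕ (k′ · σ′ ⊕ ⨁ ρs′)           ≡⟨ ⊕-exchange (k · σ) (k′ · σ′) (⨁ ρs′) ⟩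
            k′ · σ′ ⊕ (k · σ ⊕ ⨁ ρs′)           ≡⟨ cong (k′ · σ′ ⊕_) (⨁-++ (replicate k σ) ρs′) ⟨
            k′ · σ′ ⊕ ⨁ (replicate k σ ++ ρs′)  ∎)
        , x , All.++⁺ (copies k p₀) all″
      where
      open ≡-Reasoning
      copies : ∀ k → (0 < k → P σ) → All P (replicate k σ)
      copies zero    _ = []
      copies (suc k) f = f (s≤s z≤n) ∷ copies k (λ _ → f (s≤s z≤n))

  -- θ w n bounds the number of copies of a structure of hereditary width w that n rounds can tell apart.
  θ : ℕ → ℕ → ℕ
  θ w zero    = 2
  θ w (suc n) = 2 + w * (θ w n + M)

  2≤θ : ∀ w n → 2 ≤ θ w n
  2≤θ w zero    = ℕ.≤-refl
  2≤θ w (suc n) = s≤s (s≤s z≤n)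

  -- Two copies suffice: a colour present in `τ` then has count at least 2, from where only the
  -- residue matters, and links are the same for every positive number of copies.
  ·-periodic-ob : ∀ {n p} (τ : Type n p) a → 2 ≤ a → obOf ((M + a) · τ) ≡ obOf (a · τ)
  ·-periodic-ob τ (suc a) 2≤a = Obs-ext
    (λ κ → trans (cnt-· (M + suc a) τ κ) (trans (period (cntOf (obOf τ) κ)) (sym (cnt-· (suc a) τ κ))))
    (λ R κ μ → trans (cong (λ z → lnkOf (obOf (z · τ)) R κ μ) (ℕ.+-suc M a))
      (trans (lnk-· (M + a) τ R κ μ) (sym (lnk-· a τ R κ μ))))
    where
    period : ∀ x → capᵗ ((M + suc a) * x) ≡ capᵗ (suc a * x)
    period zero    = cong capᵗ (trans (ℕ.*-zeroʳ (M + suc a)) (sym (ℕ.*-zeroʳ (suc a))))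
    period (suc x) = trans (cong capᵗ (trans (ℕ.*-distribʳ-+ (suc x) M (suc a)) (cong (_+ suc a * suc x) (ℕ.*-comm M (suc x)))))
      (cong toℕ (cap-period (suc a * suc x) (ℕ.≤-trans 2≤a (ℕ.m≤m*n (suc a) (suc x))) (suc x)))

  -- Among sufficiently many chosen members of τ, some member is chosen so often that,
  -- by induction, M copies of it can be added or removed.
  ·-periodic : ∀ w n {p} {τ : Type n p} → HW w n τ → ∀ a → θ w n ≤ a → (M + a) · τ ≡ a · τ
  ·-periodic w zero    {τ = τ} h a le = Type-ext₀ (·-periodic-ob τ a le)
  ·-periodic w (suc n) {p} {τ} (ls , l , h) a le = Type-ext (·-periodic-ob τ a (ℕ.≤-trans (2≤θ w (suc n)) le)) shrink grow
    where
    m = θ w n + M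
    InHW : Type n (bit p) → Set
    InHW ρ = ρ ∈ᵗ τ × HW w n ρ
    many : ∀ {b} → a ≤ b → length ls * m < b
    many le′ = ℕ.<-≤-trans (s≤s (ℕ.≤-trans (ℕ.*-monoˡ-≤ m l) (ℕ.n≤1+n _))) (ℕ.≤-trans le le′)
    Chosen : List (Type n (bit p)) → Set
    Chosen σs = ∃ λ k → ∃ λ ρ → ∃ λ ρs → m < k × length σs ≡ k + length ρs × ⨁ σs ≡ k · ρ ⊕ ⨁ ρs ×
                InHW ρ × All InHW ρs
    choose : ∀ σs → All (λ ρ → ρ ∈ᵗ τ) σs → a ≤ length σs → Chosen σs
    choose σs all le′ = pigeonhole m ls σs (λ ρ i → proj₁ (h ρ (All.lookup all i)))
      (All.map (λ {ρ} e → e , proj₂ (h ρ e)) all) (many le′)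
    again : ∀ k ρ ρs → InHW ρ → All InHW ρs → k · ρ ⊕ ⨁ ρs ∈ᵗ (k + length ρs) · τ
    again k ρ ρs x all = subst₂ (λ z b → z ∈ᵗ b · τ) (⨁-++ (replicate k ρ) ρs)
      (trans (length-++ (replicate k ρ)) (cong (_+ length ρs) (length-replicate k)))
      (∈-·-intro (replicate k ρ ++ ρs) (All.++⁺ (All.replicate⁺ k (proj₁ x)) (All.map proj₁ all)))
    shrink : ∀ σ → σ ∈ᵗ (M + a) · τ → σ ∈ᵗ a · τ
    shrink σ e with ∈-·-elim (M + a) σ e
    ... | σs , q , all , refl with choose σs all (ℕ.≤-trans (ℕ.m≤n+m a M) (ℕ.≤-reflexive (sym q)))
    ... | k , ρ , ρs , m<k , q′ , e′ , x , all′ with ℕ.m≤n⇒∃[o]m+o≡n (ℕ.≤-trans (ℕ.m≤n+m M (θ w n)) (ℕ.<⇒≤ m<k))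
    ... | k′ , refl = subst₂ (λ z b → z ∈ᵗ b · τ)
          (sym (trans e′ (cong (_⊕ ⨁ ρs) (·-periodic w n (proj₂ x) k′ θ≤k′))))
          (ℕ.+-cancelˡ-≡ M _ _ (trans (sym (ℕ.+-assoc M k′ (length ρs))) (trans (sym q′) q)))
          (again k′ ρ ρs x all′)
      where
      θ≤k′ : θ w n ≤ k′
      θ≤k′ = ℕ.+-cancelˡ-≤ M _ _ (ℕ.≤-trans (ℕ.≤-reflexive (ℕ.+-comm M (θ w n))) (ℕ.<⇒≤ m<k))
    grow : ∀ σ → σ ∈ᵗ a · τ → σ ∈ᵗ (M + a) · τ
    grow σ e with ∈-·-elim a σ e
    ... | σs , refl , all , refl with choose σs all ℕ.≤-refl
    ... | k , ρ , ρs , m<k , q′ , e′ , x , all′ = subst₂ (λ z b → z ∈ᵗ b · τ)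
          (sym (trans e′ (cong (_⊕ ⨁ ρs) (sym (·-periodic w n (proj₂ x) k (ℕ.≤-trans (ℕ.m≤m+n (θ w n) M) (ℕ.<⇒≤ m<k)))))))
          (trans (ℕ.+-assoc M k (length ρs)) (cong (M +_) (sym q′)))
          (again (M + k) ρ ρs x all′)

-- Representatives of the trees of bounded height

Full : ∀ {r p} → Str r p → Set
Full A = ∀ x → dom A x ≡ true

Full-glue : ∀ {r p q s} (G : Glue r p q s) {A B} → Full A → Full B → Full (glue G A B)
Full-glue G {A} {B} a b = ↑-elim (car A) _ (λ x → trans (dom-l G A B x) (a x)) (λ y → trans (dom-u G A B y) (b y))

-- The first bit of a colour marks the roots.
module _ {c : Pal} where

  rootGlue : Glue 1 (bit c) (bit c) (bit c)
  rootGlue = record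
    { m₁ = id ; m₂ = λ (_ , κ) → false , κ
    ; x₁₂ = λ _ _ (root , _) → root ; x₂₁ = λ _ _ _ → false }

  point : El c → Str 1 (bit c)
  point κ = record { car = 1 ; dom = λ _ → true ; col = λ _ → true , κ ; lnk = λ _ _ _ → false }

module Representatives (M : ℕ) .{{_ : NonZero M}} (n : ℕ) (c : Pal) where
  open Types 1 M
  open Composition 1 M
  open Monoid 1 M

  private
    Ty = Type n (bit c)
    S  = Str 1 (bit c)

  nodeType : El c → Ty → Ty
  nodeType κ τ = comp n rootGlue (tp n (point κ)) τ

  -- Height at most `h`, not exactly `h`: an empty `τs` admits leaves at every level.
  TreeType : ℕ → Ty → Set
  TreeType zero    τ = ∃ λ κ → τ ≡ nodeType κ ε
  TreeType (suc h) τ = ∃ λ κ → ∃ λ τs → All (TreeType h) τs × τ ≡ nodeType κ (⨁ τs)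

  copies : ℕ → S → S
  copies zero    A = ∅
  copies (suc k) A = glue disj A (copies k A)

  family : ∀ {N} → (Fin N → S) → S
  family {zero}  F = ∅
  family {suc N} F = glue disj (F zero) (family (F ∘ suc))

  ⨁ᶠ : ∀ {N} → (Fin N → Ty) → Ty
  ⨁ᶠ {zero}  f = ε
  ⨁ᶠ {suc N} f = f zero ⊕ ⨁ᶠ (f ∘ suc)

  ⨁ᶠ-cong : ∀ {N} {f g : Fin N → Ty} → f ≗ g → ⨁ᶠ f ≡ ⨁ᶠ g
  ⨁ᶠ-cong {zero}  e = refl
  ⨁ᶠ-cong {suc N} e = cong₂ _⊕_ (e zero) (⨁ᶠ-cong (e ∘ suc))

  tp-copies : ∀ k A → tp n (copies k A) ≡ k · tp n A
  tp-copies zero    A = refl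
  tp-copies (suc k) A = trans (tp-glue n disj A (copies k A)) (cong (tp n A ⊕_) (tp-copies k A))

  tp-family : ∀ {N} (F : Fin N → S) → tp n (family F) ≡ ⨁ᶠ (tp n ∘ F)
  tp-family {zero}  F = refl
  tp-family {suc N} F = trans (tp-glue n disj (F zero) (family (F ∘ suc))) (cong (tp n (F zero) ⊕_) (tp-family (F ∘ suc)))

  Full-∅ : Full (∅ {1} {bit c})
  Full-∅ ()

  Full-copies : ∀ k {A} → Full A → Full (copies k A)
  Full-copies zero    a = Full-∅
  Full-copies (suc k) {A} a = Full-glue disj {A} {copies k A} a (Full-copies k a)

  Full-family : ∀ {N} {F : Fin N → S} → (∀ j → Full (F j)) → Full (family F)
  Full-family {zero}  a = Full-∅
  Full-family {suc N} {F} a = Full-glue disj {F zero} {family (F ∘ suc)} (a zero) (Full-family (a ∘ suc))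

  HW-glue : ∀ {w v p q s} (G : Glue 1 p q s) A B → HW w n (tp n A) → HW v n (tp n B) → HW (w * v) n (tp n (glue G A B))
  HW-glue {w} {v} G A B h k = subst (HW (w * v) n) (sym (tp-glue n G A B)) (HW-comp n G h k)

  HW-copies : ∀ {w} k A → HW w n (tp n A) → HW (w ^ k * 2) n (tp n (copies k A))
  HW-copies zero    A h = HW-tp n ∅ z≤n
  HW-copies {w} (suc k) A h = subst (λ v → HW v n (tp n (copies (suc k) A))) (sym (ℕ.*-assoc w (w ^ k) 2))
    (HW-glue disj A (copies k A) h (HW-copies k A h))

  HW-family : ∀ {w N} (F : Fin N → S) → (∀ j → HW w n (tp n (F j))) → HW (w ^ N * 2) n (tp n (family F))
  HW-family {N = zero}  F h = HW-tp n ∅ z≤n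
  HW-family {w} {suc N} F h = subst (λ v → HW v n (tp n (family F))) (sym (ℕ.*-assoc w (w ^ N) 2))
    (HW-glue disj (F zero) (family (F ∘ suc)) (h zero) (HW-family (F ∘ suc) (h ∘ suc)))

  mutual
    -- A representative of the next height consists of a root colour and a multiplicity below
    -- `bound h` for each representative of height `h`.
    #reps : ℕ → ℕ
    #reps zero    = ⟦ c ⟧
    #reps (suc h) = ⟦ c ⟧ * bound h ^ #reps h

    bound : ℕ → ℕ
    bound h = θ (width h) n + M

    -- The factors mirror the gluings in `rep`: 2 for the root, powers for the copies of a subtree
    -- and for the family of subtrees, and a further 2 for each `∅` that ends an iterated gluing.
    width : ℕ → ℕ
    width zero    = 2 * 2
    width (suc h) = 2 * ((width h ^ bound h * 2) ^ #reps h * 2)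

  multiplicity : ∀ h → Fin (#reps (suc h)) → Fin (#reps h) → Fin (bound h)
  multiplicity h i = finToFun (proj₂ (remQuot {⟦ c ⟧} (bound h ^ #reps h) i))

  rootColour : ∀ h → Fin (#reps (suc h)) → El c
  rootColour h i = dec c (proj₁ (remQuot {⟦ c ⟧} (bound h ^ #reps h) i))

  rep : ∀ h → Fin (#reps h) → S
  rep zero    i = glue rootGlue (point (dec c i)) ∅
  rep (suc h) i = glue rootGlue (point (rootColour h i)) (family λ j → copies (toℕ (multiplicity h i j)) (rep h j))

  subtrees : ∀ h → Fin (#reps (suc h)) → Fin (#reps h) → S
  subtrees h i j = copies (toℕ (multiplicity h i j)) (rep h j)

  Full-rep : ∀ h i → Full (rep h i)
  Full-rep zero    i = Full-glue rootGlue {point (dec c i)} {∅} (λ _ → refl) Full-∅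
  Full-rep (suc h) i = Full-glue rootGlue {point (rootColour h i)} {family (subtrees h i)} (λ _ → refl)
    (Full-family λ j → Full-copies (toℕ (multiplicity h i j)) (Full-rep h j))

  2≤width : ∀ h → 2 ≤ width h
  2≤width zero    = ℕ.m≤n*m 2 2
  2≤width (suc h) = ℕ.m≤m*n 2 (forest * 2) {{ℕ.m*n≢0 forest 2 {{ℕ.m^n≢0 tree (#reps h) {{tree≢0}}}}}}
    where
    tree = width h ^ bound h * 2
    forest = tree ^ #reps h
    tree≢0 : NonZero tree
    tree≢0 = ℕ.m*n≢0 (width h ^ bound h) 2 {{ℕ.m^n≢0 (width h) (bound h) {{>-nonZero (ℕ.≤-trans (s≤s z≤n) (2≤width h))}}}}

  HW-rep : ∀ h i → HW (width h) n (tp n (rep h i))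
  HW-rep zero    i = HW-glue rootGlue (point (dec c i)) ∅ (HW-tp n _ ℕ.≤-refl) (HW-tp n ∅ z≤n)
  HW-rep (suc h) i = HW-glue rootGlue (point (rootColour h i)) (family (subtrees h i)) (HW-tp n _ ℕ.≤-refl)
    (HW-family (subtrees h i) λ j → HW-mono (ℕ.*-monoˡ-≤ 2 (ℕ.^-monoʳ-≤ (width h) {{>-nonZero (ℕ.≤-trans (s≤s z≤n) (2≤width h))}}
                                    (ℕ.<⇒≤ (toℕ<n (multiplicity h i j)))))
                        n (HW-copies (toℕ (multiplicity h i j)) (rep h j) (HW-rep h j)))

  tally : ∀ {N} → List (Fin N) → Fin N → ℕ
  tally []       i = 0
  tally (x ∷ xs) i = if i ≡ᶠ x then suc (tally xs i) else tally xs i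

  ⨁ᶠ-bump : ∀ {N} (T : Fin N → Ty) (k : Fin N → ℕ) x →
            ⨁ᶠ (λ i → (if i ≡ᶠ x then suc (k i) else k i) · T i) ≡ T x ⊕ ⨁ᶠ (λ i → k i · T i)
  ⨁ᶠ-bump {suc N} T k zero = ⊕-assoc (T zero) (k zero · T zero) _
  ⨁ᶠ-bump {suc N} T k (suc x) = trans (cong (k zero · T zero ⊕_)
      (trans (⨁ᶠ-cong λ i → cong (λ b → (if b then suc (k (suc i)) else k (suc i)) · T (suc i)) (suc-≡ᶠ i x))
             (⨁ᶠ-bump (T ∘ suc) (k ∘ suc) x)))
    (⊕-exchange (k zero · T zero) (T (suc x)) _)

  ⨁ᶠ-ε : ∀ N → ⨁ᶠ {N} (λ _ → ε) ≡ ε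
  ⨁ᶠ-ε zero    = refl
  ⨁ᶠ-ε (suc N) = trans (⊕-identityˡ _) (⨁ᶠ-ε N)

  ⨁-tally : ∀ {N} (T : Fin N → Ty) xs → ⨁ (map T xs) ≡ ⨁ᶠ (λ i → tally xs i · T i)
  ⨁-tally {N} T []       = sym (⨁ᶠ-ε N)
  ⨁-tally T (x ∷ xs) = trans (cong (T x ⊕_) (⨁-tally T xs)) (sym (⨁ᶠ-bump T (tally xs) x))

  -- The surplus over the threshold is reduced modulo `M`, one period at a time; this explains the
  -- value `θ (width h) n + M` of `bound h`.
  ·-reduce : ∀ w {τ : Ty} → HW w n τ → ∀ k → ∃ λ k′ → k′ < θ w n + M × k′ · τ ≡ k · τ
  ·-reduce w {τ} h k with k <? θ w n
  ... | yes k<θ = k , ℕ.<-≤-trans k<θ (ℕ.m≤m+n _ M) , refl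
  ... | no ¬k<θ with ℕ.m≤n⇒∃[o]m+o≡n (ℕ.≮⇒≥ ¬k<θ)
  ... | d , refl = θ w n + d % M , ℕ.+-monoʳ-< (θ w n) (m%n<n d M) , sym (trans (cong (_· τ) (begin
      θ w n + d                             ≡⟨ cong (θ w n +_) (m≡m%n+[m/n]*n d M) ⟩
      θ w n + (d % M + d / M * M)           ≡⟨ +-assoc (θ w n) (d % M) (d / M * M) ⟨
      θ w n + d % M + d / M * M             ≡⟨ +-comm (θ w n + d % M) (d / M * M) ⟩
      d / M * M + (θ w n + d % M)           ∎)) (drop (d / M)))
    where
    open ≡-Reasoning
    drop : ∀ q → (q * M + (θ w n + d % M)) · τ ≡ (θ w n + d % M) · τ
    drop zero    = refl
    drop (suc q) = trans (cong (_· τ) (+-assoc M (q * M) _))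
      (trans (·-periodic w n h (q * M + (θ w n + d % M)) (ℕ.≤-trans (ℕ.m≤m+n (θ w n) (d % M)) (ℕ.m≤n+m _ (q * M)))) (drop q))

  -- By induction every child has the type of a representative. Counting children by representative
  -- and reducing each count below `bound h` leaves their sum unchanged.
  rep-complete : ∀ h {τ} → TreeType h τ → ∃ λ i → tp n (rep h i) ≡ τ
  rep-complete zero (κ , refl) = enc c κ , trans (tp-glue n rootGlue _ ∅) (cong (λ z → nodeType z ε) (dec-enc c κ))
  rep-complete (suc h) (κ , τs , all , refl) = i , node≡
    where
    T : Fin (#reps h) → Ty
    T j = tp n (rep h j)
    indices : ∀ {τs} → All (TreeType h) τs → ∃ λ xs → map T xs ≡ τs
    indices [] = [] , refl
    indices (t ∷ ts) = let x , e = rep-complete h t ; xs , es = indices ts in x ∷ xs , cong₂ _∷_ e es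
    xs = proj₁ (indices all)
    small : ∀ j → ∃ λ k′ → k′ < bound h × k′ · T j ≡ tally xs j · T j
    small j = ·-reduce (width h) (HW-rep h j) (tally xs j)
    ks : Fin (#reps h) → Fin (bound h)
    ks j = fromℕ< (proj₁ (proj₂ (small j)))
    i : Fin (#reps (suc h))
    i = combine (enc c κ) (funToFin ks)
    rq : remQuot {⟦ c ⟧} (bound h ^ #reps h) i ≡ (enc c κ , funToFin ks)
    rq = remQuot-combine (enc c κ) (funToFin ks)
    rootColour≡ : rootColour h i ≡ κ
    rootColour≡ = trans (cong (dec c ∘ proj₁) rq) (dec-enc c κ)
    multiplicity≡ : ∀ j → toℕ (multiplicity h i j) ≡ proj₁ (small j)
    multiplicity≡ j = trans (cong toℕ (trans (cong (λ z → finToFun (proj₂ z) j) rq) (finToFun-funToFin ks j)))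
                            (toℕ-fromℕ< (proj₁ (proj₂ (small j))))
    forest : tp n (family (subtrees h i)) ≡ ⨁ τs
    forest = begin
      tp n (family (subtrees h i))                ≡⟨ tp-family (subtrees h i) ⟩
      ⨁ᶠ (tp n ∘ subtrees h i)                 ≡⟨ ⨁ᶠ-cong (λ j → trans (tp-copies (toℕ (multiplicity h i j)) (rep h j))
                                          (trans (cong (_· T j) (multiplicity≡ j)) (proj₂ (proj₂ (small j))))) ⟩
      ⨁ᶠ (λ j → tally xs j · T j)   ≡⟨ ⨁-tally T xs ⟨
      ⨁ (map T xs)                   ≡⟨ cong ⨁ (proj₂ (indices all)) ⟩
      ⨁ τs                           ∎
      where open ≡-Reasoning
    node≡ : tp n (rep (suc h) i) ≡ nodeType κ (⨁ τs)
    node≡ = trans (tp-glue n rootGlue (point (rootColour h i)) (family (subtrees h i))) (cong₂ nodeType rootColour≡ forest)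

-- Labelled trees as coloured structures

module TreeStructure {L : ℕ} {c : Pal} (χ : Lab L → ℕ → El c) where

  mutual
    -- `i` is the preorder number of the root, which lets a colour depend on the individual node;
    -- carriers are laid out in preorder, as in `flat`.
    treeS : Tree L → ℕ → Str 1 (bit c)
    treeS (node l ts) i = glue rootGlue (point (χ l i)) (forestS ts (suc i))

    forestS : List (Tree L) → ℕ → Str 1 (bit c)
    forestS []       j = ∅
    forestS (t ∷ ts) j = glue disj (treeS t j) (forestS ts (j + car (treeS t j)))

  mutual
    Full-tree : ∀ t i → Full (treeS t i)
    Full-tree (node l ts) i = Full-glue rootGlue {point (χ l i)} {forestS ts (suc i)} (λ _ → refl) (Full-forest ts (suc i))

    Full-forest : ∀ ts j → Full (forestS ts j)
    Full-forest []       j ()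
    Full-forest (t ∷ ts) j = Full-glue disj {treeS t j} {forestS ts (j + car (treeS t j))} (Full-tree t j) (Full-forest ts _)

  -- Lookup by number with a dummy past the end: positions in a concatenation become arithmetic
  -- instead of casts between `Fin` types.
  entry : List (Lab L × Maybe ℕ) → ℕ → Lab L × Maybe ℕ
  entry []       k       = (λ _ → false) , nothing
  entry (e ∷ es) zero    = e
  entry (e ∷ es) (suc k) = entry es k

  entry-lookup : ∀ es (j : Fin (length es)) → entry es (toℕ j) ≡ List.lookup es j
  entry-lookup (e ∷ es) zero    = refl
  entry-lookup (e ∷ es) (suc j) = entry-lookup es j

  entry-++ˡ : ∀ es fs {k} → k < length es → entry (es ++ fs) k ≡ entry es k
  entry-++ˡ (e ∷ es) fs {zero}  lt       = refl
  entry-++ˡ (e ∷ es) fs {suc k} (s≤s lt) = entry-++ˡ es fs lt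

  entry-++ʳ : ∀ es fs k → entry (es ++ fs) (length es + k) ≡ entry fs k
  entry-++ʳ []       fs k = refl
  entry-++ʳ (e ∷ es) fs k = entry-++ʳ es fs k

  mutual
    length-flat : ∀ t p i → length (flat t p i) ≡ car (treeS t i)
    length-flat (node l ts) p i = cong suc (length-flatL ts i (suc i))

    length-flatL : ∀ ts p j → length (flatL ts p j) ≡ car (forestS ts j)
    length-flatL []       p j = refl
    length-flatL (t ∷ ts) p j = trans (length-++ (flat t (just p) j)) (cong₂ _+_ (length-flat t (just p) j)
      (trans (cong (λ z → length (flatL ts p (j + z))) (length-flat t (just p) j)) (length-flatL ts p (j + car (treeS t j)))))

  module _ (t : Tree L) (ts : List (Tree L)) (p j : ℕ) where

    private
      j′ = j + car (treeS t j)
      A  = treeS t j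
      B  = forestS ts j′

    entry-head : ∀ (x : Fin (car A)) → entry (flatL (t ∷ ts) p j) (toℕ (x ↑ˡ car B)) ≡ entry (flat t (just p) j) (toℕ x)
    entry-head x = trans (cong (entry (flatL (t ∷ ts) p j)) (toℕ-↑ˡ x (car B)))
      (entry-++ˡ (flat t (just p) j) _ (subst (toℕ x <_) (sym (length-flat t (just p) j)) (toℕ<n x)))

    entry-tail : ∀ (y : Fin (car B)) → entry (flatL (t ∷ ts) p j) (toℕ (car A ↑ʳ y)) ≡ entry (flatL ts p j′) (toℕ y)
    entry-tail y = begin
      entry (flatL (t ∷ ts) p j) (toℕ (car A ↑ʳ y))        ≡⟨ cong (entry (flatL (t ∷ ts) p j)) (toℕ-↑ʳ (car A) y) ⟩
      entry (flatL (t ∷ ts) p j) (car A + toℕ y)            ≡⟨ cong (λ z → entry (flatL (t ∷ ts) p j) (z + toℕ y)) (length-flat t (just p) j) ⟨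
      entry (flatL (t ∷ ts) p j) (length es + toℕ y)        ≡⟨ entry-++ʳ es _ (toℕ y) ⟩
      entry (flatL ts p (j + length es)) (toℕ y)            ≡⟨ cong (λ z → entry (flatL ts p (j + z)) (toℕ y)) (length-flat t (just p) j) ⟩
      entry (flatL ts p j′) (toℕ y)                          ∎
      where
      open ≡-Reasoning
      es = flat t (just p) j

    offset-tail : ∀ (y : Fin (car B)) → j + toℕ (car A ↑ʳ y) ≡ j′ + toℕ y
    offset-tail y = trans (cong (j +_) (toℕ-↑ʳ (car A) y)) (sym (+-assoc j (car A) (toℕ y)))

  mutual
    colour-tree : ∀ t p i x → proj₂ (col (treeS t i) x) ≡ χ (proj₁ (entry (flat t p i) (toℕ x))) (i + toℕ x)
    colour-tree (node l ts) p i zero    = cong (χ l) (sym (+-identityʳ i))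
    colour-tree (node l ts) p i (suc x) = trans (colour-forest ts i (suc i) x)
      (cong (χ (proj₁ (entry (flatL ts i (suc i)) (toℕ x)))) (sym (+-suc i (toℕ x))))

    colour-forest : ∀ ts p j x → proj₂ (col (forestS ts j) x) ≡ χ (proj₁ (entry (flatL ts p j) (toℕ x))) (j + toℕ x)
    colour-forest (t ∷ ts) p j = ↑-elim (car A) _
      (λ x → trans (cong proj₂ (col-l disj A B x)) (trans (colour-tree t (just p) j x)
        (cong₂ (λ e k → χ (proj₁ e) (j + k)) (sym (entry-head t ts p j x)) (sym (toℕ-↑ˡ x (car B))))))
      (λ y → trans (cong proj₂ (col-u disj A B y)) (trans (colour-forest ts p (j + car A) y)
        (cong₂ (λ e k → χ (proj₁ e) k) (sym (entry-tail t ts p j y)) (sym (offset-tail t ts p j y)))))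
      where
      A = treeS t j
      B = forestS ts (j + car A)

  -- The Boolean tells whether the entry is a root of its forest.
  Parent : Maybe ℕ → ℕ → ℕ → Bool → Maybe ℕ → Set
  Parent p i n true  q = q ≡ p
  Parent p i n false q = ∃ λ k → q ≡ just (i + k) × k < n

  Parent-widen : ∀ {p i n n′} b {q} → n ≤ n′ → Parent p i n b q → Parent p i n′ b q
  Parent-widen true  le e = e
  Parent-widen false le (k , e , lt) = k , e , ℕ.<-≤-trans lt le

  Parent-shift : ∀ {p i n} m b {q} → Parent p (i + m) n b q → Parent p i (m + n) b q
  Parent-shift m true e = e
  Parent-shift {i = i} m false (k , e , lt) = m + k , trans e (cong just (+-assoc i m k)) , ℕ.+-monoʳ-< m lt

  mutual
    parent-tree : ∀ t p i y → Parent p i (car (treeS t i)) (proj₁ (col (treeS t i) y)) (proj₂ (entry (flat t p i) (toℕ y)))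
    parent-tree (node l ts) p i zero    = refl
    parent-tree (node l ts) p i (suc y) with proj₁ (col (forestS ts (suc i)) y) | parent-forest ts i (suc i) y
    ... | true  | e = 0 , trans e (cong just (sym (+-identityʳ i))) , s≤s z≤n
    ... | false | k , e , lt = suc k , trans e (cong just (sym (+-suc i k))) , s≤s lt

    parent-forest : ∀ ts p j y → Parent (just p) j (car (forestS ts j)) (proj₁ (col (forestS ts j) y)) (proj₂ (entry (flatL ts p j) (toℕ y)))
    parent-forest (t ∷ ts) p j = ↑-elim (car A) _
      (λ x → subst₂ (λ b e → Parent (just p) j (car A + car B) b (proj₂ e)) (sym (cong proj₁ (col-l disj A B x))) (sym (entry-head t ts p j x))
        (Parent-widen (proj₁ (col A x)) (ℕ.m≤m+n (car A) (car B)) (parent-tree t (just p) j x)))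
      (λ y → subst₂ (λ b e → Parent (just p) j (car A + car B) b (proj₂ e)) (sym (cong proj₁ (col-u disj A B y))) (sym (entry-tail t ts p j y))
        (Parent-shift (car A) (proj₁ (col B y)) (parent-forest ts p (j + car A) y)))
      where
      A = treeS t j
      B = forestS ts (j + car A)

  ≡ᵇ-false : ∀ {x y} → ¬ x ≡ y → (x ≡ᵇ y) ≡ false
  ≡ᵇ-false {x} {y} ne with x ≡ᵇ y in e
  ... | false = refl
  ... | true  = ⊥-elim (ne (ℕ.≡ᵇ⇒≡ x y (subst Data.Bool.T (sym e) _)))

  ≡ᵇ-true : ∀ x → (x ≡ᵇ x) ≡ true
  ≡ᵇ-true zero    = refl
  ≡ᵇ-true (suc x) = ≡ᵇ-true x

  Before : Maybe ℕ → ℕ → Set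
  Before p i = ∀ {q} → p ≡ just q → q < i

  not-before : ∀ p {i} k → Before p i → isParent (i + k) p ≡ false
  not-before nothing  k b = refl
  not-before (just q) {i} k b = ≡ᵇ-false λ e → ℕ.<-irrefl (sym e) (ℕ.<-≤-trans (b refl) (ℕ.m≤m+n i k))

  mutual
    -- Sibling subtrees occupy disjoint intervals of numbers. By `Parent`, the recorded parent of a
    -- node lies in the interval of its own subtree or is `p`, which precedes it; so no edge joins
    -- two sibling subtrees.
    edge-tree : ∀ t p i → Before p i → ∀ x y →
                lnk (treeS t i) zero x y ≡ isParent (i + toℕ x) (proj₂ (entry (flat t p i) (toℕ y)))
    edge-tree (node l ts) p i b zero    zero    = sym (not-before p 0 b)
    edge-tree (node l ts) p i b zero    (suc y) with proj₁ (col (forestS ts (suc i)) y) | parent-forest ts i (suc i) y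
    ... | true  | e = sym (trans (cong (isParent (i + 0)) e) (trans (cong (_≡ᵇ i) (+-identityʳ i)) (≡ᵇ-true i)))
    ... | false | k , e , lt = sym (trans (cong (isParent (i + 0)) e)
      (≡ᵇ-false λ q → ℕ.<-irrefl q (s≤s (ℕ.≤-trans (ℕ.≤-reflexive (+-identityʳ i)) (ℕ.m≤m+n i k)))))
    edge-tree (node l ts) p i b (suc x) zero    = sym (not-before p (suc (toℕ x)) b)
    edge-tree (node l ts) p i b (suc x) (suc y) = trans (edge-forest ts i (suc i) ℕ.≤-refl x y)
      (cong (λ z → isParent z (proj₂ (entry (flatL ts i (suc i)) (toℕ y)))) (sym (+-suc i (toℕ x))))

    edge-forest : ∀ ts p j → p < j → ∀ x y →
                  lnk (forestS ts j) zero x y ≡ isParent (j + toℕ x) (proj₂ (entry (flatL ts p j) (toℕ y)))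
    edge-forest (t ∷ ts) p j p<j = ↑-elim (car A) _
      (λ x → ↑-elim (car A) _
        (λ y → trans (lnk-ll disj A B zero x y) (trans (edge-tree t (just p) j (λ { refl → p<j }) x y)
          (cong₂ (λ k e → isParent (j + k) (proj₂ e)) (sym (toℕ-↑ˡ x (car B))) (sym (entry-head t ts p j y)))))
        (λ y → trans (lnk-lu disj A B zero x y) (sym (trans
          (cong₂ (λ k e → isParent (j + k) (proj₂ e)) (toℕ-↑ˡ x (car B)) (entry-tail t ts p j y)) (left-right x y)))))
      (λ x → ↑-elim (car A) _
        (λ y → trans (lnk-ul disj A B zero x y) (sym (trans
          (cong₂ (λ k e → isParent k (proj₂ e)) (offset-tail t ts p j x) (entry-head t ts p j y)) (right-left x y))))
        (λ y → trans (lnk-uu disj A B zero x y) (trans (edge-forest ts p j′ (ℕ.<-≤-trans p<j (ℕ.m≤m+n j (car A))) x y)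
          (cong₂ (λ k e → isParent k (proj₂ e)) (sym (offset-tail t ts p j x)) (sym (entry-tail t ts p j y))))))
      where
      A = treeS t j
      j′ = j + car A
      B = forestS ts j′
      left-right : ∀ x y → isParent (j + toℕ x) (proj₂ (entry (flatL ts p j′) (toℕ y))) ≡ false
      left-right x y with proj₁ (col B y) | parent-forest ts p j′ y
      ... | true  | e = trans (cong (isParent (j + toℕ x)) e) (not-before (just p) (toℕ x) λ { refl → p<j })
      ... | false | k , e , lt = trans (cong (isParent (j + toℕ x)) e)
        (≡ᵇ-false λ q → ℕ.<-irrefl q (ℕ.<-≤-trans (ℕ.+-monoʳ-< j (toℕ<n x)) (ℕ.m≤m+n j′ k)))
      right-left : ∀ x y → isParent (j′ + toℕ x) (proj₂ (entry (flat t (just p) j) (toℕ y))) ≡ false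
      right-left x y with proj₁ (col A y) | parent-tree t (just p) j y
      ... | true  | e = trans (cong (isParent (j′ + toℕ x)) e)
        (not-before (just p) (toℕ x) λ { refl → ℕ.<-≤-trans p<j (ℕ.m≤m+n j (car A)) })
      ... | false | k , e , lt = trans (cong (isParent (j′ + toℕ x)) e)
        (≡ᵇ-false λ q → ℕ.<-irrefl (sym q) (ℕ.<-≤-trans (ℕ.+-monoʳ-< j lt) (ℕ.m≤m+n j′ (toℕ x))))

  module _ (t : Tree L) where

    size≡ : length (nodes t) ≡ car (treeS t 0)
    size≡ = length-flat t nothing 0

    position : Fin (length (nodes t)) → Fin (car (treeS t 0))
    position = subst Fin size≡

    toℕ-position : ∀ x → toℕ (position x) ≡ toℕ x
    toℕ-position x = go size≡ x
      where
      go : ∀ {m n} (e : m ≡ n) (x : Fin m) → toℕ (subst Fin e x) ≡ toℕ x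
      go refl x = refl

    -- The same structure on the carrier of `treeStr t`, so that formulas and types speak about the
    -- same elements.
    nodeS : Str 1 (bit c)
    nodeS = record
      { car = length (nodes t) ; dom = λ _ → true
      ; col = col (treeS t 0) ∘ position ; lnk = λ R x y → lnk (treeS t 0) R (position x) (position y) }

    nodeS-emb : Emb nodeS (treeS t 0)
    nodeS-emb = record
      { fun = position ; inj = subst-injective size≡ ; dom-f = λ x → Full-tree t 0 (position x)
      ; cover = λ y _ → subst Fin (sym size≡) y , subst-subst-sym size≡
      ; col-f = λ _ _ → refl ; lnk-f = λ _ _ _ _ _ → refl }

    nodeS-colour : ∀ x → proj₂ (col nodeS x) ≡ χ (proj₁ (List.lookup (nodes t) x)) (toℕ x)
    nodeS-colour x = trans (colour-tree t nothing 0 (position x)) (cong₂ (λ e k → χ (proj₁ e) k)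
      (trans (cong (entry (nodes t)) (toℕ-position x)) (entry-lookup (nodes t) x)) (toℕ-position x))

    nodeS-edge : ∀ x y → lnk nodeS zero x y ≡ treeRel t zero (x ∷ y ∷ [])
    nodeS-edge x y = trans (edge-tree t nothing 0 (λ ()) (position x) (position y)) (cong₂ (λ k e → isParent k (proj₂ e))
      (toℕ-position x) (trans (cong (entry (nodes t)) (toℕ-position y)) (entry-lookup (nodes t) y)))

  module _ (M : ℕ) .{{_ : NonZero M}} (n : ℕ) where
    open Types 1 M
    open Composition 1 M
    open Monoid 1 M
    open Representatives M n c

    mutual
      TreeType-tree : ∀ h t i → height t ≤ h → TreeType h (tp n (treeS t i))
      TreeType-tree zero    (node l [])       i le = χ l i , tp-glue n rootGlue (point (χ l i)) ∅
      TreeType-tree zero    (node l (t ∷ ts)) i le with () ← ℕ.≤-trans (ℕ.m≤m⊔n (suc (height t)) (heightL ts)) le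
      TreeType-tree (suc h) (node l ts)       i le with TreeType-forest h ts (suc i) le
      ... | τs , all , e = χ l i , τs , all , trans (tp-glue n rootGlue (point (χ l i)) (forestS ts (suc i))) (cong (nodeType (χ l i)) e)

      TreeType-forest : ∀ h ts j → heightL ts ≤ suc h → ∃ λ τs → All (TreeType h) τs × tp n (forestS ts j) ≡ ⨁ τs
      TreeType-forest h []       j le = [] , [] , refl
      TreeType-forest h (t ∷ ts) j le
        with TreeType-forest h ts (j + car (treeS t j)) (ℕ.≤-trans (ℕ.m≤n⊔m (suc (height t)) (heightL ts)) le)
      ... | τs , all , e = tp n (treeS t j) ∷ τs
        , TreeType-tree h t j (s≤s⁻¹ (ℕ.≤-trans (ℕ.m≤m⊔n (suc (height t)) (heightL ts)) le)) ∷ all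
        , trans (tp-glue n disj (treeS t j) (forestS ts (j + car (treeS t j)))) (cong (tp n (treeS t j) ⊕_) e)

-- Formulas and types

T⇒≡ : ∀ {b} → Data.Bool.T b → b ≡ true
T⇒≡ {true} _ = refl

≡⇒T : ∀ {b} → b ≡ true → Data.Bool.T b
≡⇒T refl = _

≡ᵇ-sound : ∀ {m n} → (m ≡ᵇ n) ≡ true → m ≡ n
≡ᵇ-sound {m} {n} e = ≡ᵇ⇒≡ m n (≡⇒T e)

≡ᵇ-complete : ∀ {m n} → m ≡ n → (m ≡ᵇ n) ≡ true
≡ᵇ-complete {m} {n} e = T⇒≡ (≡⇒≡ᵇ m n e)

card-singleton : ∀ {n} (a : Fin n) → card (a ≡ᶠ_) ≡ 1
card-singleton {suc n} zero    = trans (card-suc {n} (λ x → zero ≡ᶠ x)) (cong suc (card-∅ n))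
card-singleton {suc n} (suc a) = trans (card-suc {n} (λ x → suc a ≡ᶠ x)) (trans (card-cong (suc-≡ᶠ a)) (card-singleton a))

card-0 : ∀ {n} (X : Fin n → Bool) → card X ≡ 0 → ∀ x → X x ≡ false
card-0 {suc n} X e x with X zero in e₀
card-0 {suc n} X () x | true
card-0 {suc n} X e zero    | false = e₀
card-0 {suc n} X e (suc x) | false = card-0 (X ∘ suc) e x

card-1 : ∀ {n} (X : Fin n → Bool) → card X ≡ 1 → ∃ λ a → ∀ x → X x ≡ (a ≡ᶠ x)
card-1 {suc n} X e with X zero in e₀
... | true = zero , λ { zero → e₀ ; (suc x) → card-0 (X ∘ suc) (ℕ.suc-injective e) x }
... | false with card-1 (X ∘ suc) e
... | a , q = suc a , λ { zero → e₀ ; (suc x) → trans (q x) (sym (suc-≡ᶠ a x)) }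

-- Monadic formulas over colour palettes: variables are replaced by the colour
-- predicates they stand for, and ex adds one bit to the palette.
data F (r : ℕ) (p : Pal) : Set where
  rel′       : Fin r → (El p → Bool) → (El p → Bool) → F r p
  some one   : (El p → Bool) → F r p
  mod′       : (a b : ℕ) → .{{_ : NonZero b}} → (El p → Bool) → F r p
  ¬′_        : F r p → F r p
  _∧′_       : F r p → F r p → F r p
  ex         : F r (bit p) → F r p

module Evaluation (r M : ℕ) .{{_ : NonZero M}} where
  open Types r M

  weight : ∀ {p} → Obs p → (El p → Bool) → ℕ
  weight {p} o P = capᵗ (sumOver {p} P (cntOf o))

  evalT : ∀ {n p} → F r p → Type n p → Bool
  evalT (rel′ R P Q)   τ = any² λ κ μ → (P κ ∧ Q μ) ∧ lnkOf (obOf τ) R κ μ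
  evalT (some P)       τ = not (weight (obOf τ) P ≡ᵇ 0)
  evalT (one P)        τ = weight (obOf τ) P ≡ᵇ 1
  evalT (mod′ a b P)   τ = weight (obOf τ) P % b ≡ᵇ a % b
  evalT (¬′ φ)         τ = not (evalT φ τ)
  evalT (φ ∧′ ψ)       τ = evalT φ τ ∧ evalT ψ τ
  -- A dummy value: `Within` rules out more nested quantifiers than rounds.
  evalT {zero}  (ex φ) τ = false
  evalT {suc n} (ex φ) τ = anyᵀ λ σ → (σ ∈ᵀ τ) ∧ evalT φ σ

  module _ {p : Pal} (n : ℕ) (A : Str r p) where

    weight-tp : ∀ P → weight (obOf (tp n A)) P ≡ capᵗ (card λ x → dom A x ∧ P (col A x))
    weight-tp P = trans (cong (λ o → weight o P) (obOf-tp n A)) (cong toℕ (trans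
      (cap-sumOver {p} P (λ κ → trans (cong cap (cntOf-mkOb (λ κ → card (at A κ)) (linked A) κ)) (cap-capᵗ (card (at A κ)))))
      (cong cap (sym (card-fibres (dom A) (col A) P)))))

    evalT-some : ∀ P → evalT (some P) (tp n A) ≡ anyᶠ (λ x → dom A x ∧ P (col A x))
    evalT-some P = trans (cong (λ z → not (z ≡ᵇ 0)) (weight-tp P)) (trans (cong not (capᵗ-0 (card λ x → dom A x ∧ P (col A x)))) (card-pos λ x → dom A x ∧ P (col A x)))

    evalT-one : ∀ P → evalT (one P) (tp n A) ≡ (card (λ x → dom A x ∧ P (col A x)) ≡ᵇ 1)
    evalT-one P = trans (cong (_≡ᵇ 1) (weight-tp P)) (capᵗ-1 (card λ x → dom A x ∧ P (col A x)))

    evalT-mod : ∀ a b .{{_ : NonZero b}} → b ∣ M → ∀ P →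
                evalT (mod′ a b P) (tp n A) ≡ (card (λ x → dom A x ∧ P (col A x)) % b ≡ᵇ a % b)
    evalT-mod a b d P = trans (cong (λ z → z % b ≡ᵇ a % b) (weight-tp P)) (cong (_≡ᵇ a % b) (capᵗ-% b d (card λ x → dom A x ∧ P (col A x))))

    evalT-rel-elim : ∀ R P Q → evalT (rel′ R P Q) (tp n A) ≡ true → ∃ λ x → ∃ λ y →
                     dom A x ≡ true × dom A y ≡ true × P (col A x) ≡ true × Q (col A y) ≡ true × lnk A R x y ≡ true
    evalT-rel-elim R P Q e with any²-elim {p} {p} (λ κ μ → (P κ ∧ Q μ) ∧ lnkOf (obOf (tp n A)) R κ μ) e
    ... | κ , μ , e₁ with ∧-elim {P κ ∧ Q μ} e₁
    ... | e₂ , l with ∧-elim {P κ} e₂ | linked-elim A R (trans (sym (trans (cong (λ o → lnkOf o R κ μ) (obOf-tp n A))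
                                         (lnkOf-mkOb (λ κ → card (at A κ)) (linked A) R κ μ))) l)
    ... | a , b | x , y , dx , dy , refl , refl , l′ = x , y , dx , dy , a , b , l′

    evalT-rel-intro : ∀ R P Q x y → dom A x ≡ true → dom A y ≡ true → P (col A x) ≡ true → Q (col A y) ≡ true →
                      lnk A R x y ≡ true → evalT (rel′ R P Q) (tp n A) ≡ true
    evalT-rel-intro R P Q x y dx dy a b l =
      any²-intro {p} {p} (λ κ μ → (P κ ∧ Q μ) ∧ lnkOf (obOf (tp n A)) R κ μ) (col A x) (col A y)
        (∧-intro (∧-intro a b) (trans (trans (cong (λ o → lnkOf o R (col A x) (col A y)) (obOf-tp n A))
          (lnkOf-mkOb (λ κ → card (at A κ)) (linked A) R (col A x) (col A y))) (linked-intro A R x y dx dy refl refl l)))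

    evalT-ex-elim : ∀ φ → evalT (ex φ) (tp (suc n) A) ≡ true → ∃ λ X → evalT φ (tp n (A ▹ X)) ≡ true
    evalT-ex-elim φ e with anyᵀ-elim (λ σ → (σ ∈ᵀ tp (suc n) A) ∧ evalT φ σ) e
    ... | σ , e₁ with ∧-elim {σ ∈ᵀ tp (suc n) A} e₁
    ... | m , e₂ with ∈-tp-elim n A σ m
    ... | X , refl = X , e₂

    evalT-ex-intro : ∀ φ X → evalT φ (tp n (A ▹ X)) ≡ true → evalT (ex φ) (tp (suc n) A) ≡ true
    evalT-ex-intro φ X e = anyᵀ-intro (λ σ → (σ ∈ᵀ tp (suc n) A) ∧ evalT φ σ) (tp n (A ▹ X)) (∧-intro (∈-tp-intro n A X) e)

-- What `n`-round types with counts modulo `M` are able to evaluate: quantifier depth at most `n`,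
-- moduli dividing `M`, relation symbols satisfying `Q`.
Within : ∀ {V m k} → (Fin (nrel V) → Set) → ℕ → ℕ → Form V m k → Set
Within Q M n       (atom R _)   = Q R
Within Q M n       (eq _ _)     = ⊤
Within Q M n       (mem _ _)    = ⊤
Within Q M n       (modp _ b _) = b ∣ M
Within Q M n       (neg φ)      = Within Q M n φ
Within Q M n       (and φ ψ)    = Within Q M n φ × Within Q M n ψ
Within Q M zero    (ex1 φ)      = ⊥
Within Q M (suc n) (ex1 φ)      = Within Q M n φ
Within Q M zero    (ex2 φ)      = ⊥
Within Q M (suc n) (ex2 φ)      = Within Q M n φ

up : ∀ {p} → (El p → Bool) → El (bit p) → Bool
up P (_ , κ) = P κ

new : ∀ {p} → El (bit p) → Bool
new (b , _) = b

module Translation {V : Voc} (r : ℕ) (p₀ : Pal)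
  (atm : ∀ {p} → (El p → El p₀) → (R : Fin (nrel V)) → Vec (El p → Bool) (ar V R) → F r p) where

  -- `π` strips the bits added for variables, because an atom about labels has to read the original
  -- colour of a node.
  tr : ∀ {m k p} → (El p → El p₀) → (Fin m → El p → Bool) → (Fin k → El p → Bool) → Form V m k → F r p
  tr π ρ σ (atom R xs)   = atm π R (Vec.map ρ xs)
  tr π ρ σ (eq x y)      = some λ κ → ρ x κ ∧ ρ y κ
  tr π ρ σ (mem x X)     = some λ κ → ρ x κ ∧ σ X κ
  tr π ρ σ (modp a b X)  = mod′ a b (σ X)
  tr π ρ σ (neg φ)       = ¬′ tr π ρ σ φ
  tr π ρ σ (and φ ψ)     = tr π ρ σ φ ∧′ tr π ρ σ ψ
  tr π ρ σ (ex1 φ)       = ex (one new ∧′ tr (π ∘ proj₂) (ext new (up ∘ ρ)) (up ∘ σ) φ)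
  tr π ρ σ (ex2 φ)       = ex (tr (π ∘ proj₂) (up ∘ ρ) (ext new (up ∘ σ)) φ)

  module Correct (M : ℕ) .{{_ : NonZero M}} (A : Structure V) (col₀ : Fin (size A) → El p₀)
                 (lnk₀ : Fin r → Fin (size A) → Fin (size A) → Bool) (Q : Fin (nrel V) → Set) where
    open Types r M
    open Evaluation r M

    coloured : ∀ {p} → (Fin (size A) → El p) → Str r p
    coloured c = record { car = size A ; dom = λ _ → true ; col = c ; lnk = lnk₀ }

    Singles : ∀ {m p} → (Fin (size A) → El p) → (Fin m → El p → Bool) → (Fin m → Fin (size A)) → Set
    Singles c P a = ∀ i x → P i (c x) ≡ (a i ≡ᶠ x)

    AtomCorrect : Set
    AtomCorrect = ∀ R → Q R → ∀ n {p} (π : El p → El p₀) (c : Fin (size A) → El p) → (∀ x → π (c x) ≡ col₀ x) →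
      ∀ P xs → Singles c (lookup P) (lookup xs) → evalT (atm π R P) (tp n (coloured c)) ≡ rel A R xs

    record Env {m k p} (π : El p → El p₀) (P : Fin m → El p → Bool) (S : Fin k → El p → Bool)
               (c : Fin (size A) → El p) (a : Fin m → Fin (size A)) (X : Fin k → Fin (size A) → Bool) : Set where
      field
        base≡   : ∀ x → π (c x) ≡ col₀ x
        singles : Singles c P a
        sets    : ∀ j x → S j (c x) ≡ X j x
    open Env

    ext₁ : ∀ {m k p} {π : El p → El p₀} {P : Fin m → El p → Bool} {S : Fin k → El p → Bool} {c a X} →
           Env π P S c a X → ∀ b (Y : Fin (size A) → Bool) → (∀ x → Y x ≡ (b ≡ᶠ x)) →
           Env {suc m} {k} {bit p} (π ∘ proj₂) (ext new (up ∘ P)) (up ∘ S) (λ x → Y x , c x) (ext b a) X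
    ext₁ v b Y e = record { base≡ = base≡ v ; singles = λ { zero x → e x ; (suc i) x → singles v i x } ; sets = sets v }

    ext₂ : ∀ {m k p} {π : El p → El p₀} {P : Fin m → El p → Bool} {S : Fin k → El p → Bool} {c a X} →
           Env π P S c a X → ∀ (Y : Fin (size A) → Bool) →
           Env {m} {suc k} {bit p} (π ∘ proj₂) (up ∘ P) (ext new (up ∘ S)) (λ x → Y x , c x) a (ext Y X)
    ext₂ v Y = record { base≡ = base≡ v ; singles = singles v ; sets = λ { zero x → refl ; (suc j) x → sets v j x } }

    singles-map : ∀ {l m k p} {π : El p → El p₀} {P : Fin m → El p → Bool} {S : Fin k → El p → Bool} {c a X} (xs : Vec (Fin m) l) →
                  Env π P S c a X → Singles c (lookup (Vec.map P xs)) (lookup (Vec.map a xs))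
    singles-map {P = P} {c = c} {a} xs v i x = trans (cong (λ f → f (c x)) (lookup-map i P xs))
      (trans (singles v (lookup xs i) x) (cong (_≡ᶠ x) (sym (lookup-map i a xs))))

    module _ (atomCorrect : AtomCorrect) where

      -- Proved jointly with the converse, since negation exchanges the two directions.
      eval⇒Sat : ∀ n {m k p} (φ : Form V m k) → Within Q M n φ →
        ∀ {π : El p → El p₀} {P : Fin m → El p → Bool} {S : Fin k → El p → Bool} {c a X} → Env π P S c a X →
        evalT (tr π P S φ) (tp n (coloured c)) ≡ true → SatIn A full a X φ
      Sat⇒eval : ∀ n {m k p} (φ : Form V m k) → Within Q M n φ →
        ∀ {π : El p → El p₀} {P : Fin m → El p → Bool} {S : Fin k → El p → Bool} {c a X} → Env π P S c a X →
        SatIn A full a X φ → evalT (tr π P S φ) (tp n (coloured c)) ≡ true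

      eval⇒Sat n (atom R xs) w {π} {P} {c = c} {a} v t =
        trans (sym (atomCorrect R w n π c (base≡ v) (Vec.map P xs) (Vec.map a xs) (singles-map xs v))) t
      eval⇒Sat n (eq x y) w {π} {P} {c = c} {a} v t
        with anyᶠ-elim (λ z → P x (c z) ∧ P y (c z)) (trans (sym (evalT-some n (coloured c) (λ κ → P x κ ∧ P y κ))) t)
      ... | z , t₁ with ∧-elim {P x (c z)} t₁
      ... | q , q′ = trans (≡ᶠ-sound (trans (sym (singles v x z)) q)) (sym (≡ᶠ-sound (trans (sym (singles v y z)) q′)))
      eval⇒Sat n (mem x X) w {π} {P} {S} {c} {a} {Y} v t
        with anyᶠ-elim (λ z → P x (c z) ∧ S X (c z)) (trans (sym (evalT-some n (coloured c) (λ κ → P x κ ∧ S X κ))) t)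
      ... | z , t₁ with ∧-elim {P x (c z)} t₁
      ... | q , q′ = trans (cong (Y X) (≡ᶠ-sound (trans (sym (singles v x z)) q))) (trans (sym (sets v X z)) q′)
      eval⇒Sat n (modp a b X) w {S = S} {c} v t = trans (cong (_% b) (card-cong λ x → sym (sets v X x)))
        (≡ᵇ-sound (trans (sym (evalT-mod n (coloured c) a b w (S X))) t))
      eval⇒Sat n (neg φ) w v t q with () ← trans (sym t) (cong not (Sat⇒eval n φ w v q))
      eval⇒Sat n (and φ ψ) (w , w′) v t = let t₁ , t₂ = ∧-elim t in eval⇒Sat n φ w v t₁ , eval⇒Sat n ψ w′ v t₂
      eval⇒Sat (suc n) (ex1 φ) w {π} {P} {S} {c} v t
        with evalT-ex-elim n (coloured c) (one new ∧′ tr (π ∘ proj₂) (ext new (up ∘ P)) (up ∘ S) φ) t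
      ... | Y , t₁ with ∧-elim {evalT (one new) (tp n (coloured c ▹ Y))} t₁
      ... | t₂ , t₃ with card-1 Y (≡ᵇ-sound (trans (sym (evalT-one n (coloured c ▹ Y) new)) t₂))
      ... | b , q = b , refl , eval⇒Sat n φ w (ext₁ v b Y q) t₃
      eval⇒Sat (suc n) (ex2 φ) w {π} {P} {S} {c} v t
        with evalT-ex-elim n (coloured c) (tr (π ∘ proj₂) (up ∘ P) (ext new (up ∘ S)) φ) t
      ... | Y , t₁ = Y , (λ _ _ → refl) , eval⇒Sat n φ w (ext₂ v Y) t₁

      Sat⇒eval n (atom R xs) w {π} {P} {c = c} {a} v t =
        trans (atomCorrect R w n π c (base≡ v) (Vec.map P xs) (Vec.map a xs) (singles-map xs v)) t
      Sat⇒eval n (eq x y) w {π} {P} {c = c} {a} v t = trans (evalT-some n (coloured c) (λ κ → P x κ ∧ P y κ))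
        (anyᶠ-intro (λ z → P x (c z) ∧ P y (c z)) (a x) (∧-intro (trans (singles v x (a x)) (≡ᶠ-refl (a x)))
          (trans (singles v y (a x)) (trans (cong (_≡ᶠ a x) (sym t)) (≡ᶠ-refl (a x))))))
      Sat⇒eval n (mem x X) w {π} {P} {S} {c} {a} v t = trans (evalT-some n (coloured c) (λ κ → P x κ ∧ S X κ))
        (anyᶠ-intro (λ z → P x (c z) ∧ S X (c z)) (a x) (∧-intro (trans (singles v x (a x)) (≡ᶠ-refl (a x))) (trans (sets v X (a x)) t)))
      Sat⇒eval n (modp a b X) w {S = S} {c} v t = trans (evalT-mod n (coloured c) a b w (S X))
        (≡ᵇ-complete (trans (cong (_% b) (card-cong λ x → sets v X x)) t))
      Sat⇒eval n (neg φ) w {π} {P} {S} {c} v t with evalT (tr π P S φ) (tp n (coloured c)) in q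
      ... | false = refl
      ... | true  = ⊥-elim (t (eval⇒Sat n φ w v q))
      Sat⇒eval n (and φ ψ) (w , w′) v (t₁ , t₂) = ∧-intro (Sat⇒eval n φ w v t₁) (Sat⇒eval n ψ w′ v t₂)
      Sat⇒eval (suc n) (ex1 φ) w {π} {P} {S} {c} v (b , _ , t) =
        evalT-ex-intro n (coloured c) (one new ∧′ tr (π ∘ proj₂) (ext new (up ∘ P)) (up ∘ S) φ) (λ x → b ≡ᶠ x)
          (∧-intro (trans (evalT-one n (coloured c ▹ λ x → b ≡ᶠ x) new) (≡ᵇ-complete (card-singleton b)))
            (Sat⇒eval n φ w (ext₁ v b (λ x → b ≡ᶠ x) (λ _ → refl)) t))
      Sat⇒eval (suc n) (ex2 φ) w {π} {P} {S} {c} v (Y , _ , t) =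
        evalT-ex-intro n (coloured c) (tr (π ∘ proj₂) (up ∘ P) (ext new (up ∘ S)) φ) Y (Sat⇒eval n φ w (ext₂ v Y) t)

-- Translations

module _ {V : Voc} (A : Structure V) (U : Fin (size A) → Bool) where

  ren⇒Sat : ∀ {m m′ k k′} (φ : Form V m k) {f : Fin m → Fin m′} {g : Fin k → Fin k′} {ρ σ ρ′ σ′} →
            (∀ i → ρ (f i) ≡ ρ′ i) → (∀ j x → σ (g j) x ≡ σ′ j x) → SatIn A U ρ σ (ren f g φ) → SatIn A U ρ′ σ′ φ
  Sat⇒ren : ∀ {m m′ k k′} (φ : Form V m k) {f : Fin m → Fin m′} {g : Fin k → Fin k′} {ρ σ ρ′ σ′} →
            (∀ i → ρ (f i) ≡ ρ′ i) → (∀ j x → σ (g j) x ≡ σ′ j x) → SatIn A U ρ′ σ′ φ → SatIn A U ρ σ (ren f g φ)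

  private
    map≡ : ∀ {m m′ l} {f : Fin m → Fin m′} {ρ : Fin m′ → Fin (size A)} {ρ′} → (∀ i → ρ (f i) ≡ ρ′ i) → (xs : Vec (Fin m) l) →
           Vec.map ρ (Vec.map f xs) ≡ Vec.map ρ′ xs
    map≡ e xs = trans (sym (map-∘ _ _ xs)) (map-cong e xs)

    lift₁ : ∀ {m m′} {f : Fin m → Fin m′} {ρ : Fin m′ → Fin (size A)} {ρ′} → (∀ i → ρ (f i) ≡ ρ′ i) → ∀ a →
            ∀ i → ext a ρ (liftR f i) ≡ ext a ρ′ i
    lift₁ e a zero    = refl
    lift₁ e a (suc i) = e i

    lift₂ : ∀ {k k′} {g : Fin k → Fin k′} {σ : Fin k′ → Fin (size A) → Bool} {σ′} → (∀ j x → σ (g j) x ≡ σ′ j x) → ∀ X →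
            ∀ j x → ext X σ (liftR g j) x ≡ ext X σ′ j x
    lift₂ e X zero    x = refl
    lift₂ e X (suc j) x = e j x

  ren⇒Sat (atom R xs)  e s t = trans (cong (rel A R) (sym (map≡ e xs))) t
  ren⇒Sat (eq x y)     e s t = trans (sym (e x)) (trans t (e y))
  ren⇒Sat (mem x X) {g = g} {σ = σ} e s t = trans (sym (s X _)) (trans (cong (σ (g X)) (sym (e x))) t)
  ren⇒Sat (modp a b X) e s t = trans (cong (_% b) (card-cong λ x → sym (s X x))) t
  ren⇒Sat (neg φ)      e s t q = t (Sat⇒ren φ e s q)
  ren⇒Sat (and φ ψ)    e s (t , t′) = ren⇒Sat φ e s t , ren⇒Sat ψ e s t′
  ren⇒Sat (ex1 φ)      e s (a , u , t) = a , u , ren⇒Sat φ (lift₁ e a) s t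
  ren⇒Sat (ex2 φ)      e s (X , u , t) = X , u , ren⇒Sat φ e (lift₂ s X) t

  Sat⇒ren (atom R xs)  e s t = trans (cong (rel A R) (map≡ e xs)) t
  Sat⇒ren (eq x y)     e s t = trans (e x) (trans t (sym (e y)))
  Sat⇒ren (mem x X) {g = g} {σ = σ} e s t = trans (cong (σ (g X)) (e x)) (trans (s X _) t)
  Sat⇒ren (modp a b X) e s t = trans (cong (_% b) (card-cong λ x → s X x)) t
  Sat⇒ren (neg φ)      e s t q = t (ren⇒Sat φ e s q)
  Sat⇒ren (and φ ψ)    e s (t , t′) = Sat⇒ren φ e s t , Sat⇒ren ψ e s t′
  Sat⇒ren (ex1 φ)      e s (a , u , t) = a , u , Sat⇒ren φ (lift₁ e a) s t
  Sat⇒ren (ex2 φ)      e s (X , u , t) = X , u , Sat⇒ren φ e (lift₂ s X) t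

module _ {τ σ : Voc} (I : Interp τ σ) {A : Structure σ} {C : Structure τ} (i : IsInterpretedBy I A C) where

  private
    f      = proj₁ i
    f-inj  = proj₁ (proj₂ i)
    f-ν    = proj₁ (proj₂ (proj₂ i))
    f-onto = proj₁ (proj₂ (proj₂ (proj₂ i)))
    f-rels = proj₂ (proj₂ (proj₂ (proj₂ i)))

  -- `covered` keeps sets inside the interpreted domain. Otherwise their cardinalities in `A` and in
  -- `C` could differ, and with them the value of `modp`.
  record Related {m k} (ρ : Fin m → Fin (size A)) (ρ′ : Fin m → Fin (size C))
                 (X : Fin k → Fin (size A) → Bool) (X′ : Fin k → Fin (size C) → Bool) : Set where
    field
      elements : ∀ i → ρ i ≡ f (ρ′ i)
      sets     : ∀ j c → X j (f c) ≡ X′ j c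
      covered  : ∀ j a → X j a ≡ true → ∃ λ c → f c ≡ a
  open Related

  translate⇒Sat : ∀ {m k} (φ : Form τ m k) {ρ ρ′ X X′} → Related {m} {k} ρ ρ′ X X′ →
                  SatIn A full ρ X (translate I φ) → SatIn C full ρ′ X′ φ
  Sat⇒translate : ∀ {m k} (φ : Form τ m k) {ρ ρ′ X X′} → Related {m} {k} ρ ρ′ X X′ →
                  SatIn C full ρ′ X′ φ → SatIn A full ρ X (translate I φ)

  private
    ext₁ : ∀ {m k ρ ρ′ X X′} → Related {m} {k} ρ ρ′ X X′ → ∀ {a} c → f c ≡ a → Related (ext a ρ) (ext c ρ′) X X′
    ext₁ v c e = record { elements = λ { zero → sym e ; (suc i) → elements v i } ; sets = sets v ; covered = covered v }

    ext₂ : ∀ {m k ρ ρ′ X X′} → Related {m} {k} ρ ρ′ X X′ → ∀ {Y Y′} → (∀ c → Y (f c) ≡ Y′ c) →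
           (∀ a → Y a ≡ true → ∃ λ c → f c ≡ a) → Related ρ ρ′ (ext Y X) (ext Y′ X′)
    ext₂ v e co = record { elements = elements v ; sets = λ { zero → e ; (suc j) → sets v j }
                         ; covered = λ { zero → co ; (suc j) → covered v j } }

    args : ∀ {m k l ρ ρ′ X X′} → Related {m} {k} ρ ρ′ X X′ → (xs : Vec (Fin m) l) → ∀ i →
           ρ (lookup xs i) ≡ lookup (Vec.map f (Vec.map ρ′ xs)) i
    args {ρ′ = ρ′} v xs i = trans (elements v (lookup xs i))
      (sym (trans (lookup-map i f (Vec.map ρ′ xs)) (cong f (lookup-map i ρ′ xs))))

    inDomain : ∀ {m k} {ρ : Fin m → Fin (size A)} {X : Fin k → Fin (size A) → Bool} a →
               SatIn A full (ext a ρ) X (ren (λ _ → zero) fin0 (ν I)) → ∃ λ c → f c ≡ a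
    inDomain a t = f-onto a (ren⇒Sat A full (ν I) (λ _ → refl) (λ ()) t)

    domain : ∀ {m k} {ρ : Fin m → Fin (size A)} {X : Fin k → Fin (size A) → Bool} c →
             SatIn A full (ext (f c) ρ) X (ren (λ _ → zero) fin0 (ν I))
    domain c = Sat⇒ren A full (ν I) (λ _ → refl) (λ ()) (f-ν c)

  translate⇒Sat (atom R xs) {ρ} {ρ′} v t = Equivalence.from (f-rels R (Vec.map ρ′ xs))
    (ren⇒Sat A full (η I R) (args v xs) (λ ()) t)
  translate⇒Sat (eq x y) v t = f-inj (trans (sym (elements v x)) (trans t (elements v y)))
  translate⇒Sat (mem x X) {X = Y} v t = trans (sym (sets v X _)) (trans (cong (Y X) (sym (elements v x))) t)
  translate⇒Sat (modp a b X) {X = Y} v t = trans (cong (_% b)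
    (sym (trans (card-image f f-inj (Y X) (covered v X)) (card-cong (sets v X))))) t
  translate⇒Sat (neg φ) v t q = t (Sat⇒translate φ v q)
  translate⇒Sat (and φ ψ) v (t , t′) = translate⇒Sat φ v t , translate⇒Sat ψ v t′
  translate⇒Sat (ex1 φ) {ρ} {X = X} v (a , _ , d , t) with inDomain {ρ = ρ} {X} a d
  ... | c , e = c , refl , translate⇒Sat φ (ext₁ v c e) t
  translate⇒Sat (ex2 φ) {ρ} {X = X} v (Y , _ , sub , t) =
    Y ∘ f , (λ _ _ → refl) , translate⇒Sat φ (ext₂ v (λ _ → refl) co) t
    where
    co : ∀ a → Y a ≡ true → ∃ λ c → f c ≡ a
    -- The guard in the translation is a negated existential and gives no witness; the preimage is
    -- found by a decidable search.
    co a y with any? (λ c → f c ≟ a)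
    ... | yes p = p
    ... | no ¬p = ⊥-elim (sub (a , refl , y , λ d → ¬p (inDomain {ρ = ρ} {ext Y X} a d)))

  Sat⇒translate (atom R xs) {ρ} {ρ′} v t = Sat⇒ren A full (η I R) (args v xs) (λ ())
    (Equivalence.to (f-rels R (Vec.map ρ′ xs)) t)
  Sat⇒translate (eq x y) v t = trans (elements v x) (trans (cong f t) (sym (elements v y)))
  Sat⇒translate (mem x X) {X = Y} v t = trans (cong (Y X) (elements v x)) (trans (sets v X _) t)
  Sat⇒translate (modp a b X) {X = Y} v t = trans (cong (_% b)
    (trans (card-image f f-inj (Y X) (covered v X)) (card-cong (sets v X)))) t
  Sat⇒translate (neg φ) v t q = t (translate⇒Sat φ v q)
  Sat⇒translate (and φ ψ) v (t , t′) = Sat⇒translate φ v t , Sat⇒translate ψ v t′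
  Sat⇒translate (ex1 φ) {ρ} {X = X} v (c , _ , t) = f c , refl , domain {ρ = ρ} {X} c , Sat⇒translate φ (ext₁ v c refl) t
  Sat⇒translate (ex2 φ) {ρ} {X = X} v (Y′ , _ , t) =
    Y , (λ _ _ → refl)
    , (λ (a , _ , y , ¬d) → let c , e = co a y in
        ¬d (subst (λ z → SatIn A full (ext z ρ) (ext Y X) (ren (λ _ → zero) fin0 (ν I))) e (domain {ρ = ρ} {ext Y X} c)))
    , Sat⇒translate φ (ext₂ v same co) t
    where
    Y : Fin (size A) → Bool
    Y a = anyᶠ λ c → (f c ≡ᶠ a) ∧ Y′ c
    co : ∀ a → Y a ≡ true → ∃ λ c → f c ≡ a
    co a y = let c , q = anyᶠ-elim (λ c → (f c ≡ᶠ a) ∧ Y′ c) y in c , ≡ᶠ-sound (proj₁ (∧-elim q))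
    same : ∀ c → Y (f c) ≡ Y′ c
    same c = ⇔→≡
      (λ y → let c′ , q = anyᶠ-elim (λ c′ → (f c′ ≡ᶠ f c) ∧ Y′ c′) y ; a , b = ∧-elim {f c′ ≡ᶠ f c} q in
             subst (λ z → Y′ z ≡ true) (f-inj (≡ᶠ-sound a)) b)
      (λ y → anyᶠ-intro (λ c′ → (f c′ ≡ᶠ f c) ∧ Y′ c′) c (∧-intro (≡ᶠ-refl (f c)) y))

-- Depth, moduli and symbols of translated formulas

module _ {V : Voc} where

  Within-map : ∀ {Q Q′ : Fin (nrel V) → Set} {M n m k} → (∀ {R} → Q R → Q′ R) → (φ : Form V m k) → Within Q M n φ → Within Q′ M n φ
  Within-map h (atom R _)   w = h w
  Within-map h (eq _ _)     w = w
  Within-map h (mem _ _)    w = w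
  Within-map h (modp _ _ _) w = w
  Within-map h (neg φ)      w = Within-map h φ w
  Within-map h (and φ ψ)    (w , w′) = Within-map h φ w , Within-map h ψ w′
  Within-map {n = suc n} h (ex1 φ) w = Within-map h φ w
  Within-map {n = suc n} h (ex2 φ) w = Within-map h φ w

  Within-mono : ∀ {Q : Fin (nrel V) → Set} {M n n′ m k} → n ≤ n′ → (φ : Form V m k) → Within Q M n φ → Within Q M n′ φ
  Within-mono le (atom R _)   w = w
  Within-mono le (eq _ _)     w = w
  Within-mono le (mem _ _)    w = w
  Within-mono le (modp _ _ _) w = w
  Within-mono le (neg φ)      w = Within-mono le φ w
  Within-mono le (and φ ψ)    (w , w′) = Within-mono le φ w , Within-mono le ψ w′
  Within-mono (s≤s le) (ex1 φ) w = Within-mono le φ w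
  Within-mono (s≤s le) (ex2 φ) w = Within-mono le φ w

  Within-ren : ∀ {Q : Fin (nrel V) → Set} {M n m k m′ k′} {f : Fin m → Fin m′} {g : Fin k → Fin k′} (φ : Form V m k) →
               Within Q M n (ren f g φ) → Within Q M n φ
  Within-ren (atom R _)   w = w
  Within-ren (eq _ _)     w = w
  Within-ren (mem _ _)    w = w
  Within-ren (modp _ _ _) w = w
  Within-ren (neg φ)      w = Within-ren φ w
  Within-ren (and φ ψ)    (w , w′) = Within-ren φ w , Within-ren ψ w′
  Within-ren {n = suc n} (ex1 φ) w = Within-ren φ w
  Within-ren {n = suc n} (ex2 φ) w = Within-ren φ w

  -- The formula of `J` for a symbol absent from ψ leaves no trace in the translation and cannot be
  -- charged to its length. Such relations are masked below.
  mentions : ∀ {m k} → Form V m k → Fin (nrel V) → Bool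
  mentions (atom R _)   S = S ≡ᶠ R
  mentions (eq _ _)     S = false
  mentions (mem _ _)    S = false
  mentions (modp _ _ _) S = false
  mentions (neg φ)      S = mentions φ S
  mentions (and φ ψ)    S = mentions φ S ∨ mentions ψ S
  mentions (ex1 φ)      S = mentions φ S
  mentions (ex2 φ)      S = mentions φ S

module _ {τ σ : Voc} (J : Interp τ σ) {Q : Fin (nrel σ) → Set} {M : ℕ} where

  Within-η : ∀ {n m k} (φ : Form τ m k) → Within Q M n (translate J φ) → ∀ R → mentions φ R ≡ true → Within Q M n (η J R)
  Within-η (atom R xs) w S e with refl ← ≡ᶠ-sound {i = S} {R} e = Within-ren (η J S) w
  Within-η (neg φ)     w S e = Within-η φ w S e
  Within-η (and φ ψ) (w , w′) S e with ∨-elim {mentions φ S} e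
  ... | inj₁ e′ = Within-η φ w S e′
  ... | inj₂ e′ = Within-η ψ w′ S e′
  Within-η {suc n} (ex1 φ) (_ , w) S e = Within-mono (ℕ.n≤1+n n) (η J S) (Within-η φ w S e)
  Within-η {suc n} (ex2 φ) (_ , w) S e = Within-mono (ℕ.n≤1+n n) (η J S) (Within-η φ w S e)

  Within-translate : ∀ {n m k} (φ : Form τ m k) → Within Q M n (translate J φ) → Within (λ R → mentions φ R ≡ true) M n φ
  Within-translate (atom R xs)  w = ≡ᶠ-refl R
  Within-translate (eq _ _)     w = w
  Within-translate (mem _ _)    w = w
  Within-translate (modp _ _ _) w = w
  Within-translate (neg φ)      w = Within-translate φ w
  Within-translate (and φ ψ)    (w , w′) =
    Within-map (λ {R} → ∨-introˡ) φ (Within-translate φ w) , Within-map (λ {R} → ∨-introʳ {mentions φ R}) ψ (Within-translate ψ w′)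
  Within-translate {suc n} (ex1 φ) (_ , w) = Within-translate φ w
  Within-translate {suc n} (ex2 φ) (_ , w) = Within-translate φ w

-- A sentence over a vocabulary without constants contains a quantifier, so its translation contains ν.
Within-ν : ∀ {r σ} (J : Interp (BinVoc r) σ) {Q : Fin (nrel σ) → Set} {M n} (φ : Form (BinVoc r) 0 0) →
           Within Q M n (translate J φ) → Within Q M n (ν J)
Within-ν J (atom R (() ∷ _)) w
Within-ν J (neg φ)   w = Within-ν J φ w
Within-ν J (and φ ψ) (w , _) = Within-ν J φ w
Within-ν J {n = suc n} (ex1 φ) (w , _) = Within-mono (ℕ.n≤1+n n) (ν J) (Within-ren (ν J) w)
Within-ν J {n = suc (suc n)} (ex2 φ) ((_ , w) , _) = Within-mono (ℕ.≤-trans (ℕ.n≤1+n n) (ℕ.n≤1+n (suc n))) (ν J) (Within-ren (ν J) w)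

-- The trees for `J` may have any number of labels. Only those that occur in the formula, at most
-- `len` many, enter the colours.
labels : ∀ {L m k} → Form (TreeVoc L) m k → List (Fin L)
labels (atom zero _)    = []
labels (atom (suc i) _) = i ∷ []
labels (eq _ _)     = []
labels (mem _ _)    = []
labels (modp _ _ _) = []
labels (neg φ)      = labels φ
labels (and φ ψ)    = labels φ ++ labels ψ
labels (ex1 φ)      = labels φ
labels (ex2 φ)      = labels φ

length-labels : ∀ {L m k} (φ : Form (TreeVoc L) m k) → length (labels φ) ≤ len φ
length-labels (atom zero _)    = z≤n
length-labels (atom (suc i) _) = s≤s z≤n
length-labels (eq _ _)     = z≤n
length-labels (mem _ _)    = z≤n
length-labels (modp _ _ _) = z≤n
length-labels (neg φ)      = ℕ.m≤n⇒m≤1+n (length-labels φ)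
length-labels (and φ ψ)    = ℕ.m≤n⇒m≤1+n (ℕ.≤-trans (ℕ.≤-reflexive (length-++ (labels φ))) (ℕ.+-mono-≤ (length-labels φ) (length-labels ψ)))
length-labels (ex1 φ)      = ℕ.m≤n⇒m≤1+n (ℕ.m≤n⇒m≤1+n (length-labels φ))
length-labels (ex2 φ)      = ℕ.m≤n⇒m≤1+n (ℕ.m≤n⇒m≤1+n (length-labels φ))

UsesOnly : ∀ {L} → List (Fin L) → Fin (suc L) → Set
UsesOnly ls zero    = ⊤
UsesOnly ls (suc i) = i ∈ ls

-- The length serves as a crude bound on the quantifier depth.
within : ∀ {L m k} {ls M n} (φ : Form (TreeVoc L) m k) → (∀ {i} → i ∈ labels φ → i ∈ ls) → (∀ {b} → b ∈ moduli φ → b ∣ M) →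
         len φ ≤ n → Within (UsesOnly ls) M n φ
within (atom zero _)    l d le = tt
within (atom (suc i) _) l d le = l (here refl)
within (eq _ _)     l d le = tt
within (mem _ _)    l d le = tt
within (modp _ _ _) l d le = d (here refl)
within (neg φ)      l d le = within φ l d (ℕ.≤-trans (ℕ.n≤1+n _) le)
within (and φ ψ)    l d le =
  within φ (l ∘ ∈-++⁺ˡ) (d ∘ ∈-++⁺ˡ) (ℕ.≤-trans (ℕ.≤-trans (ℕ.m≤m+n (len φ) (len ψ)) (ℕ.n≤1+n _)) le) ,
  within ψ (l ∘ ∈-++⁺ʳ (labels φ)) (d ∘ ∈-++⁺ʳ (moduli φ)) (ℕ.≤-trans (ℕ.≤-trans (ℕ.m≤n+m (len ψ) (len φ)) (ℕ.n≤1+n _)) le)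
within (ex1 φ) l d (s≤s le) = within φ l d (ℕ.≤-trans (ℕ.n≤1+n _) le)
within (ex2 φ) l d (s≤s le) = within φ l d (ℕ.≤-trans (ℕ.n≤1+n _) le)

∣-lcm : ∀ bs {b} → b ∈ bs → b ∣ foldr lcm 1 bs
∣-lcm (b ∷ bs) (here refl) = m∣lcm[m,n] b (foldr lcm 1 bs)
∣-lcm (b ∷ bs) (there i)   = ∣-trans (∣-lcm bs i) (n∣lcm[m,n] b (foldr lcm 1 bs))

lcm≢0 : ∀ m n → ¬ m ≡ 0 → ¬ n ≡ 0 → ¬ lcm m n ≡ 0
lcm≢0 m n m≢0 n≢0 e with ℕ.m*n≡0⇒m≡0∨n≡0 m (0∣⇒≡0 (subst (_∣ m * n) e (lcm-least {m} {n} (m∣m*n n) (n∣m*n m))))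
... | inj₁ p = m≢0 p
... | inj₂ p = n≢0 p

modulus≢0 : ∀ {V m k} (φ : Form V m k) {b} → b ∈ moduli φ → ¬ b ≡ 0
modulus≢0 (modp a zero {{nz}} X) (here refl) _ = ⊥-elim-irr (NonZero.nonZero nz)
modulus≢0 (neg φ)   i = modulus≢0 φ i
modulus≢0 (and φ ψ) i with ∈-++⁻ (moduli φ) i
... | inj₁ j = modulus≢0 φ j
... | inj₂ j = modulus≢0 ψ j
modulus≢0 (ex1 φ)   i = modulus≢0 φ i
modulus≢0 (ex2 φ)   i = modulus≢0 φ i

lcmMod-nonZero : ∀ {V m k} (φ : Form V m k) → NonZero (lcmMod φ)
lcmMod-nonZero φ = ≢-nonZero (go (moduli φ) (modulus≢0 φ))
  where
  go : ∀ bs → (∀ {b} → b ∈ bs → ¬ b ≡ 0) → ¬ foldr lcm 1 bs ≡ 0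
  go []       h ()
  go (b ∷ bs) h = lcm≢0 b (foldr lcm 1 bs) (h (here refl)) (go bs (h ∘ there))

-- Structures induced on parts of a tree

≡ᶠ-injective : ∀ {m n} {f : Fin m → Fin n} → Injective _≡_ _≡_ f → ∀ x y → (f x ≡ᶠ f y) ≡ (x ≡ᶠ y)
≡ᶠ-injective {f = f} inj x y = ⇔→≡
  (λ e → subst (λ z → (x ≡ᶠ z) ≡ true) (inj (≡ᶠ-sound {i = f x} e)) (≡ᶠ-refl x))
  (λ e → subst (λ z → (f x ≡ᶠ f z) ≡ true) (≡ᶠ-sound {i = x} e) (≡ᶠ-refl (f x)))

≡ᶠ-false : ∀ {n} {i j : Fin n} → ¬ i ≡ j → (i ≡ᶠ j) ≡ false
≡ᶠ-false {i = i} {j} ne with i ≟ j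
... | yes e = ⊥-elim (ne e)
... | no _  = refl

↑-disjoint : ∀ {m n} (x : Fin m) (y : Fin n) → ¬ x ↑ˡ n ≡ m ↑ʳ y
↑-disjoint {m} {n} x y e with () ← trans (sym (splitAt-↑ˡ m x n)) (trans (cong (splitAt m) e) (splitAt-↑ʳ m n y))

enumerate : ∀ {n} (P : Fin n → Bool) → ∃ λ m → Σ (Fin m → Fin n) λ e →
            Injective _≡_ _≡_ e × (∀ i → P (e i) ≡ true) × (∀ x → P x ≡ true → ∃ λ i → e i ≡ x)
enumerate {zero} P = 0 , id , id , (λ ()) , λ ()
enumerate {suc n} P with P zero in p₀ | enumerate (P ∘ suc)
... | false | m , e , inj , s , c = m , suc ∘ e , inj ∘ suc-injective , s
    , λ { zero p → ⊥-elim (contra (trans (sym p₀) p)) ; (suc x) p → let i , q = c x p in i , cong suc q }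
  where
  contra : ¬ false ≡ true
  contra ()
... | true  | m , e , inj , s , c = suc m , e′
    , (λ { {zero} {zero} _ → refl ; {suc i} {suc j} q → cong suc (inj (suc-injective q)) })
    , (λ { zero → p₀ ; (suc i) → s i })
    , λ { zero p → zero , refl ; (suc x) p → let i , q = c x p in suc i , cong suc q }
  where
  e′ : Fin (suc m) → Fin _
  e′ zero    = zero
  e′ (suc i) = suc (e i)

module _ {r : ℕ} (𝒮 : Structure (BinVoc r) → Set) where

  -- Colours are ignored: the domain with its links has to be a member of `𝒮` up to isomorphism.
  record Realised {p} (A : Str r p) : Set where
    field
      C      : Structure (BinVoc r)
      C∈𝒮    : 𝒮 C
      place  : Fin (size C) → Fin (car A)
      inj′   : Injective _≡_ _≡_ place
      inside : ∀ x → dom A (place x) ≡ true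
      onto   : ∀ y → dom A y ≡ true → ∃ λ x → place x ≡ y
      rels   : ∀ R x y → rel C R (x ∷ y ∷ []) ≡ lnk A R (place x) (place y)

  -- Here heredity of `𝒮` enters: the elements of `C` placed in the image of `k` induce a
  -- substructure, and on them `k` is inverted by search.
  restrict : Hereditary 𝒮 → ∀ {p q} {A : Str r p} {B : Str r q} (k : Fin (car B) → Fin (car A)) → Injective _≡_ _≡_ k →
             (∀ x → dom A (k x) ≡ dom B x) →
             (∀ R x y → dom B x ≡ true → dom B y ≡ true → lnk A R (k x) (k y) ≡ lnk B R x y) → Realised A → Realised B
  restrict her {A = A} {B} k kinj kdom klnk real with enumerate (λ x → anyᶠ λ y → k y ≡ᶠ Realised.place real x)
  ... | m , e , einj , sound , complete = record
    { C = C′ ; C∈𝒮 = her C C′ C∈𝒮 (e , einj , λ _ _ → refl) ; place = place′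
    ; inj′ = λ {i} {j} q → einj (inj′ (trans (sym (place≡ i)) (trans (cong k q) (place≡ j))))
    ; inside = inside′
    ; onto = onto′
    ; rels = λ R i j → trans (rels R (e i) (e j)) (trans (sym (cong₂ (lnk A R) (place≡ i) (place≡ j))) (klnk R (place′ i) (place′ j) (inside′ i) (inside′ j))) }
    where
    open Realised real
    C′ : Structure (BinVoc r)
    C′ = record { size = m ; rel = λ R t → rel C R (Vec.map e t) }
    preimage : ∀ i → ∃ λ y → k y ≡ place (e i)
    preimage i = let y , q = anyᶠ-elim (λ y → k y ≡ᶠ place (e i)) (sound i) in y , ≡ᶠ-sound q
    place′ : Fin m → Fin (car B)
    place′ i = proj₁ (preimage i)
    place≡ : ∀ i → k (place′ i) ≡ place (e i)
    place≡ i = proj₂ (preimage i)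
    inside′ : ∀ i → dom B (place′ i) ≡ true
    inside′ i = trans (sym (kdom (place′ i))) (trans (cong (dom A) (place≡ i)) (inside (e i)))
    onto′ : ∀ y → dom B y ≡ true → ∃ λ i → place′ i ≡ y
    onto′ y d with onto (k y) (trans (kdom y) d)
    ... | x , q with complete x (anyᶠ-intro (λ y → k y ≡ᶠ place x) y (trans (cong (_≡ᶠ place x) (sym q)) (≡ᶠ-refl (place x))))
    ... | i , refl = i , kinj (trans (place≡ i) q)

  realised-emb : ∀ {p} {A B : Str r p} → Emb A B → Realised A → Realised B
  realised-emb {A = A} {B} f real = record
    { C = C ; C∈𝒮 = C∈𝒮 ; place = fun f ∘ place ; inj′ = λ e → inj′ (inj f e)
    ; inside = λ x → trans (dom-f f (place x)) (inside x)
    ; onto = λ y d → onto′ d (cover f y d)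
    ; rels = λ R x y → trans (rels R x y) (sym (lnk-f f R (place x) (place y) (inside x) (inside y))) }
    where
    open Realised real
    onto′ : ∀ {y} → dom B y ≡ true → (∃ λ x → fun f x ≡ y) → ∃ λ x → fun f (place x) ≡ y
    onto′ d (x , refl) = let z , e = onto x (trans (sym (dom-f f x)) d) in z , cong (fun f) e

masked : ∀ {r p} → (Fin r → Bool) → Str r p → Str r p
masked occ A = record { car = car A ; dom = dom A ; col = col A ; lnk = λ R x y → occ R ∧ lnk A R x y }

module _ {r p} {𝒮 : Structure (BinVoc r) → Set} (occ : Fin r → Bool) {A : Str r p} (real : Realised 𝒮 A) where
  open Realised real

  realiser : Str r p
  realiser = record { car = size C ; dom = λ _ → true ; col = col A ∘ place ; lnk = λ R x y → occ R ∧ rel C R (x ∷ y ∷ []) }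

  realiser-emb : Emb realiser (masked occ A)
  realiser-emb = record { fun = place ; inj = inj′ ; dom-f = inside ; cover = onto ; col-f = λ _ _ → refl
                        ; lnk-f = λ R x y _ _ → cong (occ R ∧_) (sym (rels R x y)) }

-- The structure interpreted in an outer tree, restricted to a part B of it: a context
-- tells which types of B with two marked elements the outer formulas accept.
module Induced (r M n : ℕ) .{{_ : NonZero M}} (p : Pal) where
  open Types 1 M
  open Composition 1 M

  Mark2 : Set
  Mark2 = Type n (bit (bit p))

  Context : Set
  Context = Fin (suc r) → Mark2 → Bool

  -- An element carries its type as first and as second argument. A link across two parts is decided
  -- by the first-argument type of its source and the second-argument type of its target.
  MarkPal : Pal
  MarkPal = TyPal n (bit (bit p)) ⊗ TyPal n (bit (bit p))

  only : ∀ {m} → Fin m → Fin m → Bool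
  only x z = x ≡ᶠ z

  none : ∀ {m} → Fin m → Bool
  none _ = false

  marked : (B : Str 1 p) → (Fin (car B) → Bool) → (Fin (car B) → Bool) → Mark2
  marked B X Y = tp n (B ▹ X ▹ Y)

  unmarked : Str 1 p → Mark2
  unmarked B = marked B none none

  induced : (Fin r → Bool) → Context → Str 1 p → Str r MarkPal
  induced occ c B = record
    { car = car B
    ; dom = λ x → dom B x ∧ c zero (marked B (only x) none)
    ; col = λ x → Type.elt (marked B (only x) none) , Type.elt (marked B none (only x))
    ; lnk = λ R x y → occ R ∧ c (suc R) (marked B (only x) (only y)) }

  marked-cong : ∀ (B : Str 1 p) {X X′ Y Y′ : Fin (car B) → Bool} → X ≗ X′ → Y ≗ Y′ → marked B X Y ≡ marked B X′ Y′
  marked-cong B {X} {X′} {Y} {Y′} e f = tp-emb n (▹-emb (▹-cong B e) {Y} {Y′} (λ x → sym (f x)))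

  marked-emb : ∀ {B B′ : Str 1 p} (f : Emb B B′) {X Y X′ Y′} → (∀ x → X′ (fun f x) ≡ X x) → (∀ x → Y′ (fun f x) ≡ Y x) →
               marked B X Y ≡ marked B′ X′ Y′
  marked-emb f {X} {Y} {X′} {Y′} e e′ = tp-emb n (▹-emb (▹-emb f {X} {X′} e) {Y} {Y′} e′)

  induced-emb : ∀ occ c {B B′} → Emb B B′ → Emb (induced occ c B) (induced occ c B′)
  induced-emb occ c {B} {B′} f = record
    { fun = fun f ; inj = inj f
    ; dom-f = λ x → cong₂ _∧_ (dom-f f x) (cong (c zero) (sym (mark₁ x)))
    ; cover = λ y e → cover f y (proj₁ (∧-elim e))
    ; col-f = λ x _ → cong₂ _,_ (cong Type.elt (sym (mark₁ x))) (cong Type.elt (sym (marked-emb f (λ _ → refl) (≡ᶠ-injective (inj f) x))))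
    ; lnk-f = λ R x y _ _ → cong (λ z → occ R ∧ c (suc R) z) (sym (marked-emb f (≡ᶠ-injective (inj f) x) (≡ᶠ-injective (inj f) y))) }
    where
    mark₁ : ∀ x → marked B (only x) none ≡ marked B′ (only (fun f x)) none
    mark₁ x = marked-emb f (≡ᶠ-injective (inj f) x) (λ _ → refl)

  join : Glue 1 p p p → Mark2 → Mark2 → Mark2
  join G = comp n (lift (lift G))

  -- For one part, the other one belongs to the outside: its unmarked type is joined to the marked
  -- type before `c` is asked.
  ctx₁ ctx₂ : Glue 1 p p p → Mark2 → Context → Context
  ctx₁ G q c j a = c j (join G a q)
  ctx₂ G q c j a = c j (join G q a)

  inducedGlue : (Fin r → Bool) → Glue 1 p p p → Context → Mark2 → Mark2 → Glue r MarkPal MarkPal MarkPal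
  inducedGlue occ G c q₁ q₂ = record
    { m₁ = λ (a , b) → Type.elt (join G (type a) q₂) , Type.elt (join G (type b) q₂)
    ; m₂ = λ (a , b) → Type.elt (join G q₁ (type a)) , Type.elt (join G q₁ (type b))
    ; x₁₂ = λ R (a , _) (_ , b) → occ R ∧ c (suc R) (join G (type a) (type b))
    ; x₂₁ = λ R (a , _) (_ , b) → occ R ∧ c (suc R) (join G (type b) (type a)) }

  module _ (G : Glue 1 p p p) (A B : Str 1 p) where

    private
      l : Fin (car A) → Fin (car A + car B)
      l = _↑ˡ car B
      u : Fin (car B) → Fin (car A + car B)
      u = car A ↑ʳ_
      q₁ = unmarked A
      q₂ = unmarked B

    marked-glue : ∀ X Y → marked (glue G A B) X Y ≡ join G (marked A (X ∘ l) (Y ∘ l)) (marked B (X ∘ u) (Y ∘ u))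
    marked-glue X Y = begin
      tp n (glue G A B ▹ X ▹ Y)
        ≡⟨ tp-emb n (▹-emb (▹-glue G A B X) {Y} {Y} (λ _ → refl)) ⟨
      tp n (glue (lift G) (A ▹ X ∘ l) (B ▹ X ∘ u) ▹ Y)
        ≡⟨ tp-emb n (▹-glue (lift G) (A ▹ X ∘ l) (B ▹ X ∘ u) Y) ⟨
      tp n (glue (lift (lift G)) (A ▹ X ∘ l ▹ Y ∘ l) (B ▹ X ∘ u ▹ Y ∘ u))
        ≡⟨ tp-glue n (lift (lift G)) (A ▹ X ∘ l ▹ Y ∘ l) (B ▹ X ∘ u ▹ Y ∘ u) ⟩
      join G (marked A (X ∘ l) (Y ∘ l)) (marked B (X ∘ u) (Y ∘ u)) ∎
      where open ≡-Reasoning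

    private
      ll : ∀ x → only (l x) ∘ l ≗ only x
      ll x = ≡ᶠ-injective (λ {i} {j} → ↑ˡ-injective (car B) i j) x
      lu : ∀ x → only (l x) ∘ u ≗ none
      lu x y = ≡ᶠ-false (↑-disjoint x y)
      ul : ∀ y → only (u y) ∘ l ≗ none
      ul y x = ≡ᶠ-false (↑-disjoint x y ∘ sym)
      uu : ∀ y → only (u y) ∘ u ≗ only y
      uu y = ≡ᶠ-injective (λ {i} {j} → ↑ʳ-injective (car A) i j) y
      nn : ∀ {m} → none {m} ≗ none
      nn _ = refl

    unmarked-glue : unmarked (glue G A B) ≡ join G q₁ q₂
    unmarked-glue = marked-glue none none

    mark₁-l : ∀ x → marked (glue G A B) (only (l x)) none ≡ join G (marked A (only x) none) q₂
    mark₁-l x = trans (marked-glue (only (l x)) none) (cong₂ (join G) (marked-cong A (ll x) nn) (marked-cong B (lu x) nn))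

    mark₂-l : ∀ x → marked (glue G A B) none (only (l x)) ≡ join G (marked A none (only x)) q₂
    mark₂-l x = trans (marked-glue none (only (l x))) (cong₂ (join G) (marked-cong A nn (ll x)) (marked-cong B nn (lu x)))

    mark₁-u : ∀ y → marked (glue G A B) (only (u y)) none ≡ join G q₁ (marked B (only y) none)
    mark₁-u y = trans (marked-glue (only (u y)) none) (cong₂ (join G) (marked-cong A (ul y) nn) (marked-cong B (uu y) nn))

    mark₂-u : ∀ y → marked (glue G A B) none (only (u y)) ≡ join G q₁ (marked B none (only y))
    mark₂-u y = trans (marked-glue none (only (u y))) (cong₂ (join G) (marked-cong A nn (ul y)) (marked-cong B nn (uu y)))

    mark-ll : ∀ x y → marked (glue G A B) (only (l x)) (only (l y)) ≡ join G (marked A (only x) (only y)) q₂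
    mark-ll x y = trans (marked-glue (only (l x)) (only (l y))) (cong₂ (join G) (marked-cong A (ll x) (ll y)) (marked-cong B (lu x) (lu y)))

    mark-lu : ∀ x y → marked (glue G A B) (only (l x)) (only (u y)) ≡ join G (marked A (only x) none) (marked B none (only y))
    mark-lu x y = trans (marked-glue (only (l x)) (only (u y))) (cong₂ (join G) (marked-cong A (ll x) (ul y)) (marked-cong B (lu x) (uu y)))

    mark-ul : ∀ x y → marked (glue G A B) (only (u x)) (only (l y)) ≡ join G (marked A none (only y)) (marked B (only x) none)
    mark-ul x y = trans (marked-glue (only (u x)) (only (l y))) (cong₂ (join G) (marked-cong A (ul x) (ll y)) (marked-cong B (uu x) (lu y)))

    mark-uu : ∀ x y → marked (glue G A B) (only (u x)) (only (u y)) ≡ join G q₁ (marked B (only x) (only y))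
    mark-uu x y = trans (marked-glue (only (u x)) (only (u y))) (cong₂ (join G) (marked-cong A (ul x) (ul y)) (marked-cong B (uu x) (uu y)))

    module _ (occ : Fin r → Bool) (c : Context) where

      induced-dom-l : ∀ x → dom (induced occ c (glue G A B)) (l x) ≡ dom (induced occ (ctx₁ G q₂ c) A) x
      induced-dom-l x = cong₂ _∧_ (dom-l G A B x) (cong (c zero) (mark₁-l x))

      induced-dom-u : ∀ y → dom (induced occ c (glue G A B)) (u y) ≡ dom (induced occ (ctx₂ G q₁ c) B) y
      induced-dom-u y = cong₂ _∧_ (dom-u G A B y) (cong (c zero) (mark₁-u y))

      induced-lnk-l : ∀ R x y → lnk (induced occ c (glue G A B)) R (l x) (l y) ≡ lnk (induced occ (ctx₁ G q₂ c) A) R x y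
      induced-lnk-l R x y = cong (λ z → occ R ∧ c (suc R) z) (mark-ll x y)

      induced-lnk-u : ∀ R x y → lnk (induced occ c (glue G A B)) R (u x) (u y) ≡ lnk (induced occ (ctx₂ G q₁ c) B) R x y
      induced-lnk-u R x y = cong (λ z → occ R ∧ c (suc R) z) (mark-uu x y)

      -- On both sides membership, colours and links are read off the same joined types, so that
      -- `tp-glue` also applies to induced parts.
      induced-glue : Emb (glue (inducedGlue occ G c q₁ q₂) (induced occ (ctx₁ G q₂ c) A) (induced occ (ctx₂ G q₁ c) B))
                         (induced occ c (glue G A B))
      induced-glue = glue-emb (inducedGlue occ G c q₁ q₂) (induced occ (ctx₁ G q₂ c) A) (induced occ (ctx₂ G q₁ c) B)
        (induced occ c (glue G A B)) refl
        induced-dom-l induced-dom-u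
        (λ x _ → cong₂ _,_ (cong Type.elt (mark₁-l x)) (cong Type.elt (mark₂-l x)))
        (λ y _ → cong₂ _,_ (cong Type.elt (mark₁-u y)) (cong Type.elt (mark₂-u y)))
        (λ R x y _ _ → induced-lnk-l R x y)
        (λ R x y _ _ → cong (λ z → occ R ∧ c (suc R) z) (mark-lu x y))
        (λ R x y _ _ → cong (λ z → occ R ∧ c (suc R) z) (mark-ul x y))
        (λ R x y _ _ → induced-lnk-u R x y)

    module _ {𝒮 : Structure (BinVoc r) → Set} (her : Hereditary 𝒮) (occ : Fin r → Bool) (c : Context) where

      realised-l : Realised 𝒮 (induced occ c (glue G A B)) → Realised 𝒮 (induced occ (ctx₁ G q₂ c) A)
      realised-l = restrict 𝒮 her l (λ {i} {j} → ↑ˡ-injective (car B) i j) (induced-dom-l occ c) (λ R x y _ _ → induced-lnk-l occ c R x y)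

      realised-u : Realised 𝒮 (induced occ c (glue G A B)) → Realised 𝒮 (induced occ (ctx₂ G q₁ c) B)
      realised-u = restrict 𝒮 her u (λ {i} {j} → ↑ʳ-injective (car A) i j) (induced-dom-u occ c) (λ R x y _ _ → induced-lnk-u occ c R x y)

-- The game on interpreted structures

recolour : ∀ {r p s} → (El p → El s) → Str r p → Str r s
recolour m A = record { car = car A ; dom = dom A ; col = m ∘ col A ; lnk = lnk A }

recolourGlue : ∀ {r p s} → (El p → El s) → Glue r p p s
recolourGlue m = record { m₁ = m ; m₂ = m ; x₁₂ = λ _ _ _ → false ; x₂₁ = λ _ _ _ → false }

-- Recolouring is gluing with the empty structure; the composition theorem then shows that it
-- respects types.
recolour-emb : ∀ {r p s} (m : El p → El s) (A : Str r p) → Emb (recolour m A) (glue (recolourGlue m) A ∅)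
recolour-emb m A = record
  { fun = _↑ˡ 0 ; inj = λ {i} {j} → ↑ˡ-injective 0 i j
  ; dom-f = dom-l (recolourGlue m) A ∅ ; cover = ↑-elim (car A) _ (λ x _ → x , refl) (λ ())
  ; col-f = λ x _ → col-l (recolourGlue m) A ∅ x ; lnk-f = λ R x y _ _ → lnk-ll (recolourGlue m) A ∅ R x y }

module Game (r M : ℕ) .{{_ : NonZero M}} where
  open Types r M
  open Composition r M
  open Evaluation r M

  tp-recolour : ∀ n {p s} (m : El p → El s) {A B : Str r p} → tp n A ≡ tp n B → tp n (recolour m A) ≡ tp n (recolour m B)
  tp-recolour n m {A} {B} e = begin
    tp n (recolour m A)                        ≡⟨ tp-emb n (recolour-emb m A) ⟩
    tp n (glue (recolourGlue m) A ∅)           ≡⟨ tp-glue n (recolourGlue m) A ∅ ⟩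
    comp n (recolourGlue m) (tp n A) (tp n ∅)  ≡⟨ cong (λ τ → comp n (recolourGlue m) τ (tp n ∅)) e ⟩
    comp n (recolourGlue m) (tp n B) (tp n ∅)  ≡⟨ tp-glue n (recolourGlue m) B ∅ ⟨
    tp n (glue (recolourGlue m) B ∅)           ≡⟨ tp-emb n (recolour-emb m B) ⟨
    tp n (recolour m B)                        ∎
    where open ≡-Reasoning

  tp-ob : ∀ n {p} {A B : Str r p} → tp n A ≡ tp n B → ob A ≡ ob B
  tp-ob n {A = A} {B} e = trans (sym (obOf-tp n A)) (trans (cong obOf e) (obOf-tp n B))

  tp-down : ∀ n {p} {A B : Str r p} → tp (suc n) A ≡ tp (suc n) B → tp n A ≡ tp n B
  tp-down zero {A = A} {B} e = Type-ext₀ (trans (obOf-tp 0 A) (trans (tp-ob 1 e) (sym (obOf-tp 0 B))))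
  tp-down (suc n) {p} {A} {B} e = Type-ext (trans (obOf-tp (suc n) A) (trans (tp-ob (suc (suc n)) e) (sym (obOf-tp (suc n) B)))) (half e) (half (sym e))
    where
    half : ∀ {A B : Str r p} → tp (suc (suc n)) A ≡ tp (suc (suc n)) B → ∀ ρ → ρ ∈ᵗ tp (suc n) A → ρ ∈ᵗ tp (suc n) B
    half {A} {B} e ρ m =
      let X , q = ∈-tp-elim n A ρ m
          Y , q′ = tp-move e X
      in subst (_∈ᵗ tp (suc n) B) (trans (sym (tp-down n q′)) q) (∈-tp-intro n B Y)

  tp-drop : ∀ m n {p} {A B : Str r p} → tp (m + n) A ≡ tp (m + n) B → tp n A ≡ tp n B
  tp-drop zero    n e = e
  tp-drop (suc m) n e = tp-drop m n (tp-down (m + n) e)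

  module _ {p : Pal} where

    card-full : (A : Str r p) → Full A → ∀ (X : Fin (car A) → Bool) → card (λ x → dom A x ∧ X x) ≡ card X
    card-full A f X = card-cong λ x → cong (_∧ X x) (f x)

    card-agree : ∀ n {A B : Str r p} → Full A → Full B → tp n A ≡ tp n B → ∀ P →
                 cap (card (λ x → P (col A x))) ≡ cap (card (λ x → P (col B x)))
    card-agree n {A} {B} fA fB e P = toℕ-injective (begin
      capᵗ (card (λ x → P (col A x)))             ≡⟨ cong capᵗ (card-full A fA (P ∘ col A)) ⟨
      capᵗ (card (λ x → dom A x ∧ P (col A x)))   ≡⟨ weight-tp n A P ⟨
      weight (obOf (tp n A)) P                    ≡⟨ cong (λ τ → weight (obOf τ) P) e ⟩
      weight (obOf (tp n B)) P                    ≡⟨ weight-tp n B P ⟩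
      capᵗ (card (λ x → dom B x ∧ P (col B x)))   ≡⟨ cong capᵗ (card-full B fB (P ∘ col B)) ⟩
      capᵗ (card (λ x → P (col B x)))             ∎)
      where open ≡-Reasoning

  cap-1 : ∀ {x y} → cap x ≡ cap y → x ≡ 1 → y ≡ 1
  cap-1 {x} {y} e refl = ≡ᵇ-sound (trans (sym (capᵗ-1 y)) (cong (_≡ᵇ 1) (cong toℕ (sym e))))

  -- A singleton is answered by a singleton, because `cap` keeps the count 1 apart from all others.
  answer : ∀ n {p} {A B : Str r p} → Full A → Full B → tp (suc n) A ≡ tp (suc n) B →
           ∀ x → ∃ λ y → tp n (A ◂ x) ≡ tp n (B ◂ y)
  answer n {A = A} {B} fA fB e x =
    let Y , q = tp-move e (x ≡ᶠ_)
        y , q′ = card-1 Y (cap-1 (card-agree n fA fB q new) (card-singleton x))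
    in y , trans q (tp-emb n (▹-cong B q′))

  card-only : ∀ {n} (x : Fin n) (X : Fin n → Bool) → card (λ z → (x ≡ᶠ z) ∧ X z) ≡ b2n (X x)
  card-only {suc n} zero X = trans (card-suc (λ z → (zero ≡ᶠ z) ∧ X z)) (trans (cong (b2n (X zero) +_) (card-∅ n)) (+-identityʳ _))
  card-only {suc n} (suc x) X = trans (card-suc (λ z → (suc x ≡ᶠ z) ∧ X z))
    (trans (card-cong λ z → cong (_∧ X (suc z)) (suc-≡ᶠ x z)) (card-only x (X ∘ suc)))

  b2n-injective : ∀ {a b} → cap (b2n a) ≡ cap (b2n b) → a ≡ b
  b2n-injective {true}  {true}  e = refl
  b2n-injective {false} {false} e = refl

  -- The number of marked elements whose colour satisfies `P` is 0 or 1, so capping loses nothing.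
  colour-agree : ∀ n {p} {A B : Str r p} → Full A → Full B → ∀ {x y} → tp n (A ◂ x) ≡ tp n (B ◂ y) →
                 ∀ P → P (col A x) ≡ P (col B y)
  colour-agree n {A = A} {B} fA fB {x} {y} e P = b2n-injective (begin
    cap (b2n (P (col A x)))                        ≡⟨ cong cap (card-only x (P ∘ col A)) ⟨
    cap (card (λ z → (x ≡ᶠ z) ∧ P (col A z)))      ≡⟨ card-agree n fA fB e (λ (b , κ) → b ∧ P κ) ⟩
    cap (card (λ z → (y ≡ᶠ z) ∧ P (col B z)))      ≡⟨ cong cap (card-only y (P ∘ col B)) ⟩
    cap (b2n (P (col B y)))                        ∎)
    where open ≡-Reasoning

overlay : ∀ {t r p s} (A : Str t p) → (El p → El s) → (Fin (car A) → Bool) → (Fin r → Fin (car A) → Fin (car A) → Bool) → Str r s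
overlay A κ D E = record { car = car A ; dom = D ; col = κ ∘ col A ; lnk = E }

-- n rounds on interpreted structures are won with n + 2 + q rounds on the host structures
-- if q-round types determine domain and relations: the domain itself is played as one more
-- set, whose answer must again be the domain.
module Overlay (r M : ℕ) .{{_ : NonZero M}} (q : ℕ) where
  open Types 1 M using (cap; tp; tp-move)
  open Game 1 M
  private
    module S = Types r M

  module _ {p s : Pal} (κ : El p → El s) (A B : Str 1 p)
           (D : Fin (car A) → Bool) (D′ : Fin (car B) → Bool)
           (E : Fin r → Fin (car A) → Fin (car A) → Bool) (E′ : Fin r → Fin (car B) → Fin (car B) → Bool) where

    Definable₁ : Set
    Definable₁ = ∀ x y → tp q (A ◂ x) ≡ tp q (B ◂ y) → D x ≡ D′ y

    Definable₂ : Set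
    Definable₂ = ∀ R x x′ y y′ → tp q (A ◂ x ◂ x′) ≡ tp q (B ◂ y ◂ y′) → E R x x′ ≡ E′ R y y′

  keep-second : ∀ {p} → El (bit (bit p)) → El (bit p)
  keep-second (b , (_ , κ)) = b , κ

  -- Two rounds name the ends of a link and the remaining `q` decide domain and relations there. For
  -- the second end alone, the first mark is forgotten by recolouring.
  linked⇒ : ∀ {p s} (κ : El p → El s) {A B : Str 1 p} {D D′ E E′} → Full A → Full B →
            tp (suc (suc q)) A ≡ tp (suc (suc q)) B → Definable₁ κ A B D D′ E E′ → Definable₂ κ A B D D′ E E′ →
            ∀ R {μ μ′} → S.linked (overlay A κ D E) R μ μ′ ≡ true → S.linked (overlay B κ D′ E′) R μ μ′ ≡ true
  linked⇒ {p} {s} κ {A} {B} {D} {D′} {E} {E′} fA fB e d₁ d₂ R {μ} {μ′} l = go (S.linked-elim (overlay A κ D E) R l)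
    where
    Goal : Set
    Goal = S.linked (overlay B κ D′ E′) R μ μ′ ≡ true
    same : ∀ x y → tp q (A ◂ x) ≡ tp q (B ◂ y) → κ (col B y) ≡ κ (col A x)
    same x y e = ==-sound {s} (trans (sym (colour-agree q fA fB e (λ c → κ c == κ (col A x)))) (==-refl {s} (κ (col A x))))
    finish : ∀ x x′ y y′ → D x ≡ true → D x′ ≡ true → κ (col A x) ≡ μ → κ (col A x′) ≡ μ′ → E R x x′ ≡ true →
             tp q (A ◂ x) ≡ tp q (B ◂ y) → tp q (A ◂ x′) ≡ tp q (B ◂ y′) →
             tp q (A ◂ x ◂ x′) ≡ tp q (B ◂ y ◂ y′) → Goal
    finish x x′ y y′ dx dx′ cx cx′ lk e₁ e₁′ e₂ = S.linked-intro (overlay B κ D′ E′) R y y′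
      (trans (sym (d₁ x y e₁)) dx) (trans (sym (d₁ x′ y′ e₁′)) dx′)
      (trans (same x y e₁) cx) (trans (same x′ y′ e₁′) cx′) (trans (sym (d₂ R x x′ y y′ e₂)) lk)
    go : (∃ λ x → ∃ λ x′ → D x ≡ true × D x′ ≡ true × κ (col A x) ≡ μ × κ (col A x′) ≡ μ′ × E R x x′ ≡ true) → Goal
    go (x , x′ , dx , dx′ , cx , cx′ , lk) = go₁ (answer (suc q) fA fB e x)
      where
      go₂ : ∀ y → tp (suc q) (A ◂ x) ≡ tp (suc q) (B ◂ y) →
            (∃ λ y′ → tp q (A ◂ x ◂ x′) ≡ tp q (B ◂ y ◂ y′)) → Goal
      go₂ y e₁ (y′ , e₂) = finish x x′ y y′ dx dx′ cx cx′ lk (tp-down q e₁)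
        (tp-recolour q keep-second e₂) e₂
      go₁ : (∃ λ y → tp (suc q) (A ◂ x) ≡ tp (suc q) (B ◂ y)) → Goal
      go₁ (y , e₁) = go₂ y e₁ (answer q fA fB e₁ x′)

  -- The element of `A` that answers `y` lies in `D` exactly if `y` lies in `Y`, and by definability
  -- exactly if `y` lies in `D′`.
  domain-answer : ∀ {p s} (κ : El p → El s) {A B : Str 1 p} {D D′ E E′} → Full A → Full B → Definable₁ κ A B D D′ E E′ →
                  ∀ Y → tp (suc q) (A ▹ D) ≡ tp (suc q) (B ▹ Y) → Y ≗ D′
  domain-answer κ {A} {B} {D} {D′} fA fB d₁ Y e y = go (answer q fB fA (sym e) y)
    where
    go : (∃ λ x → tp q (B ▹ Y ◂ y) ≡ tp q (A ▹ D ◂ x)) → Y y ≡ D′ y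
    go (x , e₁) = trans (colour-agree q fB fA e₁ proj₁)
      (d₁ x y (sym (tp-recolour q keep-second e₁)))

  ob-overlay : ∀ {p s} (κ : El p → El s) {A B : Str 1 p} {D D′ E E′} → Full A → Full B →
               tp (suc (suc q)) A ≡ tp (suc (suc q)) B → Definable₁ κ A B D D′ E E′ → Definable₂ κ A B D D′ E E′ →
               S.ob (overlay A κ D E) ≡ S.ob (overlay B κ D′ E′)
  ob-overlay {p} {s} κ {A} {B} {D} {D′} {E} {E′} fA fB e d₁ d₂ = S.mkOb-cong (counts (tp-move e D))
    (λ R μ μ′ → ⇔→≡ (linked⇒ κ {A} {B} {D} {D′} {E} {E′} fA fB e d₁ d₂ R)
      (linked⇒ κ {B} {A} {D′} {D} {E′} {E} fB fA (sym e) (λ x y t → sym (d₁ y x (sym t))) (λ R x x′ y y′ t → sym (d₂ R y y′ x x′ (sym t))) R))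
    where
    counts : (∃ λ Y → tp (suc q) (A ▹ D) ≡ tp (suc q) (B ▹ Y)) → ∀ μ →
             cap (card (S.at (overlay {r = r} A κ D E) μ)) ≡ cap (card (S.at (overlay {r = r} B κ D′ E′) μ))
    counts (Y , e₁) μ = trans (card-agree (suc q) fA fB e₁ (λ (b , c) → b ∧ (κ c == μ)))
      (cong cap (card-cong λ y → cong (_∧ (κ (col B y) == μ)) (domain-answer κ {A} {B} {D} {D′} {E} {E′} fA fB d₁ Y e₁ y)))

  tp-overlay : ∀ m {p s} (κ : El p → El s) {A B : Str 1 p} {D D′ E E′} → Full A → Full B →
               tp (m + suc (suc q)) A ≡ tp (m + suc (suc q)) B → Definable₁ κ A B D D′ E E′ → Definable₂ κ A B D D′ E E′ →
               S.tp m (overlay A κ D E) ≡ S.tp m (overlay B κ D′ E′)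
  tp-overlay zero κ {A} {B} {D} {D′} {E} {E′} fA fB e d₁ d₂ = S.Type-ext₀ (trans (S.obOf-tp 0 (overlay A κ D E))
    (trans (ob-overlay κ {A} {B} {D} {D′} {E} {E′} fA fB e d₁ d₂) (sym (S.obOf-tp 0 (overlay B κ D′ E′)))))
  tp-overlay (suc m) {p} {s} κ {A} {B} {D} {D′} {E} {E′} fA fB e d₁ d₂ = S.Type-ext
    (trans (S.obOf-tp (suc m) (overlay A κ D E)) (trans
      (ob-overlay κ {A} {B} {D} {D′} {E} {E′} fA fB (tp-drop (suc m) (suc (suc q)) e) d₁ d₂)
      (sym (S.obOf-tp (suc m) (overlay B κ D′ E′)))))
    (half fA fB e d₁ d₂)
    (half fB fA (sym e) (λ x y t → sym (d₁ y x (sym t))) (λ R x x′ y y′ t → sym (d₂ R y y′ x x′ (sym t))))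
    where
    κ′ : El (bit p) → El (bit s)
    κ′ (b , c) = b , κ c
    half : ∀ {A B : Str 1 p} {D D′ E E′} → Full A → Full B →
           tp (suc m + suc (suc q)) A ≡ tp (suc m + suc (suc q)) B → Definable₁ κ A B D D′ E E′ → Definable₂ κ A B D D′ E E′ →
           ∀ ρ → ρ S.∈ᵗ S.tp (suc m) (overlay A κ D E) → ρ S.∈ᵗ S.tp (suc m) (overlay B κ D′ E′)
    half {A} {B} {D} {D′} {E} {E′} fA fB e d₁ d₂ ρ i = go (S.∈-tp-elim m (overlay A κ D E) ρ i)
      where
      step : ∀ X Y → tp (m + suc (suc q)) (A ▹ X) ≡ tp (m + suc (suc q)) (B ▹ Y) →
             S.tp m (overlay A κ D E ▹ X) ≡ S.tp m (overlay B κ D′ E′ ▹ Y)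
      step X Y e₁ = tp-overlay m κ′ {A ▹ X} {B ▹ Y} {D} {D′} {E} {E′} fA fB e₁
        -- The bit of the move is forgotten by recolouring, so definability persists after the move.
        (λ x y t → d₁ x y (tp-recolour q keep-second t))
        (λ R x x′ y y′ t → d₂ R x x′ y y′ (tp-recolour q (λ (b , (b′ , (_ , c))) → b , (b′ , c)) t))
      go : (∃ λ X → S.tp m (overlay A κ D E ▹ X) ≡ ρ) → ρ S.∈ᵗ S.tp (suc m) (overlay B κ D′ E′)
      go (X , e₀) = go′ (tp-move e X)
        where
        go′ : (∃ λ Y → tp (m + suc (suc q)) (A ▹ X) ≡ tp (m + suc (suc q)) (B ▹ Y)) → ρ S.∈ᵗ S.tp (suc m) (overlay B κ D′ E′)
        go′ (Y , e₁) = subst (S._∈ᵗ S.tp (suc m) (overlay B κ D′ E′))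
          (trans (sym (step X Y e₁)) e₀) (S.∈-tp-intro m (overlay B κ D′ E′) Y)

-- Formulas over labelled trees

lookup-index : ∀ {A : Set} {x : A} {xs} (i : x ∈ xs) → List.lookup xs (Any.index i) ≡ x
lookup-index (here e)  = sym e
lookup-index (there i) = lookup-index i

-- Node colours: the labels in ls, and an extra colour from s.
module TreeFormulas {L : ℕ} (ls : List (Fin L)) (s : Pal) where

  ColPal : Pal
  ColPal = base (2 ^ length ls) ⊗ s

  code : Lab L → Fin (2 ^ length ls)
  code l = funToFin (b2f ∘ l ∘ List.lookup ls)

  hasLabel : Fin L → El (bit ColPal) → Bool
  hasLabel i (_ , (t , _)) = anyᶠ λ j → (List.lookup ls j ≡ᶠ i) ∧ f2b (finToFun {2} {length ls} t j)

  hasLabel-code : ∀ {i} → i ∈ ls → ∀ l {b k} → hasLabel i (b , (code l , k)) ≡ l i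
  hasLabel-code {i} i∈ls l = ⇔→≡
    (λ e → to (anyᶠ-elim (λ j → (List.lookup ls j ≡ᶠ i) ∧ f2b (finToFun {2} {length ls} (code l) j)) e))
    (λ e → anyᶠ-intro (λ j → (List.lookup ls j ≡ᶠ i) ∧ f2b (finToFun {2} {length ls} (code l) j)) (Any.index i∈ls)
      (∧-intro (subst (λ z → (z ≡ᶠ i) ≡ true) (sym (lookup-index i∈ls)) (≡ᶠ-refl i))
        (trans (read (Any.index i∈ls)) (trans (cong l (lookup-index i∈ls)) e))))
    where
    read : ∀ j → f2b (finToFun {2} {length ls} (code l) j) ≡ l (List.lookup ls j)
    read j = trans (cong f2b (finToFun-funToFin (b2f ∘ l ∘ List.lookup ls) j)) (f2b-b2f _)
    to : (∃ λ j → (List.lookup ls j ≡ᶠ i) ∧ f2b (finToFun {2} {length ls} (code l) j) ≡ true) → l i ≡ true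
    to (j , e) = subst (λ z → l z ≡ true) (≡ᶠ-sound (proj₁ (∧-elim e))) (trans (sym (read j)) (proj₂ (∧-elim {List.lookup ls j ≡ᶠ i} e)))

  atm : ∀ {p} → (El p → El (bit ColPal)) → (R : Fin (suc L)) → Vec (El p → Bool) (treeAr L R) → F 1 p
  atm π zero    (P ∷ Q ∷ []) = rel′ zero P Q
  atm π (suc i) (P ∷ [])     = some λ κ → P κ ∧ hasLabel i (π κ)

  open Translation {TreeVoc L} 1 (bit ColPal) atm public

  module _ (M : ℕ) .{{_ : NonZero M}} (k : ℕ → El s) (t : Tree L) where
    open Types 1 M
    open Evaluation 1 M
    open TreeStructure {L} {ColPal} (λ l i → code l , k i)
    open Correct M (treeStr t) (col (nodeS t)) (lnk (nodeS t)) (UsesOnly ls) public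

    atomCorrect : AtomCorrect
    atomCorrect zero _ n π c e (P ∷ Q ∷ []) (x ∷ y ∷ []) sg = ⇔→≡
      (λ v → to (evalT-rel-elim n (coloured c) zero P Q v))
      (λ v → evalT-rel-intro n (coloured c) zero P Q x y refl refl (trans (sg zero x) (≡ᶠ-refl x)) (trans (sg (suc zero) y) (≡ᶠ-refl y))
        (trans (nodeS-edge t x y) v))
      where
      to : (∃ λ x′ → ∃ λ y′ → true ≡ true × true ≡ true × P (c x′) ≡ true × Q (c y′) ≡ true × lnk (nodeS t) zero x′ y′ ≡ true) →
           treeRel t zero (x ∷ y ∷ []) ≡ true
      to (x′ , y′ , _ , _ , p , q , l) = subst₂ (λ u v → treeRel t zero (u ∷ v ∷ []) ≡ true)
        (sym (≡ᶠ-sound (trans (sym (sg zero x′)) p))) (sym (≡ᶠ-sound (trans (sym (sg (suc zero) y′)) q)))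
        (trans (sym (nodeS-edge t x′ y′)) l)
    atomCorrect (suc i) i∈ls n π c e (P ∷ []) (x ∷ []) sg = trans (evalT-some n (coloured c) (λ κ → P κ ∧ hasLabel i (π κ))) (⇔→≡
      (λ v → to (anyᶠ-elim (λ z → P (c z) ∧ hasLabel i (π (c z))) v))
      (λ v → anyᶠ-intro (λ z → P (c z) ∧ hasLabel i (π (c z))) x (∧-intro (trans (sg zero x) (≡ᶠ-refl x)) (trans (label x) v))))
      where
      label : ∀ z → hasLabel i (π (c z)) ≡ treeRel t (suc i) (z ∷ [])
      label z = trans (cong (hasLabel i) (e z)) (trans (cong (λ κ → hasLabel i (proj₁ (col (nodeS t) z) , κ)) (nodeS-colour t z))
        (hasLabel-code i∈ls (proj₁ (List.lookup (nodes t) z)) {proj₁ (col (nodeS t) z)} {k (toℕ z)}))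
      to : (∃ λ z → P (c z) ∧ hasLabel i (π (c z)) ≡ true) → treeRel t (suc i) (x ∷ []) ≡ true
      to (z , v) = subst (λ u → treeRel t (suc i) (u ∷ []) ≡ true) (sym (≡ᶠ-sound (trans (sym (sg zero z)) (proj₁ (∧-elim {P (c z)} v)))))
        (trans (sym (label z)) (proj₂ (∧-elim {P (c z)} v)))

  variable₁ : Fin 1 → El (bit (bit ColPal)) → Bool
  variable₁ _ = new {bit ColPal}

  variable₂ : Fin 2 → El (bit (bit (bit ColPal))) → Bool
  variable₂ zero       = up {bit (bit ColPal)} (new {bit ColPal})
  variable₂ (suc zero) = new {bit (bit ColPal)}

  tr₁ : Form (TreeVoc L) 1 0 → F 1 (bit (bit ColPal))
  tr₁ = tr {p = bit (bit ColPal)} proj₂ variable₁ fin0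

  tr₂ : Form (TreeVoc L) 2 0 → F 1 (bit (bit (bit ColPal)))
  tr₂ = tr {p = bit (bit (bit ColPal))} (proj₂ ∘ proj₂) variable₂ fin0

  module _ (M : ℕ) .{{_ : NonZero M}} (n : ℕ) (k : ℕ → El s) (t : Tree L) where
    open Types 1 M
    open Evaluation 1 M
    open TreeStructure {L} {ColPal} (λ l i → code l , k i)

    env₁ : ∀ x → Env M k t {p = bit (bit ColPal)} proj₂ variable₁ fin0 (λ z → (x ≡ᶠ z) , col (nodeS t) z) (λ _ → x) fin0
    env₁ x = record { base≡ = λ _ → refl ; singles = λ _ _ → refl ; sets = λ () }

    env₂ : ∀ x y → Env M k t {p = bit (bit (bit ColPal))} (proj₂ ∘ proj₂) variable₂ fin0 (λ z → (y ≡ᶠ z) , ((x ≡ᶠ z) , col (nodeS t) z)) (lookup (x ∷ y ∷ [])) fin0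
    env₂ x y = record { base≡ = λ _ → refl ; singles = λ { zero _ → refl ; (suc zero) _ → refl } ; sets = λ () }

    tr₁-correct : ∀ φ → Within (UsesOnly ls) M n φ → ∀ x →
                  (evalT (tr₁ φ) (tp n (nodeS t ◂ x)) ≡ true) ⇔ SatIn (treeStr t) full (λ _ → x) fin0 φ
    tr₁-correct φ w x = mk⇔ (eval⇒Sat M k t (atomCorrect M k t) n φ w (env₁ x)) (Sat⇒eval M k t (atomCorrect M k t) n φ w (env₁ x))

    tr₂-correct : ∀ φ → Within (UsesOnly ls) M n φ → ∀ x y →
                  (evalT (tr₂ φ) (tp n (nodeS t ◂ x ◂ y)) ≡ true) ⇔ SatIn (treeStr t) full (lookup (x ∷ y ∷ [])) fin0 φ
    tr₂-correct φ w x y = mk⇔ (eval⇒Sat M k t (atomCorrect M k t) n φ w (env₂ x y)) (Sat⇒eval M k t (atomCorrect M k t) n φ w (env₂ x y))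

-- Representatives for the members of the hereditary class

module Covering {r L : ℕ} (ls : List (Fin L)) (s : Pal) (M : ℕ) .{{_ : NonZero M}}
  (J : Interp (BinVoc r) (TreeVoc L)) (occ : Fin r → Bool) (m q : ℕ)
  (within-ν : Within (UsesOnly ls) M q (ν J)) (within-η : ∀ R → occ R ≡ true → Within (UsesOnly ls) M q (η J R)) where

  open TreeFormulas ls s
  open Evaluation 1 M
  open Overlay r M q
  private
    module T = Types 1 M
    module S = Types r M

  rounds : ℕ
  rounds = m + suc (suc q)

  extra : El (bit ColPal) → El s
  extra (_ , (_ , k)) = k

  domain : (A : Str 1 (bit ColPal)) → Fin (car A) → Bool
  domain A x = evalT (tr₁ (ν J)) (T.tp q (A ◂ x))

  relation : (A : Str 1 (bit ColPal)) → Fin r → Fin (car A) → Fin (car A) → Bool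
  relation A R x y = occ R ∧ evalT (tr₂ (η J R)) (T.tp q (A ◂ x ◂ y))

  -- Evaluating `J` on types makes sense in every coloured structure, in particular in
  -- representatives; the result may lie outside `𝒮`.
  interpreted : Str 1 (bit ColPal) → Str r s
  interpreted A = overlay A extra (domain A) (relation A)

  interpreted-cong : ∀ {A B} → Full A → Full B → T.tp rounds A ≡ T.tp rounds B → S.tp m (interpreted A) ≡ S.tp m (interpreted B)
  interpreted-cong {A} {B} fA fB e = tp-overlay m extra {A} {B} {domain A} {domain B} {relation A} {relation B} fA fB e
    (λ x y t → cong (evalT (tr₁ (ν J))) t) (λ R x x′ y y′ t → cong (λ τ → occ R ∧ evalT (tr₂ (η J R)) τ) t)

  open Representatives M rounds ColPal using (#reps; rep; rep-complete; Full-rep)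

  module _ {𝒮 : Structure (BinVoc r) → Set} {𝒰 : Tree L → Set} {h : ℕ} (height≤h : ∀ T → 𝒰 T → height T ≤ h)
           (class : ∀ C → 𝒮 C → Σ _ λ U → 𝒰 U × IsInterpretedBy J (treeStr U) C) (default : El s) where

    module _ {A : Str r s} (real : Realised 𝒮 A) (U : Tree L) (i : IsInterpretedBy J (treeStr U) (Realised.C real)) where
      open Realised real

      private
        f      = proj₁ i
        f-inj  = proj₁ (proj₂ i)
        f-ν    = proj₁ (proj₂ (proj₂ i))
        f-onto = proj₁ (proj₂ (proj₂ (proj₂ i)))
        f-rels = proj₂ (proj₂ (proj₂ (proj₂ i)))

      abstract
        -- The colours of `A` are put on the nodes that interpret its elements. The other nodes lie
        -- outside the interpreted domain, and their colour is arbitrary.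
        k : ℕ → El s
        k j with any? (λ x → toℕ (f x) ℕ.≟ j)
        ... | yes (x , _) = col A (place x)
        ... | no _        = default

        k-f : ∀ x → k (toℕ (f x)) ≡ col A (place x)
        k-f x with any? (λ y → toℕ (f y) ℕ.≟ toℕ (f x))
        ... | yes (y , e) = cong (col A ∘ place) (f-inj (toℕ-injective e))
        ... | no ne       = ⊥-elim (ne (x , refl))

      open TreeStructure {L} {ColPal} (λ l i → code l , k i)

      realiser-U : Emb (realiser occ real) (interpreted (nodeS U))
      realiser-U = record
        { fun = f ; inj = f-inj
        ; dom-f = λ x → Equivalence.from (tr₁-correct M q k U (ν J) within-ν (f x)) (f-ν x)
        ; cover = λ y e → f-onto y (Equivalence.to (tr₁-correct M q k U (ν J) within-ν y) e)
        ; col-f = λ x _ → trans (cong proj₂ (nodeS-colour U (f x))) (k-f x)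
        ; lnk-f = λ R x y _ _ → same R x y (occ R) refl }
        where
        same : ∀ R x y b → occ R ≡ b → b ∧ evalT (tr₂ (η J R)) (T.tp q (nodeS U ◂ f x ◂ f y)) ≡ b ∧ rel C R (x ∷ y ∷ [])
        same R x y false _ = refl
        same R x y true  o = ⇔→≡
          (λ e → Equivalence.from (f-rels R (x ∷ y ∷ [])) (Equivalence.to (tr₂-correct M q k U (η J R) (within-η R o) (f x) (f y)) e))
          (λ e → Equivalence.from (tr₂-correct M q k U (η J R) (within-η R o) (f x) (f y)) (Equivalence.to (f-rels R (x ∷ y ∷ [])) e))

      -- The representative and `U` have equal types, hence so have the structures interpreted in
      -- them; the one in `U` is `A`, masked by `occ`, up to isomorphism.
      covered-by : height U ≤ h → ∃ λ v → S.tp m (interpreted (rep h v)) ≡ S.tp m (masked occ A)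
      covered-by le = go (rep-complete h (TreeType-tree M rounds h U 0 le))
        where
        go : (∃ λ v → T.tp rounds (rep h v) ≡ T.tp rounds (treeS U 0)) → ∃ λ v → S.tp m (interpreted (rep h v)) ≡ S.tp m (masked occ A)
        go (v , e) = v , trans (interpreted-cong (Full-rep h v) (λ _ → refl) (trans e (sym (T.tp-emb rounds (nodeS-emb U)))))
          (trans (sym (S.tp-emb m realiser-U)) (S.tp-emb m (realiser-emb occ real)))

    covered-type : ∀ {A : Str r s} → Realised 𝒮 A → ∃ λ v → S.tp m (interpreted (rep h v)) ≡ S.tp m (masked occ A)
    covered-type real = go (class C C∈𝒮)
      where
      open Realised real
      go : (Σ _ λ U → 𝒰 U × IsInterpretedBy J (treeStr U) C) → _
      go (U , U∈𝒰 , i) = covered-by real U i (height≤h U U∈𝒰)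

-- The automaton

first : ∀ {n} → (Fin n → Bool) → Maybe (Fin n)
first {zero}  P = nothing
first {suc n} P = if P zero then just zero else Maybe.map suc (first (P ∘ suc))

first-sound : ∀ {n} (P : Fin n → Bool) d {i} → P i ≡ true → P (fromMaybe d (first P)) ≡ true
first-sound P d {i} p = go (exists P i p)
  where
  exists : ∀ {n} (P : Fin n → Bool) i → P i ≡ true → ∃ λ j → first P ≡ just j × P j ≡ true
  exists {suc _} P i p with P zero in e
  exists {suc _} P i p       | true  = zero , refl , e
  exists {suc _} P zero p    | false with () ← trans (sym p) e
  exists {suc _} P (suc i) p | false = let j , q , r = exists (P ∘ suc) i p in suc j , cong (Maybe.map suc) q , r
  go : (∃ λ j → first P ≡ just j × P j ≡ true) → P (fromMaybe d (first P)) ≡ true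
  go (j , q , r) = subst (λ z → P (fromMaybe d z) ≡ true) (sym q) r

glue-embʳ : ∀ {r p q s} (G : Glue r p q s) (A : Str r p) {B B′ : Str r q} → Emb B B′ → Emb (glue G A B) (glue G A B′)
glue-embʳ G A {B} {B′} f = record
  { fun = g
  ; inj = λ {x} {y} → ↑-elim (car A) (λ x → ∀ y → g x ≡ g y → x ≡ y)
      (λ x → ↑-elim (car A) _ (λ y e → cong (_↑ˡ car B) (↑ˡ-injective (car B′) x y (trans (sym (g-l x)) (trans e (g-l y)))))
                              (λ y e → ⊥-elim (↑-disjoint x (fun f y) (trans (sym (g-l x)) (trans e (g-u y))))))
      (λ x → ↑-elim (car A) _ (λ y e → ⊥-elim (↑-disjoint y (fun f x) (trans (sym (g-l y)) (trans (sym e) (g-u x)))))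
                              (λ y e → cong (car A ↑ʳ_) (inj f (↑ʳ-injective (car A) _ _ (trans (sym (g-u x)) (trans e (g-u y)))))))
      x y
  ; dom-f = ↑-elim (car A) _
      (λ x → trans (cong (dom (glue G A B′)) (g-l x)) (trans (dom-l G A B′ x) (sym (dom-l G A B x))))
      (λ y → trans (cong (dom (glue G A B′)) (g-u y)) (trans (dom-u G A B′ (fun f y)) (trans (dom-f f y) (sym (dom-u G A B y)))))
  ; cover = ↑-elim (car A) _
      (λ x _ → x ↑ˡ car B , g-l x)
      (λ y e → cov y (cover f y (trans (sym (dom-u G A B′ y)) e)))
  ; col-f = ↑-elim (car A) _
      (λ x _ → trans (cong (col (glue G A B′)) (g-l x)) (trans (col-l G A B′ x) (sym (col-l G A B x))))
      (λ y e → trans (cong (col (glue G A B′)) (g-u y)) (trans (col-u G A B′ (fun f y))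
        (trans (cong (m₂ G) (col-f f y (trans (sym (dom-u G A B y)) e))) (sym (col-u G A B y)))))
  ; lnk-f = λ R → ↑-elim (car A) _
      (λ x → ↑-elim (car A) _
        (λ y _ _ → trans (cong₂ (lnk (glue G A B′) R) (g-l x) (g-l y)) (trans (lnk-ll G A B′ R x y) (sym (lnk-ll G A B R x y))))
        (λ y _ e → trans (cong₂ (lnk (glue G A B′) R) (g-l x) (g-u y)) (trans (lnk-lu G A B′ R x (fun f y))
          (trans (cong (x₁₂ G R (col A x)) (col-f f y (trans (sym (dom-u G A B y)) e))) (sym (lnk-lu G A B R x y))))))
      (λ x → ↑-elim (car A) _
        (λ y e _ → trans (cong₂ (lnk (glue G A B′) R) (g-u x) (g-l y)) (trans (lnk-ul G A B′ R (fun f x) y)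
          (trans (cong (λ c → x₂₁ G R c (col A y)) (col-f f x (trans (sym (dom-u G A B x)) e))) (sym (lnk-ul G A B R x y)))))
        (λ y e e′ → trans (cong₂ (lnk (glue G A B′) R) (g-u x) (g-u y)) (trans (lnk-uu G A B′ R (fun f x) (fun f y))
          (trans (lnk-f f R x y (trans (sym (dom-u G A B x)) e) (trans (sym (dom-u G A B y)) e′)) (sym (lnk-uu G A B R x y)))))) }
  where
  g : Fin (car A + car B) → Fin (car A + car B′)
  g z = [ (_↑ˡ car B′) , (λ y → car A ↑ʳ fun f y) ]′ (splitAt (car A) z)
  g-l : ∀ x → g (x ↑ˡ car B) ≡ x ↑ˡ car B′
  g-l x = cong [ (_↑ˡ car B′) , (λ y → car A ↑ʳ fun f y) ]′ (splitAt-↑ˡ (car A) x (car B))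
  g-u : ∀ y → g (car A ↑ʳ y) ≡ car A ↑ʳ fun f y
  g-u y = cong [ (_↑ˡ car B′) , (λ y → car A ↑ʳ fun f y) ]′ (splitAt-↑ʳ (car A) (car B) y)
  cov : ∀ y → (∃ λ x → fun f x ≡ y) → ∃ λ z → g z ≡ car A ↑ʳ y
  cov y (x , refl) = car A ↑ʳ x , g-u x

module Automaton {r L : ℕ} {𝒮 : Structure (BinVoc r) → Set} (her : Hereditary 𝒮)
  (c : Pal) (colour : Lab L → El c) (M₁ n : ℕ) .{{_ : NonZero M₁}} (occ : Fin r → Bool) (M m : ℕ) .{{_ : NonZero M}} where

  open TreeStructure {L} {c} (λ l _ → colour l)
  open Induced r M₁ n (bit c)
  private
    module T = Types 1 M₁
    module S = Types r M
    module TC = Composition 1 M₁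
    module SC = Composition r M

  all : Fin r → Bool
  all _ = true

  STy : Set
  STy = S.Type m MarkPal

  -- Membership in `𝒮` concerns the full vocabulary, so all relations are kept here, whereas the
  -- remembered types see only those in `occ`.
  Good : Context → Str 1 (bit c) → Set
  Good k B = Realised 𝒮 (induced all k B)

  -- What is remembered of a structure B: its type, and for every context the type of
  -- the structure induced on B.
  Val : Set
  Val = Mark2 × (Context → STy)

  -- Nothing is claimed for contexts whose part is not in `𝒮`, as no representative need exist
  -- there.
  record Tracks (v : Val) (B : Str 1 (bit c)) : Set where
    field
      type≡ : proj₁ v ≡ unmarked B
      good  : ∀ k → Good k B → proj₂ v k ≡ S.tp m (induced occ k B)
  open Tracks

  Tracks-emb : ∀ {v B B′} → Emb B B′ → Tracks v B → Tracks v B′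
  Tracks-emb f t = record
    { type≡ = trans (type≡ t) (marked-emb f (λ _ → refl) (λ _ → refl))
    ; good = λ k g → trans (good t k (restrict 𝒮 her (fun f) (inj f) (dom-f (e k)) (lnk-f (e k)) g)) (S.tp-emb m (induced-emb occ k f)) }
    where
    e : ∀ k → Emb (induced all k _) (induced all k _)
    e k = induced-emb all k f

  exact : Str 1 (bit c) → Val
  exact B = unmarked B , λ k → S.tp m (induced occ k B)

  Tracks-exact : ∀ B → Tracks (exact B) B
  Tracks-exact B = record { type≡ = refl ; good = λ _ _ → refl }

  glueV : Glue 1 (bit c) (bit c) (bit c) → Val → Val → Val
  glueV G (q₁ , t₁) (q₂ , t₂) =
    join G q₁ q₂ , λ k → SC.comp m (inducedGlue occ G k q₁ q₂) (t₁ (ctx₁ G q₂ k)) (t₂ (ctx₂ G q₁ k))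

  -- If the whole is good in context `k`, both parts are good in their derived contexts by heredity,
  -- so that both values can be trusted.
  Tracks-glue : ∀ G {v w A B} → Tracks v A → Tracks w B → Tracks (glueV G v w) (glue G A B)
  Tracks-glue G {q₁ , t₁} {q₂ , t₂} {A} {B} s t = record
    { type≡ = trans (cong₂ (join G) (type≡ s) (type≡ t)) (sym (unmarked-glue G A B))
    ; good = λ k g → go (type≡ s) (type≡ t) k g }
    where
    go : q₁ ≡ unmarked A → q₂ ≡ unmarked B → ∀ k → Good k (glue G A B) →
         SC.comp m (inducedGlue occ G k q₁ q₂) (t₁ (ctx₁ G q₂ k)) (t₂ (ctx₂ G q₁ k)) ≡ S.tp m (induced occ k (glue G A B))
    go refl refl k g = begin
      SC.comp m H (t₁ (ctx₁ G q₂ k)) (t₂ (ctx₂ G q₁ k))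
        ≡⟨ cong₂ (SC.comp m H) (good s _ (realised-l G A B her all k g)) (good t _ (realised-u G A B her all k g)) ⟩
      SC.comp m H (S.tp m (induced occ (ctx₁ G q₂ k) A)) (S.tp m (induced occ (ctx₂ G q₁ k) B))
        ≡⟨ SC.tp-glue m H (induced occ (ctx₁ G q₂ k) A) (induced occ (ctx₂ G q₁ k) B) ⟨
      S.tp m (glue H (induced occ (ctx₁ G q₂ k) A) (induced occ (ctx₂ G q₁ k) B))
        ≡⟨ S.tp-emb m (induced-glue G A B occ k) ⟩
      S.tp m (induced occ k (glue G A B)) ∎
      where
      open ≡-Reasoning
      H = inducedGlue occ G k q₁ q₂

  infix 4 _≈ⱽ_
  _≈ⱽ_ : Val → Val → Set
  (q₁ , t₁) ≈ⱽ (q₂ , t₂) = q₁ ≡ q₂ × (∀ k → t₁ k ≡ t₂ k)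

  -- Contexts decoded from numbers agree with the original ones only pointwise, and values must not
  -- notice the difference.
  Extensional : Val → Set
  Extensional (q , t) = ∀ {k k′} → (∀ j a → k j a ≡ k′ j a) → t k ≡ t k′

  inducedGlue-≈ : ∀ G {k k′ : Context} q₁ q₂ → (∀ j a → k j a ≡ k′ j a) → inducedGlue occ G k q₁ q₂ ≈ᴳ inducedGlue occ G k′ q₁ q₂
  inducedGlue-≈ G q₁ q₂ e = record { m₁≈ = λ _ → refl ; m₂≈ = λ _ → refl
    ; x₁₂≈ = λ R _ _ → cong (occ R ∧_) (e (suc R) _) ; x₂₁≈ = λ R _ _ → cong (occ R ∧_) (e (suc R) _) }

  Extensional-glue : ∀ G {v w} → Extensional v → Extensional w → Extensional (glueV G v w)
  Extensional-glue G {q₁ , t₁} {q₂ , t₂} x y e = trans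
    (SC.comp-cong m (inducedGlue-≈ G q₁ q₂ e) _ _)
    (cong₂ (SC.comp m _) (x λ j a → e j _) (y λ j a → e j _))

  Extensional-exact : ∀ B → Extensional (exact B)
  Extensional-exact B e = S.tp-emb m (record
    { fun = id ; inj = id ; dom-f = λ x → cong (dom B x ∧_) (sym (e zero _)) ; cover = λ y _ → y , refl
    ; col-f = λ _ _ → refl ; lnk-f = λ R x y _ _ → cong (occ R ∧_) (sym (e (suc R) _)) })

  join-comm : ∀ a b → join disj a b ≡ join disj b a
  join-comm a b = trans (TC.comp-swap n (lift (lift disj)) a b) (TC.comp-cong n
    (record { m₁≈ = λ _ → refl ; m₂≈ = λ _ → refl ; x₁₂≈ = λ _ _ _ → refl ; x₂₁≈ = λ _ _ _ → refl }) b a)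

  -- Swapping the parts exchanges the derived contexts and the two roles in `inducedGlue`. By
  -- `join-comm` these agree, but only pointwise, hence the extensionality assumptions.
  glueV-comm : ∀ {v w} → Extensional v → Extensional w → glueV disj v w ≈ⱽ glueV disj w v
  glueV-comm {q₁ , t₁} {q₂ , t₂} x y = join-comm q₁ q₂ , λ k → begin
    SC.comp m (inducedGlue occ disj k q₁ q₂) (t₁ (ctx₁ disj q₂ k)) (t₂ (ctx₂ disj q₁ k))
      ≡⟨ cong₂ (SC.comp m (inducedGlue occ disj k q₁ q₂)) (x λ j a → cong (k j) (join-comm a q₂)) (y λ j a → cong (k j) (join-comm q₁ a)) ⟩
    SC.comp m (inducedGlue occ disj k q₁ q₂) (t₁ (ctx₂ disj q₂ k)) (t₂ (ctx₁ disj q₁ k))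
      ≡⟨ SC.comp-swap m (inducedGlue occ disj k q₁ q₂) _ _ ⟩
    SC.comp m (swap (inducedGlue occ disj k q₁ q₂)) (t₂ (ctx₁ disj q₁ k)) (t₁ (ctx₂ disj q₂ k))
      ≡⟨ SC.comp-cong m (swapped k) _ _ ⟩
    SC.comp m (inducedGlue occ disj k q₂ q₁) (t₂ (ctx₁ disj q₁ k)) (t₁ (ctx₂ disj q₂ k)) ∎
    where
    open ≡-Reasoning
    swapped : ∀ k → swap (inducedGlue occ disj k q₁ q₂) ≈ᴳ inducedGlue occ disj k q₂ q₁
    swapped k = record
      { m₁≈ = λ (a , b) → cong₂ (λ a b → T.Type.elt a , T.Type.elt b) (join-comm q₁ (T.type a)) (join-comm q₁ (T.type b))
      ; m₂≈ = λ (a , b) → cong₂ (λ a b → T.Type.elt a , T.Type.elt b) (join-comm (T.type a) q₂) (join-comm (T.type b) q₂)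
      ; x₁₂≈ = λ R (a , _) (_ , b) → cong (λ z → occ R ∧ k (suc R) z) (join-comm (T.type b) (T.type a))
      ; x₂₁≈ = λ R (a , _) (_ , b) → cong (λ z → occ R ∧ k (suc R) z) (join-comm (T.type a) (T.type b)) }

  module States {N : ℕ} (φ : Fin N → STy) (v₀ : Fin N)
    (complete : ∀ {A : Str r MarkPal} → Realised 𝒮 A → ∃ λ v → φ v ≡ S.tp m (masked occ A)) where

    MarkTypes : Pal
    MarkTypes = T.TyPal n (bit (bit (bit c)))

    ContextPal : Pal
    ContextPal = base (suc r) ⊗ MarkTypes

    #contexts : ℕ
    #contexts = 2 ^ ⟦ ContextPal ⟧

    encode : Context → Fin #contexts
    encode k = table ContextPal λ (j , a) → b2f (k j (T.type a))

    decode : Fin #contexts → Context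
    decode i j a = f2b (look ContextPal i (j , T.Type.elt a))

    decode-encode : ∀ k j a → decode (encode k) j a ≡ k j a
    decode-encode k j a = trans (cong f2b (look-table ContextPal (λ (j , a) → b2f (k j (T.type a))) (j , T.Type.elt a))) (f2b-b2f (k j a))

    encode-cong : ∀ {k k′ : Context} → (∀ j a → k j a ≡ k′ j a) → encode k ≡ encode k′
    encode-cong e = table-cong ContextPal λ (j , a) → cong b2f (e j (T.type a))

    StatePal : Pal
    StatePal = MarkTypes ⊗ base (N ^ #contexts)

    State : Set
    State = Fin ⟦ StatePal ⟧

    -- The default `v₀` is used only when no index fits, which cannot happen for a good context of a
    -- tracked structure.
    choose : STy → Fin N
    choose τ = fromMaybe v₀ (first λ v → φ v S.≡ᵀ τ)

    -- The compression on which the bound rests: for each context an index below `N` is stored in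
    -- place of a type.
    toState : Val → State
    toState (q , t) = enc StatePal (T.Type.elt q , funToFin (choose ∘ t ∘ decode))

    val : State → Val
    val s = T.type (proj₁ (dec StatePal s)) , λ k → φ (finToFun {N} {#contexts} (proj₂ (dec StatePal s)) (encode k))

    Extensional-val : ∀ s → Extensional (val s)
    Extensional-val s e = cong (λ i → φ (finToFun {N} {#contexts} (proj₂ (dec StatePal s)) i)) (encode-cong e)

    toState-cong : ∀ {v w} → v ≈ⱽ w → toState v ≡ toState w
    toState-cong {v} {w} (e , f) = cong₂ (λ q g → enc StatePal (T.Type.elt q , g)) e
      (funToFin-cong {f = choose ∘ proj₂ v ∘ decode} {choose ∘ proj₂ w ∘ decode} λ i → cong choose (f (decode i)))

    Tracks-toState : ∀ {v B} → Extensional v → Tracks v B → Tracks (val (toState v)) B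
    Tracks-toState {q , t} {B} x tr = record
      { type≡ = trans (cong (λ z → T.type (proj₁ z)) (dec-enc StatePal (T.Type.elt q , funToFin (choose ∘ t ∘ decode)))) (type≡ tr)
      ; good = λ k g → trans (value k) (trans (chosen k g) (good tr k g)) }
      where
      value : ∀ k → proj₂ (val (toState (q , t))) k ≡ φ (choose (t (decode (encode k))))
      value k = trans (cong (λ z → φ (finToFun {N} {#contexts} (proj₂ z) (encode k))) (dec-enc StatePal (T.Type.elt q , funToFin (choose ∘ t ∘ decode))))
        (cong φ (finToFun-funToFin (choose ∘ t ∘ decode) (encode k)))
      chosen : ∀ k → Good k B → φ (choose (t (decode (encode k)))) ≡ t k
      chosen k g = trans (cong (φ ∘ choose) (x (decode-encode k))) (go (complete g))
        where
        go : (∃ λ v → φ v ≡ S.tp m (masked occ (induced all k B))) → φ (choose (t k)) ≡ t k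
        go (v , e) = S.≡ᵀ-sound (first-sound (λ v → φ v S.≡ᵀ t k) v₀ {v} (S.≡ᵀ-complete (trans e (sym (good tr k g)))))

    -- Longer lists of children do not occur in binary trees.
    forestV : List State → Val
    forestV []               = exact ∅
    forestV (s ∷ [])         = val s
    forestV (s ∷ s′ ∷ [])    = glueV disj (val s) (val s′)
    forestV (_ ∷ _ ∷ _ ∷ _)  = exact ∅

    nodeV : Lab L → Val → Val
    nodeV l v = glueV rootGlue (exact (point (colour l))) v

    transition : Lab L → List State → State
    transition l ss = toState (nodeV l (forestV ss))

    Extensional-forest : ∀ ss → Extensional (forestV ss)
    Extensional-forest []              = Extensional-exact ∅
    Extensional-forest (s ∷ [])        = Extensional-val s
    Extensional-forest (s ∷ s′ ∷ [])   = Extensional-glue disj {val s} {val s′} (Extensional-val s) (Extensional-val s′)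
    Extensional-forest (_ ∷ _ ∷ _ ∷ _) = Extensional-exact ∅

    Extensional-node : ∀ l {v} → Extensional v → Extensional (nodeV l v)
    Extensional-node l {v} x = Extensional-glue rootGlue {exact (point (colour l))} {v} (Extensional-exact (point (colour l))) x

    nodeV-cong : ∀ l {v w} → v ≈ⱽ w → nodeV l v ≈ⱽ nodeV l w
    nodeV-cong l {q , t} {.q , u} (refl , f) = refl , λ k → cong (SC.comp m _ _) (f _)

    forestV-↭ : ∀ xs ys → xs ↭ ys → forestV xs ≈ⱽ forestV ys
    forestV-↭ [] ys p with ↭-empty-inv (↭.↭-sym p)
    ... | refl = refl , λ _ → refl
    forestV-↭ (x ∷ []) ys p with ↭-singleton-inv (↭.↭-sym p)
    ... | refl = refl , λ _ → refl
    forestV-↭ (x ∷ x′ ∷ []) [] p with () ← ↭-length p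
    forestV-↭ (x ∷ x′ ∷ []) (_ ∷ []) p with () ← ↭-length p
    forestV-↭ (x ∷ x′ ∷ []) (_ ∷ _ ∷ _ ∷ _) p with () ← ↭-length p
    forestV-↭ (x ∷ x′ ∷ []) (y ∷ y′ ∷ []) p with ∈-resp-↭ p (here refl)
    ... | here refl with ↭-singleton-inv (↭.↭-sym (drop-∷ p))
    ...   | refl = refl , λ _ → refl
    forestV-↭ (x ∷ x′ ∷ []) (y ∷ y′ ∷ []) p | there (here refl)
      with ↭-singleton-inv (↭.↭-sym (drop-∷ (↭.↭-trans p (↭.swap y x ↭.refl))))
    ...   | refl = glueV-comm {val x} {val y} (Extensional-val x) (Extensional-val y)
    forestV-↭ (x ∷ x′ ∷ x″ ∷ xs) [] p with () ← ↭-length p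
    forestV-↭ (x ∷ x′ ∷ x″ ∷ xs) (_ ∷ []) p with () ← ↭-length p
    forestV-↭ (x ∷ x′ ∷ x″ ∷ xs) (_ ∷ _ ∷ []) p with () ← ↭-length p
    forestV-↭ (x ∷ x′ ∷ x″ ∷ xs) (_ ∷ _ ∷ _ ∷ _) p = refl , λ _ → refl

    automaton : (STy → Bool) → Context → DTA L
    automaton accept top = record
      { states = ⟦ StatePal ⟧
      ; δ = transition
      ; acc = λ s → accept (proj₂ (val s) top)
      ; δ-perm = λ l xs ys p → toState-cong {nodeV l (forestV xs)} {nodeV l (forestV ys)}
          (nodeV-cong l {forestV xs} {forestV ys} (forestV-↭ xs ys p)) }

    module _ (accept : STy → Bool) (top : Context) where
      private
        𝒜 = automaton accept top

      mutual
        -- The run knows no preorder numbers; `i` may be arbitrary because the colours depend on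
        -- labels only.
        run-tracks : ∀ t i → IsBinary t → Tracks (val (run 𝒜 t)) (treeS t i)
        run-tracks (node l ts) i (le , bin) = Tracks-toState {nodeV l (forestV (runL 𝒜 ts))} {treeS (node l ts) i}
          (Extensional-node l {forestV (runL 𝒜 ts)} (Extensional-forest (runL 𝒜 ts)))
          (Tracks-glue rootGlue {exact (point (colour l))} {forestV (runL 𝒜 ts)} {point (colour l)} {forestS ts (suc i)}
            (Tracks-exact (point (colour l))) (runL-tracks ts (suc i) le bin))

        runL-tracks : ∀ ts j → length ts ≤ 2 → AllBinary ts → Tracks (forestV (runL 𝒜 ts)) (forestS ts j)
        runL-tracks [] j le bin = Tracks-exact ∅
        -- `recolour id` changes nothing and `recolourGlue id` is `disj`, both by definition: the
        -- forest is the tree glued with `∅`.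
        runL-tracks (t ∷ []) j le (bin , _) = Tracks-emb {val (run 𝒜 t)} (recolour-emb id (treeS t j)) (run-tracks t j bin)
        runL-tracks (t ∷ t′ ∷ []) j le (bin , bin′ , _) =
          Tracks-emb {forestV (run 𝒜 t ∷ run 𝒜 t′ ∷ [])} (glue-embʳ disj (treeS t j) (recolour-emb id (treeS t′ j′)))
            (Tracks-glue disj {val (run 𝒜 t)} {val (run 𝒜 t′)} {treeS t j} {treeS t′ j′} (run-tracks t j bin) (run-tracks t′ j′ bin′))
          where
          j′ = j + car (treeS t j)
        runL-tracks (_ ∷ _ ∷ _ ∷ _) j (s≤s (s≤s ())) bin

-- The number of states

module _ where
  open import Data.Nat.Properties

  tow-mono : ∀ i {x y} → x ≤ y → tow i x ≤ tow i y
  tow-mono zero    le = le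
  tow-mono (suc i) le = ^-monoʳ-≤ 2 (tow-mono i le)

  n<2^n : ∀ n → n < 2 ^ n
  n<2^n zero    = s≤s z≤n
  n<2^n (suc n) = begin
    suc (suc n)       ≤⟨ s≤s (n<2^n n) ⟩
    1 + 2 ^ n         ≤⟨ +-monoˡ-≤ (2 ^ n) (≤-trans (s≤s z≤n) (n<2^n n)) ⟩
    2 ^ n + 2 ^ n     ≡⟨ cong (2 ^ n +_) (+-identityʳ (2 ^ n)) ⟨
    2 * 2 ^ n         ∎
    where open ≤-Reasoning

  n≤2^n : ∀ n → n ≤ 2 ^ n
  n≤2^n n = <⇒≤ (n<2^n n)

  1≤2^ : ∀ n → 1 ≤ 2 ^ n
  1≤2^ n = ≤-trans (s≤s z≤n) (n<2^n n)

  *-2^ : ∀ {x y} a b → x ≤ 2 ^ a → y ≤ 2 ^ b → x * y ≤ 2 ^ (a + b)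
  *-2^ a b le le′ = ≤-trans (*-mono-≤ le le′) (≤-reflexive (sym (^-distribˡ-+-* 2 a b)))

  ^-2^ : ∀ {x} a {k m} → x ≤ 2 ^ a → k ≤ m → x ^ k ≤ 2 ^ (a * m)
  ^-2^ {x} a {k} {m} le le′ = begin
    x ^ k         ≤⟨ ^-monoˡ-≤ k le ⟩
    (2 ^ a) ^ k   ≡⟨ ^-*-assoc 2 a k ⟩
    2 ^ (a * k)   ≤⟨ ^-monoʳ-≤ 2 (*-monoʳ-≤ a le′) ⟩
    2 ^ (a * m)   ∎
    where open ≤-Reasoning

  +-2^ : ∀ {x y} a → x ≤ 2 ^ a → y ≤ 2 ^ a → x + y ≤ 2 ^ suc a
  +-2^ a le le′ = ≤-trans (+-mono-≤ le le′) (≤-reflexive (cong (2 ^ a +_) (sym (+-identityʳ (2 ^ a)))))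

  module Bounds (M : ℕ) .{{_ : NonZero M}} where
    open Monoid 1 M using (θ)

    -- A round multiplies `θ w n + M` by at most `1 + w`, since one further copy of it absorbs the
    -- summand `2 + M`.
    θ-bound : ∀ w W n → w ≤ 2 ^ W → θ w n + M ≤ 2 ^ (suc W * n + suc M)
    θ-bound w W zero le = begin
      2 + M                   ≤⟨ n<2^n (suc M) ⟩
      2 ^ suc M               ≡⟨ cong (λ z → 2 ^ (z + suc M)) (*-zeroʳ (suc W)) ⟨
      2 ^ (suc W * 0 + suc M) ∎
      where open ≤-Reasoning
    θ-bound w W (suc n) le = begin
      2 + w * X + M                    ≡⟨ solve 3 (λ w x m → con 2 :+ w :* x :+ m := (con 2 :+ m) :+ w :* x) refl w X M ⟩
      2 + M + w * X                    ≤⟨ +-monoˡ-≤ (w * X) (+-monoˡ-≤ M (2≤θ′ w n)) ⟩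
      X + w * X                        ≤⟨ *-2^ (suc W) (suc W * n + suc M) (+-2^ W (1≤2^ W) le) (θ-bound w W n le) ⟩
      2 ^ (suc W + (suc W * n + suc M)) ≡⟨ cong (2 ^_) (solve 3 (λ w n m → (con 1 :+ w) :+ ((con 1 :+ w) :* n :+ (con 1 :+ m)) :=
                                                     (con 1 :+ w) :* (con 1 :+ n) :+ (con 1 :+ m)) refl W n M) ⟩
      2 ^ (suc W * suc n + suc M)      ∎
      where
      open ≤-Reasoning
      open +-*-Solver
      X = θ w n + M
      2≤θ′ : ∀ w n → 2 ≤ θ w n
      2≤θ′ = Monoid.2≤θ 1 M

    module _ (n λ′ : ℕ) (extra : ℕ) where

      -- In the exponent within `next`, `n + 2` is the slope in `Z` and `γ` the constant part. `α`
      -- enlarges the slope by the room for the final power, `2 * σ` pays for the constant factors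
      -- in `next-bound`, and `a₀` is `α * Z + β` at height 0.
      γ α σ β a₀ : ℕ
      γ = n + M + 1
      α = n + 2 + extra
      σ = α + λ′ + γ + 2
      β = γ + 2 * σ
      a₀ = α * (λ′ + 2) + β

      -- If counts and widths are at most `2 ^ Z`, those one level higher are at most `2 ^ next Z`:
      -- one `Z` is for the number of subtrees, one for their width, the bracket for the
      -- multiplicities.
      next : ℕ → ℕ
      next Z = λ′ + 2 + 2 ^ (2 * Z + (suc Z * n + suc M))

      -- The affine function with coefficients `α` and `β` absorbs a step of the recursion, so that
      -- a level costs no more than one exponential.
      next-bound : ∀ Z → α * next Z + β ≤ 2 ^ (α * Z + β)
      next-bound Z = begin
        α * (λ′ + 2 + 2 ^ e) + β                   ≡⟨ solve 4 (λ a l x b → a :* (l :+ con 2 :+ x) :+ b := a :* (l :+ con 2) :+ b :+ a :* x) refl α λ′ (2 ^ e) β ⟩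
        α * (λ′ + 2) + β + α * 2 ^ e               ≤⟨ +-monoˡ-≤ (α * 2 ^ e) (m≤m*n (α * (λ′ + 2) + β) (2 ^ e) {{>-nonZero (1≤2^ e)}}) ⟩
        (α * (λ′ + 2) + β) * 2 ^ e + α * 2 ^ e     ≡⟨ *-distribʳ-+ (2 ^ e) (α * (λ′ + 2) + β) α ⟨
        (α * (λ′ + 2) + β + α) * 2 ^ e             ≤⟨ *-2^ (2 * σ) e small ≤-refl ⟩
        2 ^ (2 * σ + e)                            ≤⟨ ^-monoʳ-≤ 2 exponents ⟩
        2 ^ (α * Z + β)                            ∎
        where
        open ≤-Reasoning
        open +-*-Solver
        e = 2 * Z + (suc Z * n + suc M)
        small : α * (λ′ + 2) + β + α ≤ 2 ^ (2 * σ)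
        small = begin
          α * (λ′ + 2) + (γ + 2 * σ) + α  ≡⟨ solve 4 (λ a l g s → a :* (l :+ con 2) :+ (g :+ con 2 :* s) :+ a := a :* (l :+ con 3) :+ (g :+ (s :+ s))) refl α λ′ γ σ ⟩
          α * (λ′ + 3) + (γ + (σ + σ))    ≤⟨ +-mono-≤ product (+-monoˡ-≤ (σ + σ) γ≤σ) ⟩
          2 ^ σ + (σ + (σ + σ))           ≤⟨ +-monoʳ-≤ (2 ^ σ) (+-mono-≤ (n≤2^n σ) (+-mono-≤ (n≤2^n σ) (n≤2^n σ))) ⟩
          2 ^ σ + (2 ^ σ + (2 ^ σ + 2 ^ σ)) ≡⟨ solve 1 (λ x → x :+ (x :+ (x :+ x)) := con 4 :* x) refl (2 ^ σ) ⟩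
          4 * 2 ^ σ                       ≤⟨ *-monoˡ-≤ (2 ^ σ) (^-monoʳ-≤ 2 {2} {σ} (m≤n+m 2 (α + λ′ + γ))) ⟩
          2 ^ σ * 2 ^ σ                   ≡⟨ ^-distribˡ-+-* 2 σ σ ⟨
          2 ^ (σ + σ)                     ≡⟨ cong (λ z → 2 ^ (σ + z)) (+-identityʳ σ) ⟨
          2 ^ (2 * σ)                     ∎
          where
          γ≤σ : γ ≤ σ
          γ≤σ = ≤-trans (m≤n+m γ (α + λ′)) (m≤m+n (α + λ′ + γ) 2)
          product : α * (λ′ + 3) ≤ 2 ^ σ
          product = ≤-trans (*-2^ α (λ′ + 2) (n≤2^n α) (≤-trans (≤-reflexive (+-suc λ′ 2)) (n<2^n (λ′ + 2))))
            (^-monoʳ-≤ 2 (≤-trans (m≤m+n (α + (λ′ + 2)) γ)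
              (≤-reflexive (solve 3 (λ a l g → a :+ (l :+ con 2) :+ g := a :+ l :+ g :+ con 2) refl α λ′ γ))))
        exponents : 2 * σ + e ≤ α * Z + β
        exponents = begin
          2 * σ + (2 * Z + (suc Z * n + suc M)) ≡⟨ solve 4 (λ s z n m → con 2 :* s :+ (con 2 :* z :+ ((con 1 :+ z) :* n :+ (con 1 :+ m))) :=
                                                       (n :+ con 2) :* z :+ ((n :+ m :+ con 1) :+ con 2 :* s)) refl σ Z n M ⟩
          (n + 2) * Z + β                       ≤⟨ +-monoˡ-≤ β (*-monoˡ-≤ Z (m≤m+n (n + 2) extra)) ⟩
          α * Z + β                             ∎

      exponent : ℕ → ℕ
      exponent zero    = λ′ + 2
      exponent (suc h) = next (exponent h)

      exponent-bound : ∀ h → α * exponent h + β ≤ tow h a₀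
      exponent-bound zero    = ≤-refl
      exponent-bound (suc h) = ≤-trans (next-bound (exponent h)) (^-monoʳ-≤ 2 (exponent-bound h))

      module _ (c : Pal) (small : ⟦ c ⟧ ≤ 2 ^ λ′) where
        open Representatives M n c

        -- A joint induction: the count of the next level uses the width through `bound h`, and the
        -- width of the next level has the count as an exponent.
        reps-bound : ∀ h → #reps h ≤ 2 ^ exponent h × width h ≤ 2 ^ exponent h
        reps-bound zero = ≤-trans small (^-monoʳ-≤ 2 (m≤m+n λ′ 2)) , ^-monoʳ-≤ 2 {2} (m≤n+m 2 λ′)
        reps-bound (suc h) = counts , widths
          where
          open ≤-Reasoning
          open +-*-Solver
          Z = exponent h
          b = suc Z * n + suc M
          N≤ = proj₁ (reps-bound h)
          w≤ = proj₂ (reps-bound h)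
          B≤ : bound h ≤ 2 ^ b
          B≤ = θ-bound (width h) Z n w≤
          counts : #reps (suc h) ≤ 2 ^ next Z
          counts = ≤-trans (*-2^ λ′ (b * 2 ^ Z) small (^-2^ b B≤ N≤)) (^-monoʳ-≤ 2 (begin
            λ′ + b * 2 ^ Z                ≤⟨ +-monoʳ-≤ λ′ (*-2^ b Z (n≤2^n b) ≤-refl) ⟩
            λ′ + 2 ^ (b + Z)              ≤⟨ +-mono-≤ (m≤m+n λ′ 2) (^-monoʳ-≤ 2 (≤-trans (m≤m+n (b + Z) Z)
                                               (≤-reflexive (solve 2 (λ b z → b :+ z :+ z := con 2 :* z :+ b) refl b Z)))) ⟩
            λ′ + 2 + 2 ^ (2 * Z + b)      ∎))
          tree≤ : width h ^ bound h * 2 ≤ 2 ^ (Z * 2 ^ b + 1)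
          tree≤ = *-2^ (Z * 2 ^ b) 1 (^-2^ Z w≤ B≤) ≤-refl
          widths : width (suc h) ≤ 2 ^ next Z
          widths = ≤-trans (*-2^ 1 ((Z * 2 ^ b + 1) * 2 ^ Z + 1) ≤-refl
                            (*-2^ ((Z * 2 ^ b + 1) * 2 ^ Z) 1 (^-2^ (Z * 2 ^ b + 1) tree≤ N≤) ≤-refl)) (^-monoʳ-≤ 2 (begin
            1 + ((Z * 2 ^ b + 1) * 2 ^ Z + 1)   ≡⟨ solve 1 (λ x → con 1 :+ (x :+ con 1) := con 2 :+ x) refl ((Z * 2 ^ b + 1) * 2 ^ Z) ⟩
            2 + (Z * 2 ^ b + 1) * 2 ^ Z         ≤⟨ +-monoʳ-≤ 2 (*-monoˡ-≤ (2 ^ Z) inner) ⟩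
            2 + 2 ^ (Z + b) * 2 ^ Z             ≡⟨ cong (2 +_) (^-distribˡ-+-* 2 (Z + b) Z) ⟨
            2 + 2 ^ (Z + b + Z)                 ≤⟨ +-mono-≤ (m≤n+m 2 λ′) (≤-reflexive (cong (2 ^_) (solve 2 (λ b z → z :+ b :+ z := con 2 :* z :+ b) refl b Z))) ⟩
            λ′ + 2 + 2 ^ (2 * Z + b)            ∎))
            where
            inner : Z * 2 ^ b + 1 ≤ 2 ^ (Z + b)
            inner = begin
              Z * 2 ^ b + 1       ≤⟨ +-monoʳ-≤ (Z * 2 ^ b) (1≤2^ b) ⟩
              Z * 2 ^ b + 2 ^ b   ≡⟨ +-comm (Z * 2 ^ b) (2 ^ b) ⟩
              suc Z * 2 ^ b       ≤⟨ *-2^ Z b (n<2^n Z) ≤-refl ⟩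
              2 ^ (Z + b)         ∎

        -- A state is one of `Q` types together with `C` indices of representatives; `extra` in the
        -- slope `α` reserves the room for both.
        states-bound : ∀ h Q C → Q + C ≤ extra → Q * #reps h ^ C ≤ tow (suc h) a₀
        states-bound h Q C le = ≤-trans (*-2^ Q (exponent h * C) (n≤2^n Q) (^-2^ (exponent h) (proj₁ (reps-bound h)) (≤-refl {C})))
          (^-monoʳ-≤ 2 (≤-trans (begin
            Q + exponent h * C          ≡⟨ trans (+-comm Q _) (cong (_+ Q) (*-comm (exponent h) C)) ⟩
            C * exponent h + Q          ≤⟨ +-mono-≤ (*-monoˡ-≤ (exponent h) (≤-trans (m≤n+m C Q) (≤-trans le (m≤n+m extra (n + 2)))))
                                            (≤-trans (m≤m+n Q C) (≤-trans le (≤-trans (m≤n+m extra (n + 2)) α≤β))) ⟩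
            α * exponent h + β          ∎) (exponent-bound h)))
          where
          open ≤-Reasoning
          α≤β : α ≤ β
          α≤β = ≤-trans (≤-trans (m≤m+n α λ′) (≤-trans (m≤m+n (α + λ′) γ) (≤-trans (m≤m+n (α + λ′ + γ) 2) (m≤m+n σ (σ + 0))))) (m≤n+m (2 * σ) γ)

    -- n and λ′ as they arise for a formula of length l and Q marked types.
    a₀-bound : ∀ l Q C → a₀ (l + suc (suc l)) (l + (Q + Q)) (Q + C) ≤ (7 * (M + l + (Q + C + 1))) ^ 2
    a₀-bound l Q C = begin
      a₀ n λ′ (Q + C)                                          ≡⟨ solve 3 (λ a l g → a :* (l :+ con 2) :+ (g :+ con 2 :* (a :+ l :+ g :+ con 2)) :=
                                                                     a :* (l :+ con 4) :+ (con 2 :* l :+ con 3 :* g :+ con 4)) refl α′ λ′ γ′ ⟩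
      α′ * (λ′ + 4) + (2 * λ′ + 3 * γ′ + 4)                    ≤⟨ +-mono-≤ (*-mono-≤ α≤ λ≤) rest≤ ⟩
      5 * Y * (6 * Y) + 19 * Y                                 ≤⟨ +-monoʳ-≤ (5 * Y * (6 * Y)) (*-monoʳ-≤ 19 (m≤m*n Y Y {{>-nonZero 1≤Y}})) ⟩
      5 * Y * (6 * Y) + 19 * (Y * Y)                           ≡⟨ solve 1 (λ y → con 5 :* y :* (con 6 :* y) :+ con 19 :* (y :* y) := (con 7 :* y) :* ((con 7 :* y) :* con 1)) refl Y ⟩
      (7 * Y) ^ 2                                              ∎
      where
      open ≤-Reasoning
      open +-*-Solver
      n = l + suc (suc l)
      λ′ = l + (Q + Q)
      α′ = n + 2 + (Q + C)
      γ′ = n + M + 1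
      Y = M + l + (Q + C + 1)
      1≤Y : 1 ≤ Y
      1≤Y = ≤-trans (m≤n+m 1 (Q + C)) (m≤n+m (Q + C + 1) (M + l))
      α≤ : α′ ≤ 5 * Y
      α≤ = ≤-trans (m≤m+n α′ (5 * M + 3 * l + 4 * Q + 4 * C + 1)) (≤-reflexive
        (solve 4 (λ m l q c → l :+ (con 2 :+ l) :+ con 2 :+ (q :+ c) :+ (con 5 :* m :+ con 3 :* l :+ con 4 :* q :+ con 4 :* c :+ con 1)
                             := con 5 :* (m :+ l :+ (q :+ c :+ con 1))) refl M l Q C))
      λ≤ : λ′ + 4 ≤ 6 * Y
      λ≤ = ≤-trans (m≤m+n (λ′ + 4) (6 * M + 5 * l + 4 * Q + 6 * C + 2)) (≤-reflexive
        (solve 4 (λ m l q c → l :+ (q :+ q) :+ con 4 :+ (con 6 :* m :+ con 5 :* l :+ con 4 :* q :+ con 6 :* c :+ con 2)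
                             := con 6 :* (m :+ l :+ (q :+ c :+ con 1))) refl M l Q C))
      rest≤ : 2 * λ′ + 3 * γ′ + 4 ≤ 19 * Y
      rest≤ = ≤-trans (m≤m+n (2 * λ′ + 3 * γ′ + 4) (16 * M + 11 * l + 15 * Q + 19 * C + 6)) (≤-reflexive
        (solve 4 (λ m l q c → con 2 :* (l :+ (q :+ q)) :+ con 3 :* (l :+ (con 2 :+ l) :+ m :+ con 1) :+ con 4
                               :+ (con 16 :* m :+ con 11 :* l :+ con 15 :* q :+ con 19 :* c :+ con 6)
                             := con 19 :* (m :+ l :+ (q :+ c :+ con 1))) refl M l Q C))

-- Proof of the theorem

module Outer {r L : ℕ} (I : Interp (BinVoc r) (TreeVoc L)) (M₁ n₁ : ℕ) .{{_ : NonZero M₁}} where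

  open TreeFormulas (allFin L) (base 1) public
  open Evaluation 1 M₁
  open TreeStructure {L} {ColPal} (λ l _ → code l , zero) public
  open Induced r M₁ n₁ (bit ColPal) public
  private
    module T = Types 1 M₁

  -- `ν` is read on types with two marks of which the second is empty, so that contexts treat domain
  -- and relations alike.
  firstMark : Fin 1 → El (bit (bit (bit ColPal))) → Bool
  firstMark _ = up {bit (bit ColPal)} (new {bit ColPal})

  trν : F 1 (bit (bit (bit ColPal)))
  trν = tr {p = bit (bit (bit ColPal))} (proj₂ ∘ proj₂) firstMark fin0 (ν I)

  -- For the whole tree there is no outside: the formulas of `I` themselves decide acceptance.
  top : Context
  top zero    a = evalT trν a
  top (suc R) a = evalT (tr₂ (η I R)) a

  #marks : ℕ
  #marks = ⟦ T.TyPal n₁ (bit (bit (bit ColPal))) ⟧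

  #ctx : ℕ
  #ctx = 2 ^ (suc r * #marks)

  all : Fin r → Bool
  all _ = true

  module _ (within-ν : Within (UsesOnly (allFin L)) M₁ n₁ (ν I)) (within-η : ∀ R → Within (UsesOnly (allFin L)) M₁ n₁ (η I R))
           {𝒮 : Structure (BinVoc r) → Set} (T : Tree L) (C : Structure (BinVoc r)) (C∈𝒮 : 𝒮 C) (i : IsInterpretedBy I (treeStr T) C) where

    private
      f = proj₁ i
      k : ℕ → Fin 1
      k _ = zero

    env : ∀ x → Env M₁ k T {p = bit (bit (bit ColPal))} (proj₂ ∘ proj₂) firstMark fin0
                    (λ z → none {car (nodeS T)} z , ((x ≡ᶠ z) , col (nodeS T) z)) (λ _ → x) fin0
    env x = record { base≡ = λ _ → refl ; singles = λ _ _ → refl ; sets = λ () }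

    realised-nodes : Realised 𝒮 (induced all top (nodeS T))
    realised-nodes = record
      { C = C ; C∈𝒮 = C∈𝒮 ; place = f ; inj′ = proj₁ (proj₂ i)
      ; inside = λ x → Sat⇒eval M₁ k T (atomCorrect M₁ k T) n₁ (ν I) within-ν (env (f x)) (proj₁ (proj₂ (proj₂ i)) x)
      ; onto = λ y e → proj₁ (proj₂ (proj₂ (proj₂ i))) y (eval⇒Sat M₁ k T (atomCorrect M₁ k T) n₁ (ν I) within-ν (env y) e)
      ; rels = λ R x y → ⇔→≡
          (λ e → Equivalence.from (tr₂-correct M₁ n₁ k T (η I R) (within-η R) (f x) (f y))
                   (Equivalence.to (proj₂ (proj₂ (proj₂ (proj₂ i))) R (x ∷ y ∷ [])) e))
          (λ e → Equivalence.from (proj₂ (proj₂ (proj₂ (proj₂ i))) R (x ∷ y ∷ []))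
                   (Equivalence.to (tr₂-correct M₁ n₁ k T (η I R) (within-η R) (f x) (f y)) e)) }

    realised-tree : Realised 𝒮 (induced all top (treeS T 0))
    realised-tree = realised-emb 𝒮 (induced-emb all top (nodeS-emb T)) realised-nodes

binaryAtom : ∀ {r p₀ p} → (El p → El p₀) → (R : Fin r) → Vec (El p → Bool) 2 → F r p
binaryAtom π R (P ∷ Q ∷ []) = rel′ R P Q

module Sentence {r : ℕ} (M m : ℕ) .{{_ : NonZero M}} (s : Pal) where
  open Types r M
  open Evaluation r M
  open Translation {BinVoc r} r s (λ {p} → binaryAtom {r} {s} {p})

  accept : Form (BinVoc r) 0 0 → Type m s → Bool
  accept ψ = evalT (tr {p = s} id fin0 fin0 ψ)

  module _ (ψ : Form (BinVoc r) 0 0) (within-ψ : Within (λ R → mentions ψ R ≡ true) M m ψ)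
           {𝒮 : Structure (BinVoc r) → Set} {A : Str r s} (real : Realised 𝒮 A) where
    open Realised real
    private
      B = realiser (mentions ψ) real

    open Correct M C (col B) (lnk B) (λ R → mentions ψ R ≡ true)

    atomCorrect : AtomCorrect
    atomCorrect R o n π c e (P ∷ Q ∷ []) (x ∷ y ∷ []) sg = ⇔→≡
      (λ v → to (evalT-rel-elim n (coloured c) R P Q v))
      (λ v → evalT-rel-intro n (coloured c) R P Q x y refl refl (trans (sg zero x) (≡ᶠ-refl x)) (trans (sg (suc zero) y) (≡ᶠ-refl y)) (∧-intro o v))
      where
      to : (∃ λ x′ → ∃ λ y′ → true ≡ true × true ≡ true × P (c x′) ≡ true × Q (c y′) ≡ true × mentions ψ R ∧ rel C R (x′ ∷ y′ ∷ []) ≡ true) →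
           rel C R (x ∷ y ∷ []) ≡ true
      to (x′ , y′ , _ , _ , p , q , l) = subst₂ (λ u v → rel C R (u ∷ v ∷ []) ≡ true)
        (sym (≡ᶠ-sound (trans (sym (sg zero x′)) p))) (sym (≡ᶠ-sound (trans (sym (sg (suc zero) y′)) q)))
        (proj₂ (∧-elim {mentions ψ R} l))

    env : Env {p = s} id fin0 fin0 (col B) fin0 fin0
    env = record { base≡ = λ _ → refl ; singles = λ () ; sets = λ () }

    accept-correct : (accept ψ (tp m (masked (mentions ψ) A)) ≡ true) ⇔ (C ⊨ ψ)
    accept-correct = mk⇔
      (λ e → eval⇒Sat atomCorrect m ψ within-ψ env (trans (cong (accept ψ) emb) e))
      (λ t → trans (cong (accept ψ) (sym emb)) (Sat⇒eval atomCorrect m ψ within-ψ env t))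
      where
      emb : tp m B ≡ tp m (masked (mentions ψ) A)
      emb = tp-emb m (realiser-emb (mentions ψ) real)

module Assembly {r L L′ : ℕ} {𝒮 : Structure (BinVoc r) → Set} (her : Hereditary 𝒮)
  (I : Interp (BinVoc r) (TreeVoc L)) (M₁ n₁ : ℕ) .{{_ : NonZero M₁}}
  (within-νI : Within (UsesOnly (allFin L)) M₁ n₁ (ν I)) (within-ηI : ∀ R → Within (UsesOnly (allFin L)) M₁ n₁ (η I R))
  (ψ : Form (BinVoc r) 0 0) (h : ℕ) (𝒰 : Tree L′ → Set) (height≤h : ∀ T → 𝒰 T → height T ≤ h)
  (J : Interp (BinVoc r) (TreeVoc L′)) (classJ : ∀ C → 𝒮 C → Σ _ λ U → 𝒰 U × IsInterpretedBy J (treeStr U) C)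
  (ls : List (Fin L′)) (M m : ℕ) .{{_ : NonZero M}}
  (within-νJ : Within (UsesOnly ls) M m (ν J)) (within-ηJ : ∀ R → mentions ψ R ≡ true → Within (UsesOnly ls) M m (η J R))
  (within-ψ : Within (λ R → mentions ψ R ≡ true) M m ψ) where

  open Outer I M₁ n₁ using (ColPal; code; MarkPal; top; treeS; unmarked; induced; #marks; #ctx; realised-tree)
  open Covering ls MarkPal M J (mentions ψ) m m within-νJ within-ηJ using (rounds; interpreted; covered-type)
  private
    module J′ = TreeFormulas ls MarkPal
    module T = Types 1 M₁
    module S = Types r M
  open Representatives M rounds J′.ColPal using (#reps; rep; rep-complete; TreeType; nodeType)

  default : El MarkPal
  default = T.Type.elt (unmarked ∅) , T.Type.elt (unmarked ∅)

  -- The table of a state needs an index even where no type fits; a tree with a single node supplies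
  -- one.
  v₀ : Fin (#reps h)
  v₀ = proj₁ (rep-complete h (proj₂ (someTree h)))
    where
    κ : El J′.ColPal
    κ = J′.code (λ _ → false) , default
    someTree : ∀ h → ∃ λ τ → TreeType h τ
    someTree zero    = _ , κ , refl
    someTree (suc h) = _ , κ , [] , [] , refl

  open Automaton her ColPal (λ l → code l , zero) M₁ n₁ (mentions ψ) M m using (Tracks; module States)
  open States (λ v → S.tp m (interpreted (rep h v))) v₀ (covered-type {𝒮} {𝒰} {h} height≤h classJ default)
    using (automaton; val; run-tracks)
  open Sentence {r} M m MarkPal

  𝒜 : DTA L
  𝒜 = automaton (accept ψ) top

  accepts : ∀ T → IsBinary T → ∀ C → 𝒮 C → IsInterpretedBy I (treeStr T) C → Accepts 𝒜 T ⇔ (treeStr T ⊨ translate I ψ)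
  accepts T bin C C∈𝒮 i = mk⇔
    (λ e → Sat⇒translate I {treeStr T} {C} i ψ related (Equivalence.to correct (trans (cong (accept ψ) (sym type≡)) e)))
    (λ t → trans (cong (accept ψ) type≡) (Equivalence.from correct (translate⇒Sat I {treeStr T} {C} i ψ related t)))
    where
    real : Realised 𝒮 (induced (λ _ → true) top (treeS T 0))
    real = realised-tree within-νI within-ηI T C C∈𝒮 i
    type≡ : proj₂ (val (run 𝒜 T)) top ≡ S.tp m (induced (mentions ψ) top (treeS T 0))
    type≡ = Tracks.good (run-tracks (accept ψ) top T 0 bin) top real
    correct : (accept ψ (S.tp m (induced (mentions ψ) top (treeS T 0))) ≡ true) ⇔ (C ⊨ ψ)
    correct = accept-correct ψ within-ψ real
    related : Related I {treeStr T} {C} i fin0 fin0 fin0 fin0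
    related = record { elements = λ () ; sets = λ () ; covered = λ () }

  -- A colour of an inner tree consists of the labels in `ls` and two marked types of the outer
  -- tree, whose number is a constant of `I`.
  palette-bound : ⟦ J′.ColPal ⟧ ≤ 2 ^ (length ls + (#marks + #marks))
  palette-bound = *-2^ (length ls) (#marks + #marks) ℕ.≤-refl (*-2^ #marks #marks (n≤2^n #marks) (n≤2^n #marks))

  few-states : length ls ≤ m → states 𝒜 ≤ tow (suc h) ((7 * (M + m + (#marks + #ctx + 1))) ^ 2)
  few-states le = ℕ.≤-trans
    (Bounds.states-bound M rounds (m + (#marks + #marks)) (#marks + #ctx) J′.ColPal
      (ℕ.≤-trans palette-bound (ℕ.^-monoʳ-≤ 2 (ℕ.+-monoˡ-≤ (#marks + #marks) le))) h #marks #ctx ℕ.≤-refl)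
    (tow-mono (suc h) (Bounds.a₀-bound M m #marks #ctx))

-- The empty conjunction is a trivial equation and needs a variable, hence `suc m`.
conjunction : ∀ {V m k} n → (Fin n → Form V (suc m) k) → Form V (suc m) k
conjunction zero    φ = eq zero zero
conjunction (suc n) φ = and (φ zero) (conjunction n (φ ∘ suc))

Within-conjunction : ∀ {V m k} {Q : Fin (nrel V) → Set} {M d} n (φ : Fin n → Form V (suc m) k) →
                     Within Q M d (conjunction n φ) → ∀ R → Within Q M d (φ R)
Within-conjunction (suc n) φ (w , _) zero    = w
Within-conjunction (suc n) φ (_ , w) (suc R) = Within-conjunction n (φ ∘ suc) w R

module Interpretation {r L : ℕ} (I : Interp (BinVoc r) (TreeVoc L)) where

  -- A device to obtain one modulus and one number of rounds for all formulas of `I` at once.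
  allFormulas : Form (TreeVoc L) 2 0
  allFormulas = and (ren suc id (ν I)) (conjunction r (η I))

  instance
    modulus-nonZero : NonZero (lcmMod allFormulas)
    modulus-nonZero = lcmMod-nonZero allFormulas

  within-all : Within (UsesOnly (allFin L)) (lcmMod allFormulas) (len allFormulas) allFormulas
  within-all = within allFormulas (λ _ → ∈-allFin _) (∣-lcm (moduli allFormulas)) ℕ.≤-refl

  open Outer I (lcmMod allFormulas) (len allFormulas) using (#marks; #ctx)

  -- Fixed before ψ and `J`: the number of marked types and of contexts over them; the summand 1
  -- keeps the base positive.
  ι : ℕ
  ι = #marks + #ctx + 1

  module _ {L′ : ℕ} {𝒮 : Structure (BinVoc r) → Set} (her : Hereditary 𝒮)
    (ψ : Form (BinVoc r) 0 0) (h : ℕ) (𝒰 : Tree L′ → Set) (height≤h : ∀ T → 𝒰 T → height T ≤ h)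
    (J : Interp (BinVoc r) (TreeVoc L′)) (classJ : ∀ C → 𝒮 C → Σ _ λ U → 𝒰 U × IsInterpretedBy J (treeStr U) C) where

    private
      ψᴶ = translate J ψ
      instance
        modulusᴶ-nonZero : NonZero (lcmMod ψᴶ)
        modulusᴶ-nonZero = lcmMod-nonZero ψᴶ

    within-ψᴶ : Within (UsesOnly (labels ψᴶ)) (lcmMod ψᴶ) (len ψᴶ) ψᴶ
    within-ψᴶ = within ψᴶ id (∣-lcm (moduli ψᴶ)) ℕ.≤-refl

    open Assembly her I (lcmMod allFormulas) (len allFormulas)
      (Within-ren (ν I) (proj₁ within-all)) (Within-conjunction r (η I) (proj₂ within-all))
      ψ h 𝒰 height≤h J classJ (labels ψᴶ) (lcmMod ψᴶ) (len ψᴶ)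
      (Within-ν J ψ within-ψᴶ) (Within-η J ψ within-ψᴶ) (Within-translate J ψ within-ψᴶ)

    result : {𝒯 : Tree L → Set} → (∀ T → 𝒯 T → IsBinary T) →
             (∀ T → 𝒯 T → Σ _ λ C → 𝒮 C × IsInterpretedBy I (treeStr T) C) →
             Σ (DTA L) λ 𝒜 →
               (∀ T → 𝒯 T → (Accepts 𝒜 T ⇔ (treeStr T ⊨ translate I ψ))) ×
               (states 𝒜 ≤ tow (suc h) ((7 * (lcmMod ψᴶ + len ψᴶ + ι)) ^ 2))
    result {𝒯} binary classI = 𝒜 , correct , few-states (length-labels ψᴶ)
      where
      correct : ∀ T → 𝒯 T → Accepts 𝒜 T ⇔ (treeStr T ⊨ translate I ψ)
      correct T T∈𝒯 = let C , C∈𝒮 , i = classI T T∈𝒯 in accepts T (binary T T∈𝒯) C C∈𝒮 i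

theorem4 : Σ ℕ λ c →
    ∀ (r : ℕ) (𝒮 : Structure (BinVoc r) → Set) → Hereditary 𝒮 →
    ∀ (L : ℕ) (𝒯 : Tree L → Set) → (∀ T → 𝒯 T → IsBinary T) →
    (I : Interp (BinVoc r) (TreeVoc L)) → InterpClass I 𝒮 𝒯 → HereditaryInterp I 𝒯 →
    Σ ℕ λ ι →
    ∀ (ψ : Form (BinVoc r) 0 0) (h L′ : ℕ) (𝒰 : Tree L′ → Set) →
    (∀ T → 𝒰 T → height T ≤ h) →
    (J : Interp (BinVoc r) (TreeVoc L′)) → InterpClass J 𝒮 𝒰 → HereditaryInterp J 𝒰 →
    Σ (DTA L) λ 𝒜 →
    (∀ T → 𝒯 T → (Accepts 𝒜 T ⇔ (treeStr T ⊨ translate I ψ))) ×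
    (states 𝒜 ≤ tow (suc h) ((c * (lcmMod (translate J ψ) + len (translate J ψ) + ι)) ^ 2))
theorem4 = 7 , λ r 𝒮 hereditary L 𝒯 binary I classI _ → Interpretation.ι I , λ ψ h L′ 𝒰 height≤h J classJ _ →
  Interpretation.result I hereditary ψ h 𝒰 height≤h J (proj₁ classJ) binary (proj₂ classI)
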